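{- Let $n\ge 2$. If $\Gamma$ is a polygonal digraph of order $n$, then $\operatorname{sp}(\Gamma)\le n$. Moreover, this bound is sharp for every order $n\ge 4$: for every integer $n\ge 4$ there exists a polygonal digraph $\Gamma$ of order $n$ with $\operatorname{sp}(\Gamma)=n$.
   Context: A simple digraph $\Gamma=(V,E)$ of order $n$ has vertex set $V=\{1,\dots,n\}$ and edge set $E\subseteq V\times V$ with no loops and no multi-edges (both $(i,j)$ and $(j,i)$ may be edges). Its adjacency matrix is $A=[a_{ij}]$ with $a_{ij}=1$ if $(i,j)\in E$ and $a_{ij}=0$ otherwise, and its Laplacian matrix is $L=D-A$, where $D$ is the diagonal matrix whose $i$th diagonal entry is the out-degree $d^+(i)$ (the number of edges of the form $(i,j)\in E$). Let $\mathbf{e}$ be the all ones vector in $\mathbb{R}^n$. For $n\ge 2$ define \[ \alpha(\Gamma)=\min_{\mathbf{x}\in\mathbb{R}^n,\ \mathbf{x}\perp\mathbf{e},\ \|\mathbf{x}\|=1}\mathbf{x}^TL\mathbf{x},\qquad \beta(\Gamma)=\max_{\mathbf{x}\in\mathbb{R}^n,\ \mathbf{x}\perp\mathbf{e},\ \|\mathbf{x}\|=1}\mathbf{x}^TL\mathbf{x}, \] where $\|\cdot\|$ is the Euclidean norm. The Laplacian spread is $\operatorname{sp}(\Gamma)=\beta(\Gamma)-\alpha(\Gamma)$. The restricted numerical range of $\Gamma$ is $W_r(\Gamma)=W_r(L)=\{\mathbf{x}^*L\mathbf{x}:\mathbf{x}\in\mathbb{C}^n,\ \mathbf{x}\perp\mathbf{e},\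 \|\mathbf{x}\|=1\}\subset\mathbb{C}$. A restrictor matrix of order $n$ is an $n\times(n-1)$ matrix $Q$ whose columns form an orthonormal basis of $\mathbf{e}^{\perp}$. A digraph $\Gamma$ is polygonal if $W_r(\Gamma)$ is a convex polygon in the complex plane (degenerate cases, i.e. a single point or a line segment, are allowed), that is, $W_r(\Gamma)$ equals the convex hull of the eigenvalues of $Q^*LQ$ for any restrictor matrix $Q$ of order $n$. -}

module Defs where

open import Algebra.Bundles using (RawMonoid; RawRing)
open import Algebra.Definitions.RawMonoid using (sum) renaming (_×_ to multiple)
open import Data.Bool.Base using (Bool; false; if_then_else_)
open import Data.Fin.Base using (Fin)
open import Data.Fin.Properties using (_≟_)
open import Data.Fin.Subset using (∣_∣)
open import Data.Nat.Base as ℕ using (ℕ; _⊔_; pred)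
import Data.Nat.Properties as ℕ
open import Data.Product.Base using (Σ-syntax; ∃-syntax; _×_; _,_)
open import Data.Rational.Base as ℚ using (ℚ; 0ℚ; 1ℚ; ½; 1/_)
import Data.Rational.Properties as ℚ
open import Data.Rational.Solver using (module +-*-Solver)
open import Data.Vec.Base using (tabulate)
open import Data.Vec.Functional using (Vector)
open import Level using (0ℓ)
open import Relation.Binary.PropositionalEquality
  using (_≡_; refl; sym; trans; cong; subst)
open import Relation.Nullary using (¬_; does)
open import Relation.Unary using (Pred; _≐_)

-- A real number is a Cauchy sequence of rationals; equality of reals is _≈ℝ_.

IsCauchy : (ℕ → ℚ) → Set
IsCauchy s = ∀ {ε} → 0ℚ ℚ.< ε →
  ∃[ N ] ∀ {m n} → N ℕ.≤ m → N ℕ.≤ n → ℚ.∣ s m ℚ.- s n ∣ ℚ.< ε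

record ℝ : Set where
  constructor mkℝ
  field
    seq    : ℕ → ℚ
    cauchy : IsCauchy seq

open ℝ public

infix 4 _≈ℝ_ _≤ℝ_

_≈ℝ_ : ℝ → ℝ → Set
x ≈ℝ y = ∀ {ε} → 0ℚ ℚ.< ε →
  ∃[ N ] ∀ {n} → N ℕ.≤ n → ℚ.∣ seq x n ℚ.- seq y n ∣ ℚ.< ε

_≤ℝ_ : ℝ → ℝ → Set
x ≤ℝ y = ∀ {ε} → 0ℚ ℚ.< ε →
  ∃[ N ] ∀ {n} → N ℕ.≤ n → seq x n ℚ.- seq y n ℚ.< ε

private
  open +-*-Solver using (solve; _:+_; _:*_; _:-_; :-_; _:=_)

  abstract
    half-pos : ∀ {ε} → 0ℚ ℚ.< ε → 0ℚ ℚ.< ½ ℚ.* ε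
    half-pos {ε} 0<ε = subst (ℚ._< ½ ℚ.* ε) (ℚ.*-zeroʳ ½) (ℚ.*-monoʳ-<-pos ½ 0<ε)

    half+half : ∀ ε → ½ ℚ.* ε ℚ.+ ½ ℚ.* ε ≡ ε
    half+half ε = trans (sym (ℚ.*-distribʳ-+ ε ½ ½)) (ℚ.*-identityˡ ε)

    const-cauchy : ∀ q → IsCauchy (λ _ → q)
    const-cauchy q {ε} 0<ε =
      0 , λ _ _ → subst (λ d → ℚ.∣ d ∣ ℚ.< ε) (sym (ℚ.+-inverseʳ q)) 0<ε

    neg-cauchy : ∀ {s} → IsCauchy s → IsCauchy (λ n → ℚ.- s n)
    neg-cauchy {s} cs {ε} 0<ε with N , close ← cs 0<ε =
      N , λ {m} {n} N≤m N≤n →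
        subst (ℚ._< ε)
          (trans (sym (ℚ.∣-p∣≡∣p∣ (s m ℚ.- s n)))
                 (cong ℚ.∣_∣ (solve 2 (λ a b → :- (a :- b) := (:- a) :- (:- b)) refl (s m) (s n))))
          (close N≤m N≤n)

    +-cauchy : ∀ {s t} → IsCauchy s → IsCauchy t → IsCauchy (λ n → s n ℚ.+ t n)
    +-cauchy {s} {t} cs ct {ε} 0<ε
      with N , s-close ← cs (half-pos 0<ε) | M , t-close ← ct (half-pos 0<ε) =
      N ⊔ M , λ {m} {n} ≤m ≤n → begin-strict
        ℚ.∣ (s m ℚ.+ t m) ℚ.- (s n ℚ.+ t n) ∣
          ≡⟨ cong ℚ.∣_∣ (solve 4 (λ a b c d → (a :+ b) :- (c :+ d) := (a :- c) :+ (b :- d))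
                           refl (s m) (t m) (s n) (t n)) ⟩
        ℚ.∣ (s m ℚ.- s n) ℚ.+ (t m ℚ.- t n) ∣
          ≤⟨ ℚ.∣p+q∣≤∣p∣+∣q∣ (s m ℚ.- s n) (t m ℚ.- t n) ⟩
        ℚ.∣ s m ℚ.- s n ∣ ℚ.+ ℚ.∣ t m ℚ.- t n ∣
          <⟨ ℚ.+-mono-< (s-close (ℕ.m⊔n≤o⇒m≤o N M ≤m) (ℕ.m⊔n≤o⇒m≤o N M ≤n))
                        (t-close (ℕ.m⊔n≤o⇒n≤o N M ≤m) (ℕ.m⊔n≤o⇒n≤o N M ≤n)) ⟩
        ½ ℚ.* ε ℚ.+ ½ ℚ.* ε
          ≡⟨ half+half ε ⟩
        ε ∎
      where open ℚ.≤-Reasoning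

    eventually-bounded : ∀ {s} → IsCauchy s →
      ∃[ B ] ℚ.Positive B × ∃[ N ] ∀ {n} → N ℕ.≤ n → ℚ.∣ s n ∣ ℚ.≤ B
    eventually-bounded {s} cs with N , close ← cs (ℚ.positive⁻¹ 1ℚ) =
      1ℚ ℚ.+ ℚ.∣ s N ∣
      , ℚ.pos+nonNeg⇒pos 1ℚ ℚ.∣ s N ∣ {{ℚ.nonNegative (ℚ.0≤∣p∣ (s N))}}
      , N , λ {n} N≤n → begin
        ℚ.∣ s n ∣
          ≡⟨ cong ℚ.∣_∣ (solve 2 (λ a b → a := (a :- b) :+ b) refl (s n) (s N)) ⟩
        ℚ.∣ (s n ℚ.- s N) ℚ.+ s N ∣
          ≤⟨ ℚ.∣p+q∣≤∣p∣+∣q∣ (s n ℚ.- s N) (s N) ⟩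
        ℚ.∣ s n ℚ.- s N ∣ ℚ.+ ℚ.∣ s N ∣
          ≤⟨ ℚ.+-monoˡ-≤ ℚ.∣ s N ∣ (ℚ.<⇒≤ (close N≤n ℕ.≤-refl)) ⟩
        1ℚ ℚ.+ ℚ.∣ s N ∣ ∎
      where open ℚ.≤-Reasoning

    -- ∣ a ∣ ≤ B and ∣ d ∣ < (ε / 2) / B give ∣ a d ∣ < ε / 2
    module _ (B : ℚ) (B>0 : ℚ.Positive B) where
      private instance
        _ = B>0
        _ = ℚ.pos⇒nonZero B
        _ = ℚ.pos⇒nonNeg B
        _ = ℚ.1/pos⇒pos B

      share : ℚ → ℚ
      share ε = 1/ B ℚ.* (½ ℚ.* ε)

      share-pos : ∀ {ε} → 0ℚ ℚ.< ε → 0ℚ ℚ.< share ε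
      share-pos {ε} 0<ε =
        subst (ℚ._< share ε) (ℚ.*-zeroʳ (1/ B)) (ℚ.*-monoʳ-<-pos (1/ B) (half-pos 0<ε))

      share-bound : ∀ {ε} a d → ℚ.∣ a ∣ ℚ.≤ B → ℚ.∣ d ∣ ℚ.< share ε →
                    ℚ.∣ a ℚ.* d ∣ ℚ.< ½ ℚ.* ε
      share-bound {ε} a d a≤B d< = begin-strict
        ℚ.∣ a ℚ.* d ∣
          ≡⟨ ℚ.∣p*q∣≡∣p∣*∣q∣ a d ⟩
        ℚ.∣ a ∣ ℚ.* ℚ.∣ d ∣
          ≤⟨ ℚ.*-monoʳ-≤-nonNeg ℚ.∣ d ∣ {{ℚ.nonNegative (ℚ.0≤∣p∣ d)}} a≤B ⟩
        B ℚ.* ℚ.∣ d ∣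
          <⟨ ℚ.*-monoʳ-<-pos B d< ⟩
        B ℚ.* share ε
          ≡⟨ sym (ℚ.*-assoc B (1/ B) (½ ℚ.* ε)) ⟩
        (B ℚ.* 1/ B) ℚ.* (½ ℚ.* ε)
          ≡⟨ cong (ℚ._* (½ ℚ.* ε)) (ℚ.*-inverseʳ B) ⟩
        1ℚ ℚ.* (½ ℚ.* ε)
          ≡⟨ ℚ.*-identityˡ (½ ℚ.* ε) ⟩
        ½ ℚ.* ε ∎
        where open ℚ.≤-Reasoning

    difference-of-products : ∀ a b c d →
      a ℚ.* b ℚ.- c ℚ.* d ≡ a ℚ.* (b ℚ.- d) ℚ.+ d ℚ.* (a ℚ.- c)
    difference-of-products =
      solve 4 (λ a b c d → a :* b :- c :* d := a :* (b :- d) :+ d :* (a :- c)) refl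

    *-close : ∀ {B C} (B>0 : ℚ.Positive B) (C>0 : ℚ.Positive C) {ε} a b c d →
      ℚ.∣ a ∣ ℚ.≤ B → ℚ.∣ d ∣ ℚ.≤ C →
      ℚ.∣ b ℚ.- d ∣ ℚ.< share B B>0 ε → ℚ.∣ a ℚ.- c ∣ ℚ.< share C C>0 ε →
      ℚ.∣ a ℚ.* b ℚ.- c ℚ.* d ∣ ℚ.< ε
    *-close {B} {C} B>0 C>0 {ε} a b c d a≤B d≤C b-d< a-c< = begin-strict
      ℚ.∣ a ℚ.* b ℚ.- c ℚ.* d ∣
        ≡⟨ cong ℚ.∣_∣ (difference-of-products a b c d) ⟩
      ℚ.∣ a ℚ.* (b ℚ.- d) ℚ.+ d ℚ.* (a ℚ.- c) ∣
        ≤⟨ ℚ.∣p+q∣≤∣p∣+∣q∣ (a ℚ.* (b ℚ.- d)) (d ℚ.* (a ℚ.- c)) ⟩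
      ℚ.∣ a ℚ.* (b ℚ.- d) ∣ ℚ.+ ℚ.∣ d ℚ.* (a ℚ.- c) ∣
        <⟨ ℚ.+-mono-< (share-bound B B>0 {ε} a (b ℚ.- d) a≤B b-d<)
                      (share-bound C C>0 {ε} d (a ℚ.- c) d≤C a-c<) ⟩
      ½ ℚ.* ε ℚ.+ ½ ℚ.* ε
        ≡⟨ half+half ε ⟩
      ε ∎
      where open ℚ.≤-Reasoning

    *-cauchy : ∀ {s t} → IsCauchy s → IsCauchy t → IsCauchy (λ n → s n ℚ.* t n)
    *-cauchy {s} {t} cs ct {ε} 0<ε =
      let B , B>0 , N₁ , s≤B = eventually-bounded {s} cs
          C , C>0 , N₂ , t≤C = eventually-bounded {t} ct
          N₃ , s-close = cs (share-pos C C>0 0<ε)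
          N₄ , t-close = ct (share-pos B B>0 0<ε)
      in (N₁ ⊔ N₂) ⊔ (N₃ ⊔ N₄) , λ {m} {n} ≤m ≤n →
        let N₁₂≤m = ℕ.m⊔n≤o⇒m≤o (N₁ ⊔ N₂) (N₃ ⊔ N₄) ≤m
            N₁₂≤n = ℕ.m⊔n≤o⇒m≤o (N₁ ⊔ N₂) (N₃ ⊔ N₄) ≤n
            N₃₄≤m = ℕ.m⊔n≤o⇒n≤o (N₁ ⊔ N₂) (N₃ ⊔ N₄) ≤m
            N₃₄≤n = ℕ.m⊔n≤o⇒n≤o (N₁ ⊔ N₂) (N₃ ⊔ N₄) ≤n
        in *-close B>0 C>0 {ε} (s m) (t m) (s n) (t n)
             (s≤B (ℕ.m⊔n≤o⇒m≤o N₁ N₂ N₁₂≤m))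
             (t≤C (ℕ.m⊔n≤o⇒n≤o N₁ N₂ N₁₂≤n))
             (t-close (ℕ.m⊔n≤o⇒n≤o N₃ N₄ N₃₄≤m) (ℕ.m⊔n≤o⇒n≤o N₃ N₄ N₃₄≤n))
             (s-close (ℕ.m⊔n≤o⇒m≤o N₃ N₄ N₃₄≤m) (ℕ.m⊔n≤o⇒m≤o N₃ N₄ N₃₄≤n))

infixl 6 _+ℝ_ _-ℝ_
infixl 7 _*ℝ_
infix  8 -ℝ_

fromℚ : ℚ → ℝ
fromℚ q = mkℝ (λ _ → q) (const-cauchy q)

0ℝ 1ℝ : ℝ
0ℝ = fromℚ 0ℚ
1ℝ = fromℚ 1ℚ

-ℝ_ : ℝ → ℝ
-ℝ x = mkℝ (λ n → ℚ.- seq x n) (neg-cauchy {seq x} (cauchy x))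

_+ℝ_ _*ℝ_ _-ℝ_ : ℝ → ℝ → ℝ
x +ℝ y = mkℝ (λ n → seq x n ℚ.+ seq y n) (+-cauchy {seq x} {seq y} (cauchy x) (cauchy y))
x *ℝ y = mkℝ (λ n → seq x n ℚ.* seq y n) (*-cauchy {seq x} {seq y} (cauchy x) (cauchy y))
x -ℝ y = x +ℝ (-ℝ y)

ℝ-rawRing : RawRing 0ℓ 0ℓ
ℝ-rawRing = record
  { Carrier = ℝ ; _≈_ = _≈ℝ_ ; _+_ = _+ℝ_ ; _*_ = _*ℝ_ ; -_ = -ℝ_ ; 0# = 0ℝ ; 1# = 1ℝ }

record ℂ : Set where
  constructor _+i_
  field
    re im : ℝ

open ℂ public

infix 4 _≈ℂ_

_≈ℂ_ : ℂ → ℂ → Set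
z ≈ℂ w = (re z ≈ℝ re w) × (im z ≈ℝ im w)

conj : ℂ → ℂ
conj z = re z +i (-ℝ im z)

fromℝ : ℝ → ℂ
fromℝ x = x +i 0ℝ

ℂ-rawRing : RawRing 0ℓ 0ℓ
ℂ-rawRing = record
  { Carrier = ℂ
  ; _≈_     = _≈ℂ_
  ; _+_     = λ z w → (re z +ℝ re w) +i (im z +ℝ im w)
  ; _*_     = λ z w → (re z *ℝ re w -ℝ im z *ℝ im w) +i (re z *ℝ im w +ℝ im z *ℝ re w)
  ; -_      = λ z → (-ℝ re z) +i (-ℝ im z)
  ; 0#      = fromℝ 0ℝ
  ; 1#      = fromℝ 1ℝ
  }

module LinearAlgebra (R : RawRing 0ℓ 0ℓ) where
  open RawRing R

  Vec : ℕ → Set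
  Vec = Vector Carrier

  Matrix : ℕ → ℕ → Set
  Matrix m n = Fin m → Fin n → Carrier

  infix  4 _≋_
  infixl 7 _·_ _*ᵥ_ _*ₘ_

  _≋_ : ∀ {n} → Vec n → Vec n → Set
  x ≋ y = ∀ i → x i ≈ y i

  ∑ : ∀ {n} → Vec n → Carrier
  ∑ = sum +-rawMonoid

  -- bilinear, also over ℂ
  _·_ : ∀ {n} → Vec n → Vec n → Carrier
  x · y = ∑ λ i → x i * y i

  _*ᵥ_ : ∀ {m n} → Matrix m n → Vec n → Vec m
  (M *ᵥ x) i = M i · x

  _*ₘ_ : ∀ {l m n} → Matrix l m → Matrix m n → Matrix l n
  (M *ₘ N) i j = M i · (λ k → N k j)

  𝟘 : ∀ {n} → Vec n
  𝟘 _ = 0#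

  𝐞 : ∀ {n} → Vec n
  𝐞 _ = 1#

  I : ∀ {n} → Matrix n n
  I i j = if does (i ≟ j) then 1# else 0#

  IsEigenvalue : ∀ {n} → Matrix n n → Pred Carrier 0ℓ
  IsEigenvalue M μ = ∃[ v ] ¬ (v ≋ 𝟘) × M *ᵥ v ≋ (λ i → μ * v i)

module ℝᴸ = LinearAlgebra ℝ-rawRing
module ℂᴸ = LinearAlgebra ℂ-rawRing

fromℕ : ℕ → ℝ
fromℕ n = multiple (RawRing.+-rawMonoid ℝ-rawRing) n 1ℝ

conjᵥ : ∀ {n} → ℂᴸ.Vec n → ℂᴸ.Vec n
conjᵥ x i = conj (x i)

infix 9 _ᴴ

_ᴴ : ∀ {m n} → ℂᴸ.Matrix m n → ℂᴸ.Matrix n m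
(M ᴴ) j i = conj (M i j)

complexify : ∀ {m n} → ℝᴸ.Matrix m n → ℂᴸ.Matrix m n
complexify M i j = fromℝ (M i j)

-- Unit vectors orthogonal to 𝐞; ‖ x ‖ = 1 is written ‖ x ‖² = 1.
UnitPerp𝐞ℝ : ∀ {n} → Pred (ℝᴸ.Vec n) 0ℓ
UnitPerp𝐞ℝ x = (ℝᴸ.𝐞 ℝᴸ.· x ≈ℝ 0ℝ) × (x ℝᴸ.· x ≈ℝ 1ℝ)

UnitPerp𝐞ℂ : ∀ {n} → Pred (ℂᴸ.Vec n) 0ℓ
UnitPerp𝐞ℂ x = (ℂᴸ.𝐞 ℂᴸ.· x ≈ℂ fromℝ 0ℝ) × (conjᵥ x ℂᴸ.· x ≈ℂ fromℝ 1ℝ)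

record IsRestrictor {n} (Q : ℂᴸ.Matrix n (pred n)) : Set where
  field
    columns⊥𝐞   : ∀ j → ℂᴸ.𝐞 ℂᴸ.· (λ i → Q i j) ≈ℂ fromℝ 0ℝ
    orthonormal : ∀ j k → (Q ᴴ ℂᴸ.*ₘ Q) j k ≈ℂ ℂᴸ.I j k
    spanning    : ∀ x → ℂᴸ.𝐞 ℂᴸ.· x ≈ℂ fromℝ 0ℝ → ∃[ c ] x ℂᴸ.≋ Q ℂᴸ.*ᵥ c

ConvexHull : Pred ℂ 0ℓ → Pred ℂ 0ℓ
ConvexHull S z =
  ∃[ k ] Σ[ t ∈ ℝᴸ.Vec k ] Σ[ p ∈ ℂᴸ.Vec k ]
    (∀ i → 0ℝ ≤ℝ t i) × (ℝᴸ.∑ t ≈ℝ 1ℝ) × (∀ i → S (p i)) ×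
    z ≈ℂ (λ i → fromℝ (t i)) ℂᴸ.· p

IsMinimum IsMaximum : Pred ℝ 0ℓ → Pred ℝ 0ℓ
IsMinimum S a = S a × (∀ r → S r → a ≤ℝ r)
IsMaximum S b = S b × (∀ r → S r → r ≤ℝ b)

record Digraph (n : ℕ) : Set where
  field
    edge     : Fin n → Fin n → Bool
    loopless : ∀ i → edge i i ≡ false

module _ {n} (Γ : Digraph n) where
  open Digraph Γ

  outDegree : Fin n → ℕ
  outDegree i = ∣ tabulate (edge i) ∣

  adjacency : ℝᴸ.Matrix n n
  adjacency i j = if edge i j then 1ℝ else 0ℝ

  degreeMatrix : ℝᴸ.Matrix n n
  degreeMatrix i j = if does (i ≟ j) then fromℕ (outDegree i) else 0ℝ

  laplacian : ℝᴸ.Matrix n n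
  laplacian i j = degreeMatrix i j -ℝ adjacency i j

  RestrictedForm : Pred ℝ 0ℓ
  RestrictedForm r = ∃[ x ] UnitPerp𝐞ℝ x × r ≈ℝ x ℝᴸ.· (laplacian ℝᴸ.*ᵥ x)

  -- A relation rather than a function: α and β are pinned down as the attained
  -- extrema (their existence is a compactness fact), so s is unique up to _≈ℝ_.
  IsSpread : Pred ℝ 0ℓ
  IsSpread s = ∃[ α ] ∃[ β ]
    IsMinimum RestrictedForm α × IsMaximum RestrictedForm β × s ≈ℝ β -ℝ α

  RestrictedNumericalRange : Pred ℂ 0ℓ
  RestrictedNumericalRange z =
    ∃[ x ] UnitPerp𝐞ℂ x × z ≈ℂ conjᵥ x ℂᴸ.· (complexify laplacian ℂᴸ.*ᵥ x)

  -- The eigenvalues are finitely many, so the hull is a convex polygon, possibly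
  -- a segment or a point.
  Polygonal : Set
  Polygonal = ∀ Q → IsRestrictor Q →
    RestrictedNumericalRange ≐
      ConvexHull (ℂᴸ.IsEigenvalue (Q ᴴ ℂᴸ.*ₘ complexify laplacian ℂᴸ.*ₘ Q))

{-# OPTIONS --safe #-}

-- A polygonal W_r is the convex hull of the eigenvalues μ of Q*LQ.  If Q*LQ v = μ v, then w = Q v is
-- orthogonal to 𝐞 and L w = μ w + c 𝐞 for some c.  As L 𝐞 = 0, the vector z = μ w + c 𝐞 satisfies L z = μ z.
-- If Re μ < 0, then row i of this equation, where ∣ zᵢ ∣ is maximal, forces z = 0, hence c = 0 and w = 0.
-- So Re μ ≥ 0.  The same argument for the weights 1 - aᵢⱼ, that is, for n I - J - L in place of L, gives
-- Re μ ≤ n.  As α and β belong to W_r, it follows that 0 ≤ α ≤ β ≤ n.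
--
-- The bound is attained by the digraph in which the vertices 0 and 1 are sinks and every other vertex has an
-- edge to all the others: for x ⊥ 𝐞 it has x*Lx = n ∑ ∣ xᵢ ∣² with the sum over i ≥ 2, so W_r is the
-- segment [0 , n], whose ends are eigenvalues with eigenvectors (1,-1,0,…) and (0,0,1,-1,0,…).
--
-- The constructive order of ℝ is ¬¬-stable, so inequalities may be proved by classical case distinctions.
module Submission where

open import Algebra.Bundles using (CommutativeRing; RawRing)
open import Algebra.Definitions.RawMonoid using () renaming (_×_ to multiple)
import Algebra.Properties.Ring
import Algebra.Properties.Semiring.Mult
import Algebra.Properties.Semiring.Sum
import Algebra.Solver.Ring
open import Algebra.Solver.Ring.AlmostCommutativeRing
  using (fromCommutativeRing; _-Raw-AlmostCommutative⟶_; Induced-equivalence)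
open import Data.Bool.Base using (Bool; true; false; if_then_else_; not; _∧_)
open import Data.Bool.Properties using (∧-zeroʳ)
open import Data.Fin.Base using (Fin; zero; suc)
open import Data.Fin.Properties using (_≟_)
open import Data.Fin.Subset using (∣_∣)
open import Data.Integer.Base as ℤ using (+_; +[1+_])
open import Data.Maybe.Base using (just; nothing)
open import Data.Nat.Base as ℕ using (ℕ; zero; suc; _⊔_; _≤_; s≤s; z≤n)
open import Data.Nat.Coprimality using (1-coprimeTo)
import Data.Nat.Properties as ℕ
open import Data.Nat.Solver using () renaming (module +-*-Solver to ℕSolve)
open import Data.Product.Base using (_×_; _,_; ∃-syntax; proj₁; proj₂)
open import Data.Rational.Base as ℚ using (ℚ; mkℚ; toℚᵘ; 0ℚ; 1ℚ; ½; 1/_)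
import Data.Rational.Properties as ℚ
open import Data.Rational.Solver using () renaming (module +-*-Solver to ℚSolve)
import Data.Rational.Unnormalised.Base as ℚᵘ
import Data.Rational.Unnormalised.Properties as ℚᵘ
open import Data.Sum.Base using (_⊎_; inj₁; inj₂)
open import Data.Vec.Base using (tabulate)
open import Level using (0ℓ)
open import Relation.Binary.Core using (Rel)
open import Relation.Binary.Definitions using (WeaklyDecidable)
open import Relation.Binary.PropositionalEquality
  using (_≡_; refl; sym; trans; cong; cong₂; subst; subst₂)
import Relation.Binary.Reasoning.Setoid
open import Relation.Binary.Structures using (IsPartialOrder)
open import Relation.Nullary using (¬_; does; yes; no; contradiction)
open import Relation.Nullary.Decidable using (dec-true)
open import Relation.Unary using (Pred; _⊆_)
open import Defs

-- `Polygonal` speaks of every restrictor and yields nothing until one is at hand, so the bound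
-- requires a restrictor of each order n ≥ 2. A closed formula, columns of a Householder reflection,
-- reduces this to the single irrational number 1/√n. Square roots return in the example: the hull
-- lies in W_r only if each value in [0 , n] is attained by a unit vector, and such a vector is
-- written down with entries depending on √(t/2) and √((1 - t)/2) instead of being found by
-- continuity. All these radicands lie in [0 , 1].
--
-- Real numbers cannot be compared by a decision, so a maximal entry exists only up to double
-- negation, and division by a nonzero number is replaced by cancellation of a factor `y` with
-- `¬ (y ≤ 0)`. Both suffice because every conclusion drawn from them is an inequality or an
-- equality of reals, hence stable.

private variable
  l m n : ℕ

-- The reals as an ordered ring

Eventually : (ℕ → Set) → Set
Eventually P = ∃[ N ] ∀ {n} → N ℕ.≤ n → P n

private variable P P′ P″ : ℕ → Set

always : (∀ n → P n) → Eventually P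
always p = 0 , λ {n} _ → p n

ev-map : (∀ n → P n → P′ n) → Eventually P → Eventually P′
ev-map f (N , p) = N , λ {n} N≤n → f n (p N≤n)

ev-zip : (∀ n → P n → P′ n → P″ n) → Eventually P → Eventually P′ → Eventually P″
ev-zip f (N , p) (M , q) = N ⊔ M , λ {n} ≤n →
  f n (p (ℕ.m⊔n≤o⇒m≤o N M ≤n)) (q (ℕ.m⊔n≤o⇒n≤o N M ≤n))

half : ℚ → ℚ
half ε = ½ ℚ.* ε

half-pos : ∀ {ε} → 0ℚ ℚ.< ε → 0ℚ ℚ.< half ε
half-pos {ε} 0<ε = subst (ℚ._< half ε) (ℚ.*-zeroʳ ½) (ℚ.*-monoʳ-<-pos ½ 0<ε)

half+half : ∀ ε → half ε ℚ.+ half ε ≡ ε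
half+half = solve 1 (λ e → con ½ :* e :+ con ½ :* e := e) refl
  where open ℚSolve

p≤∣p∣ : ∀ p → p ℚ.≤ ℚ.∣ p ∣
p≤∣p∣ p with ℚ.≤-total 0ℚ p
... | inj₁ 0≤p = ℚ.≤-reflexive (sym (ℚ.0≤p⇒∣p∣≡p 0≤p))
... | inj₂ p≤0 = ℚ.≤-trans p≤0 (ℚ.0≤∣p∣ p)

∣-∣<-intro : ∀ {p ε} → p ℚ.< ε → ℚ.- p ℚ.< ε → ℚ.∣ p ∣ ℚ.< ε
∣-∣<-intro {p} {ε} p<ε -p<ε with ℚ.∣p∣≡p∨∣p∣≡-p p
... | inj₁ eq = subst (ℚ._< ε) (sym eq) p<ε
... | inj₂ eq = subst (ℚ._< ε) (sym eq) -p<ε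

p≤p+q : ∀ p {q} → 0ℚ ℚ.≤ q → p ℚ.≤ p ℚ.+ q
p≤p+q p {q} 0≤q = subst (ℚ._≤ p ℚ.+ q) (ℚ.+-identityʳ p) (ℚ.+-monoʳ-≤ p 0≤q)

neg-diff : ∀ p q → ℚ.- (p ℚ.- q) ≡ q ℚ.- p
neg-diff = solve 2 (λ p q → :- (p :- q) := q :- p) refl
  where open ℚSolve

*-pos : ∀ {p q} → 0ℚ ℚ.< p → 0ℚ ℚ.< q → 0ℚ ℚ.< p ℚ.* q
*-pos {p} {q} 0<p 0<q = ℚ.positive⁻¹ (p ℚ.* q)
  {{ℚ.pos*pos⇒pos p {{ℚ.positive 0<p}} q {{ℚ.positive 0<q}}}}

*-mono-≤-nonNeg : ∀ {p q r s} → 0ℚ ℚ.≤ q → 0ℚ ℚ.≤ r → p ℚ.≤ q → r ℚ.≤ s → p ℚ.* r ℚ.≤ q ℚ.* s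
*-mono-≤-nonNeg {p} {q} {r} {s} 0≤q 0≤r p≤q r≤s = ℚ.≤-trans
  (ℚ.*-monoʳ-≤-nonNeg r {{ℚ.nonNegative 0≤r}} p≤q)
  (ℚ.*-monoˡ-≤-nonNeg q {{ℚ.nonNegative 0≤q}} r≤s)

-- Unlike _≈ℝ_ and _≤ℝ_, which unfold to function types, these records let Agda infer x and y.
infix 4 _≃_ _≼_ _<ℝ_

record _≃_ (x y : ℝ) : Set where
  constructor ≃-in
  field ≃-out : x ≈ℝ y

record _≼_ (x y : ℝ) : Set where
  constructor ≼-in
  field ≼-out : x ≤ℝ y

open _≃_ public
open _≼_ public

record _<ℝ_ (x y : ℝ) : Set where
  constructor <-in
  field
    {gap}   : ℚ
    gap-pos : 0ℚ ℚ.< gap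
    far     : Eventually (λ n → gap ℚ.≤ seq y n ℚ.- seq x n)

-- All late terms of x - y lie within ε/4 of one term, and that term is a rational which can be
-- compared with ε/2. If it is at least ε/2, the later ones stay above ε/4; otherwise they stay
-- below 3ε/4.
<ℝ-or-close : ∀ x y {ε} → 0ℚ ℚ.< ε → (y <ℝ x) ⊎ Eventually (λ n → seq x n ℚ.- seq y n ℚ.< ε)
<ℝ-or-close x y {ε} 0<ε = decide (cauchy d {η} 0<η)
  where
  open ℚSolve
  d = x -ℝ y
  η = half (half ε)
  0<η : 0ℚ ℚ.< η
  0<η = half-pos (half-pos 0<ε)
  decide : (∃[ N ] ∀ {m n} → N ℕ.≤ m → N ℕ.≤ n → ℚ.∣ seq d m ℚ.- seq d n ∣ ℚ.< η) →
           (y <ℝ x) ⊎ Eventually (λ n → seq d n ℚ.< ε)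
  decide (N , near) with half ε ℚ.≤? seq d N
  ... | yes large = inj₁ (<-in 0<η (N , λ {n} N≤n → begin
      η
        ≡⟨ solve 1 (λ e → con ½ :* (con ½ :* e) := con ½ :* e :- con ½ :* (con ½ :* e)) refl ε ⟩
      half ε ℚ.- η
        ≤⟨ ℚ.+-mono-≤ large (ℚ.neg-antimono-≤ (ℚ.≤-trans (p≤∣p∣ _) (ℚ.<⇒≤ (near ℕ.≤-refl N≤n)))) ⟩
      seq d N ℚ.- (seq d N ℚ.- seq d n)
        ≡⟨ solve 2 (λ a b → a :- (a :- b) := b) refl (seq d N) (seq d n) ⟩
      seq d n ∎))
    where open ℚ.≤-Reasoning
  ... | no small = inj₂ (N , λ {n} N≤n → begin-strict
      seq d n
        ≡⟨ solve 2 (λ a b → b := (b :- a) :+ a) refl (seq d N) (seq d n) ⟩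
      (seq d n ℚ.- seq d N) ℚ.+ seq d N
        <⟨ ℚ.+-mono-< (ℚ.≤-<-trans (p≤∣p∣ _) (near N≤n ℕ.≤-refl)) (ℚ.≰⇒> small) ⟩
      η ℚ.+ half ε
        <⟨ ℚ.+-monoˡ-< (half ε) η<half ⟩
      half ε ℚ.+ half ε
        ≡⟨ half+half ε ⟩
      ε ∎)
    where
    open ℚ.≤-Reasoning
    η<half : η ℚ.< half ε
    η<half = subst₂ ℚ._<_ (ℚ.+-identityˡ η) (half+half (half ε)) (ℚ.+-monoˡ-< η 0<η)

≮⇒≽ : ∀ {x y} → ¬ (y <ℝ x) → x ≼ y
≮⇒≽ {x} {y} y≮x = ≼-in λ 0<ε → case (<ℝ-or-close x y 0<ε)
  where
  case : ∀ {P : Set} → (y <ℝ x) ⊎ P → P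
  case (inj₁ y<x) = contradiction y<x y≮x
  case (inj₂ p)   = p

≼⇒≯ : ∀ {x y} → x ≼ y → ¬ (y <ℝ x)
≼⇒≯ (≼-in x≤y) (<-in 0<δ far) =
  let N , absurd = ev-zip (λ _ < ≥ → ℚ.<-irrefl refl (ℚ.<-≤-trans < ≥)) (x≤y 0<δ) far
  in absurd (ℕ.≤-refl {N})

<⇒≼ : ∀ {x y} → x <ℝ y → x ≼ y
<⇒≼ {x} {y} (<-in {δ} 0<δ far) = ≼-in λ {ε} 0<ε → ev-map (λ n δ≤ → begin-strict
  seq x n ℚ.- seq y n       ≡⟨ sym (neg-diff (seq y n) (seq x n)) ⟩
  ℚ.- (seq y n ℚ.- seq x n) ≤⟨ ℚ.neg-antimono-≤ δ≤ ⟩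
  ℚ.- δ                     <⟨ ℚ.neg-antimono-< 0<δ ⟩
  0ℚ                        <⟨ 0<ε ⟩
  ε ∎) far
  where open ℚ.≤-Reasoning

-- `≮⇒≽` and `≼⇒≯` make `_≼_` equivalent to a negated statement. This is what permits classical case
-- distinctions in proofs of inequalities.
≼-stable : ∀ {x y} → ¬ ¬ (x ≼ y) → x ≼ y
≼-stable x≼y = ≮⇒≽ λ y<x → x≼y λ x≼y → ≼⇒≯ x≼y y<x

≰⇒≽ : ∀ {x y} → ¬ (x ≼ y) → y ≼ x
≰⇒≽ x⋠y = ≮⇒≽ λ x<y → x⋠y (<⇒≼ x<y)

≼-trans : ∀ {x y z} → x ≼ y → y ≼ z → x ≼ z
≼-trans {x} {y} {z} (≼-in x≤y) (≼-in y≤z) = ≼-in λ {ε} 0<ε →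
  ev-zip (λ n p q → begin-strict
    seq x n ℚ.- seq z n
      ≡⟨ solve 3 (λ a b c → a :- c := (a :- b) :+ (b :- c)) refl (seq x n) (seq y n) (seq z n) ⟩
    (seq x n ℚ.- seq y n) ℚ.+ (seq y n ℚ.- seq z n)
      <⟨ ℚ.+-mono-< p q ⟩
    half ε ℚ.+ half ε
      ≡⟨ half+half ε ⟩
    ε ∎) (x≤y (half-pos 0<ε)) (y≤z (half-pos 0<ε))
  where open ℚ.≤-Reasoning
        open ℚSolve

≼-reflexive : ∀ {x y} → x ≃ y → x ≼ y
≼-reflexive (≃-in x≈y) = ≼-in λ 0<ε →
  ev-map (λ _ → ℚ.≤-<-trans (p≤∣p∣ _)) (x≈y 0<ε)

≼-antisym : ∀ {x y} → x ≼ y → y ≼ x → x ≃ y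
≼-antisym {x} {y} (≼-in x≤y) (≼-in y≤x) = ≃-in λ {ε} 0<ε →
  ev-zip (λ n p q → ∣-∣<-intro p (subst (ℚ._< ε) (sym (neg-diff (seq x n) (seq y n))) q))
    (x≤y 0<ε) (y≤x 0<ε)

pointwise-≼ : ∀ {x y} → (∀ n → seq x n ℚ.≤ seq y n) → x ≼ y
pointwise-≼ {x} {y} p = ≼-in λ 0<ε → always λ n →
  ℚ.≤-<-trans (subst (seq x n ℚ.- seq y n ℚ.≤_) (ℚ.+-inverseʳ (seq y n))
                 (ℚ.+-monoˡ-≤ (ℚ.- seq y n) (p n))) 0<ε

pointwise : ∀ {x y} → (∀ n → seq x n ≡ seq y n) → x ≃ y
pointwise p = ≼-antisym (pointwise-≼ λ n → ℚ.≤-reflexive (p n))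
                        (pointwise-≼ λ n → ℚ.≤-reflexive (sym (p n)))

≃-refl : ∀ {x} → x ≃ x
≃-refl = pointwise λ _ → refl

≃-sym : ∀ {x y} → x ≃ y → y ≃ x
≃-sym {x} {y} (≃-in x≈y) = ≃-in λ {ε} 0<ε → ev-map (λ n → subst (ℚ._< ε)
  (trans (sym (ℚ.∣-p∣≡∣p∣ (seq x n ℚ.- seq y n))) (cong ℚ.∣_∣ (neg-diff (seq x n) (seq y n)))))
  (x≈y 0<ε)

≃-trans : ∀ {x y z} → x ≃ y → y ≃ z → x ≃ z
≃-trans p q = ≼-antisym (≼-trans (≼-reflexive p) (≼-reflexive q))
                        (≼-trans (≼-reflexive (≃-sym q)) (≼-reflexive (≃-sym p)))

+ℝ-mono-≼ : ∀ {x y u v} → x ≼ y → u ≼ v → x +ℝ u ≼ y +ℝ v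
+ℝ-mono-≼ {x} {y} {u} {v} (≼-in x≤y) (≼-in u≤v) = ≼-in λ {ε} 0<ε →
  ev-zip (λ n p q → begin-strict
    (seq x n ℚ.+ seq u n) ℚ.- (seq y n ℚ.+ seq v n)
      ≡⟨ solve 4 (λ a b c d → (a :+ c) :- (b :+ d) := (a :- b) :+ (c :- d)) refl
           (seq x n) (seq y n) (seq u n) (seq v n) ⟩
    (seq x n ℚ.- seq y n) ℚ.+ (seq u n ℚ.- seq v n)
      <⟨ ℚ.+-mono-< p q ⟩
    half ε ℚ.+ half ε
      ≡⟨ half+half ε ⟩
    ε ∎) (x≤y (half-pos 0<ε)) (u≤v (half-pos 0<ε))
  where open ℚ.≤-Reasoning
        open ℚSolve

+ℝ-cong : ∀ {x y u v} → x ≃ y → u ≃ v → x +ℝ u ≃ y +ℝ v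
+ℝ-cong p q = ≼-antisym (+ℝ-mono-≼ (≼-reflexive p) (≼-reflexive q))
                        (+ℝ-mono-≼ (≼-reflexive (≃-sym p)) (≼-reflexive (≃-sym q)))

-ℝ-cong : ∀ {x y} → x ≃ y → -ℝ x ≃ -ℝ y
-ℝ-cong {x} {y} x≃y = ≃-in λ {ε} 0<ε → ev-map
  (λ n → subst (λ d → ℚ.∣ d ∣ ℚ.< ε)
    (solve 2 (λ a b → b :- a := (:- a) :- (:- b)) refl (seq x n) (seq y n)))
  (≃-out (≃-sym x≃y) 0<ε)
  where open ℚSolve

eventually-bounded : ∀ x → ∃[ B ] 0ℚ ℚ.< B × Eventually (λ n → ℚ.∣ seq x n ∣ ℚ.≤ B)
eventually-bounded x with N , near ← cauchy x (ℚ.positive⁻¹ 1ℚ) =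
  1ℚ ℚ.+ ℚ.∣ seq x N ∣
  , ℚ.<-≤-trans (ℚ.positive⁻¹ 1ℚ)
      (subst (ℚ._≤ 1ℚ ℚ.+ ℚ.∣ seq x N ∣) (ℚ.+-identityʳ 1ℚ) (ℚ.+-monoʳ-≤ 1ℚ (ℚ.0≤∣p∣ (seq x N))))
  , N , λ {n} N≤n → begin
    ℚ.∣ seq x n ∣
      ≡⟨ cong ℚ.∣_∣ (solve 2 (λ a b → a := (a :- b) :+ b) refl (seq x n) (seq x N)) ⟩
    ℚ.∣ (seq x n ℚ.- seq x N) ℚ.+ seq x N ∣
      ≤⟨ ℚ.∣p+q∣≤∣p∣+∣q∣ (seq x n ℚ.- seq x N) (seq x N) ⟩
    ℚ.∣ seq x n ℚ.- seq x N ∣ ℚ.+ ℚ.∣ seq x N ∣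
      ≤⟨ ℚ.+-monoˡ-≤ ℚ.∣ seq x N ∣ (ℚ.<⇒≤ (near N≤n ℕ.≤-refl)) ⟩
    1ℚ ℚ.+ ℚ.∣ seq x N ∣ ∎
  where open ℚ.≤-Reasoning
        open ℚSolve

module _ (B : ℚ) (B>0 : ℚ.Positive B) where
  private instance
    _ = B>0
    _ = ℚ.pos⇒nonZero B
    _ = ℚ.1/pos⇒pos B

  *ℝ-congʳ-bounded : ∀ {x x′ y} → Eventually (λ n → ℚ.∣ seq y n ∣ ℚ.≤ B) →
                     x ≃ x′ → x *ℝ y ≃ x′ *ℝ y
  *ℝ-congʳ-bounded {x} {x′} {y} bounded (≃-in x≈x′) = ≃-in λ {ε} 0<ε →
    ev-zip (λ n near bound → begin-strict
      ℚ.∣ seq x n ℚ.* seq y n ℚ.- seq x′ n ℚ.* seq y n ∣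
        ≡⟨ cong ℚ.∣_∣ (solve 3 (λ a b c → a :* c :- b :* c := (a :- b) :* c) refl
                         (seq x n) (seq x′ n) (seq y n)) ⟩
      ℚ.∣ (seq x n ℚ.- seq x′ n) ℚ.* seq y n ∣
        ≡⟨ ℚ.∣p*q∣≡∣p∣*∣q∣ (seq x n ℚ.- seq x′ n) (seq y n) ⟩
      ℚ.∣ seq x n ℚ.- seq x′ n ∣ ℚ.* ℚ.∣ seq y n ∣
        ≤⟨ ℚ.*-monoˡ-≤-nonNeg ℚ.∣ seq x n ℚ.- seq x′ n ∣
             {{ℚ.nonNegative (ℚ.0≤∣p∣ (seq x n ℚ.- seq x′ n))}} bound ⟩
      ℚ.∣ seq x n ℚ.- seq x′ n ∣ ℚ.* B
        <⟨ ℚ.*-monoˡ-<-pos B near ⟩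
      (ε ℚ.* 1/ B) ℚ.* B
        ≡⟨ trans (ℚ.*-assoc ε (1/ B) B)
             (trans (cong (ε ℚ.*_) (ℚ.*-inverseˡ B)) (ℚ.*-identityʳ ε)) ⟩
      ε ∎) (x≈x′ (*-pos 0<ε (ℚ.positive⁻¹ (1/ B)))) bounded
    where open ℚ.≤-Reasoning
          open ℚSolve

*ℝ-congʳ : ∀ {x x′} y → x ≃ x′ → x *ℝ y ≃ x′ *ℝ y
*ℝ-congʳ y p =
  let B , 0<B , bounded = eventually-bounded y
  in *ℝ-congʳ-bounded B (ℚ.positive 0<B) {y = y} bounded p

*ℝ-comm : ∀ x y → x *ℝ y ≃ y *ℝ x
*ℝ-comm x y = pointwise λ n → ℚ.*-comm (seq x n) (seq y n)

*ℝ-cong : ∀ {x x′ y y′} → x ≃ x′ → y ≃ y′ → x *ℝ y ≃ x′ *ℝ y′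
*ℝ-cong {x} {x′} {y} {y′} p q = ≃-trans (*ℝ-congʳ y p)
  (≃-trans (*ℝ-comm x′ y) (≃-trans (*ℝ-congʳ x′ q) (*ℝ-comm y′ x′)))

ℝ-commutativeRing : CommutativeRing 0ℓ 0ℓ
ℝ-commutativeRing = record
  { Carrier = ℝ ; _≈_ = _≃_ ; _+_ = _+ℝ_ ; _*_ = _*ℝ_ ; -_ = -ℝ_ ; 0# = 0ℝ ; 1# = 1ℝ
  ; isCommutativeRing = record
    { isRing = record
      { +-isAbelianGroup = record
        { isGroup = record
          { isMonoid = record
            { isSemigroup = record
              { isMagma = record
                { isEquivalence = record { refl = ≃-refl ; sym = ≃-sym ; trans = ≃-trans }
                ; ∙-cong = +ℝ-cong }
              ; assoc = λ x y z → pointwise λ n → ℚ.+-assoc (seq x n) (seq y n) (seq z n) }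
            ; identity = (λ x → pointwise λ n → ℚ.+-identityˡ (seq x n))
                       , (λ x → pointwise λ n → ℚ.+-identityʳ (seq x n)) }
          ; inverse = (λ x → pointwise λ n → ℚ.+-inverseˡ (seq x n))
                    , (λ x → pointwise λ n → ℚ.+-inverseʳ (seq x n))
          ; ⁻¹-cong = -ℝ-cong }
        ; comm = λ x y → pointwise λ n → ℚ.+-comm (seq x n) (seq y n) }
      ; *-cong = *ℝ-cong
      ; *-assoc = λ x y z → pointwise λ n → ℚ.*-assoc (seq x n) (seq y n) (seq z n)
      ; *-identity = (λ x → pointwise λ n → ℚ.*-identityˡ (seq x n))
                   , (λ x → pointwise λ n → ℚ.*-identityʳ (seq x n))
      ; distrib = (λ x y z → pointwise λ n → ℚ.*-distribˡ-+ (seq x n) (seq y n) (seq z n))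
                , (λ x y z → pointwise λ n → ℚ.*-distribʳ-+ (seq x n) (seq y n) (seq z n)) }
    ; *-comm = *ℝ-comm } }

-- Makes ℝ a ℚ-algebra, so that identities given to the ring solver may contain rational constants
-- such as ½.
ℚ⟶ℝ : ℚ.+-*-rawRing -Raw-AlmostCommutative⟶ fromCommutativeRing ℝ-commutativeRing
ℚ⟶ℝ = record
  { ⟦_⟧ = fromℚ
  ; +-homo = λ _ _ → pointwise λ _ → refl
  ; *-homo = λ _ _ → pointwise λ _ → refl
  ; -‿homo = λ _ → pointwise λ _ → refl
  ; 0-homo = ≃-refl
  ; 1-homo = ≃-refl }

<ℝ-*-pos : ∀ {x y} → 0ℝ <ℝ x → 0ℝ <ℝ y → 0ℝ <ℝ x *ℝ y
<ℝ-*-pos {x} {y} (<-in {δ} 0<δ farˣ) (<-in {η} 0<η farʸ) =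
  <-in (*-pos 0<δ 0<η) (ev-zip (λ n p q →
    subst (δ ℚ.* η ℚ.≤_)
      (solve 2 (λ a b → (a :- con 0ℚ) :* (b :- con 0ℚ) := a :* b :- con 0ℚ) refl (seq x n) (seq y n))
      (*-mono-≤-nonNeg (ℚ.≤-trans (ℚ.<⇒≤ 0<δ) p) (ℚ.<⇒≤ 0<η) p q)) farˣ farʸ)
  where open ℚSolve

-- Against the assumption x y < 0 the cases may be taken one by one: if both factors are positive so
-- is the product, and a factor that is nonnegative but not positive is 0, which makes the product
-- 0.
≼-*-nonNeg : ∀ {x y} → 0ℝ ≼ x → 0ℝ ≼ y → 0ℝ ≼ x *ℝ y
≼-*-nonNeg {x} {y} 0≼x 0≼y = ≮⇒≽ λ xy<0 →
  let nonzero : ¬ (0ℝ ≃ x *ℝ y)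
      nonzero 0≃xy = ≼⇒≯ (≼-reflexive 0≃xy) xy<0
      0≮x : ¬ (0ℝ <ℝ x)
      0≮x 0<x =
        let 0≮y : ¬ (0ℝ <ℝ y)
            0≮y 0<y = ≼⇒≯ (<⇒≼ (<ℝ-*-pos 0<x 0<y)) xy<0
        in nonzero (≃-sym (≃-trans (*ℝ-comm x y)
             (≃-trans (*ℝ-congʳ x (≼-antisym (≮⇒≽ 0≮y) 0≼y)) (zeroˡ x))))
  in nonzero (≃-sym (≃-trans (*ℝ-congʳ y (≼-antisym (≮⇒≽ 0≮x) 0≼x)) (zeroˡ y)))
  where open CommutativeRing ℝ-commutativeRing using (zeroˡ)

neg-<ℝ : ∀ {x} → x <ℝ 0ℝ → 0ℝ <ℝ -ℝ x
neg-<ℝ {x} (<-in {δ} 0<δ far) = <-in 0<δ (ev-map (λ n → subst (δ ℚ.≤_)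
  (solve 1 (λ a → con 0ℚ :- a := (:- a) :- con 0ℚ) refl (seq x n))) far)
  where open ℚSolve

-- `¬ (y ≼ 0ℝ)` gives 0 < y only up to double negation, which is enough to refute x < 0: otherwise
-- (- x) y would be positive.
*ℝ-cancelʳ-nonNeg : ∀ {x y} → 0ℝ ≼ x *ℝ y → ¬ (y ≼ 0ℝ) → 0ℝ ≼ x
*ℝ-cancelʳ-nonNeg {x} {y} 0≼xy y⋠0 = ≮⇒≽ λ x<0 → y⋠0 (≮⇒≽ λ 0<y →
  let <-in {δ} 0<δ far = <ℝ-*-pos (neg-<ℝ x<0) 0<y
  in ≼⇒≯ 0≼xy (<-in 0<δ (ev-map (λ n → subst (δ ℚ.≤_)
       (solve 2 (λ a b → (:- a) :* b :- con 0ℚ := con 0ℚ :- a :* b) refl (seq x n) (seq y n))) far)))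
  where open ℚSolve

-- Square roots on [0 , 1]

dyadic : ℕ → ℚ
dyadic zero    = 1ℚ ℚ.+ 1ℚ
dyadic (suc n) = half (dyadic n)

-- Bisection for √ q in [0 , 2]; it stays at 0 for q < 0.
root : ℚ → ℕ → ℚ
root q zero    = 0ℚ
root q (suc n) with (root q n ℚ.+ dyadic (suc n)) ℚ.* (root q n ℚ.+ dyadic (suc n)) ℚ.≤? q
... | yes _ = root q n ℚ.+ dyadic (suc n)
... | no  _ = root q n

-- The bisection invariant: √q lies between `s` and `s + δ`. The alternative `s ≡ 0ℚ` covers
-- negative `q`, since the rational terms of a nonnegative real may be slightly negative.
record IsRoot (q δ s : ℚ) : Set where
  field
    nonNeg  : 0ℚ ℚ.≤ s
    bounded : s ℚ.+ δ ℚ.≤ 1ℚ ℚ.+ 1ℚ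
    lower   : s ℚ.* s ℚ.≤ q ⊎ s ≡ 0ℚ
    upper   : q ℚ.< (s ℚ.+ δ) ℚ.* (s ℚ.+ δ)

dyadic-pos : ∀ n → 0ℚ ℚ.< dyadic n
dyadic-pos zero    = ℚ.positive⁻¹ (1ℚ ℚ.+ 1ℚ)
dyadic-pos (suc n) = half-pos (dyadic-pos n)

root-isRoot : ∀ {q} → q ℚ.< (1ℚ ℚ.+ 1ℚ) ℚ.* (1ℚ ℚ.+ 1ℚ) → ∀ n → IsRoot q (dyadic n) (root q n)
root-isRoot {q} q<4 zero = record
  { nonNeg = ℚ.≤-refl ; bounded = ℚ.≤-refl ; lower = inj₂ refl ; upper = q<4 }
root-isRoot {q} q<4 (suc n)
  with root-isRoot q<4 n
     | (root q n ℚ.+ dyadic (suc n)) ℚ.* (root q n ℚ.+ dyadic (suc n)) ℚ.≤? q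
... | prev | yes c²≤q = record
  { nonNeg  = ℚ.≤-trans nonNeg (p≤p+q (root q n) (ℚ.<⇒≤ (dyadic-pos (suc n))))
  ; bounded = subst (ℚ._≤ 1ℚ ℚ.+ 1ℚ) (sym both) bounded
  ; lower   = inj₁ c²≤q
  ; upper   = subst (λ c → q ℚ.< c ℚ.* c) (sym both) upper }
  where
  open IsRoot prev
  both : (root q n ℚ.+ dyadic (suc n)) ℚ.+ dyadic (suc n) ≡ root q n ℚ.+ dyadic n
  both = trans (ℚ.+-assoc (root q n) (dyadic (suc n)) (dyadic (suc n)))
               (cong (root q n ℚ.+_) (half+half (dyadic n)))
... | prev | no c²≰q = record
  { nonNeg  = nonNeg
  ; bounded = ℚ.≤-trans (ℚ.+-monoʳ-≤ (root q n)
                (subst (dyadic (suc n) ℚ.≤_) (half+half (dyadic n))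
                  (p≤p+q (dyadic (suc n)) (ℚ.<⇒≤ (dyadic-pos (suc n)))))) bounded
  ; lower   = lower
  ; upper   = ℚ.≰⇒> c²≰q }
  where open IsRoot prev

recip : ℕ → ℚ
recip n = mkℚ (+ 1) n (1-coprimeTo (suc n))

-- With denominators cleared this is n + 2 ≤ 2 (n + 1). It bounds `dyadic` by a sequence whose
-- convergence to 0 can be read off from denominators.
half-recip : ∀ n → half (recip n) ℚ.≤ recip (suc n)
half-recip n = ℚ.toℚᵘ-cancel-≤ (ℚᵘ.≤-respˡ-≃ (ℚᵘ.≃-sym {toℚᵘ (half (recip n))} (ℚ.toℚᵘ-homo-* ½ (recip n)))
  (ℚᵘ.*≤* (ℤ.+≤+ (ℕ.≤-trans (ℕ.+-mono-≤ {1} {suc n} (ℕ.s≤s ℕ.z≤n) (ℕ.s≤s (ℕ.≤-reflexive (ℕ.+-identityʳ n))))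
    (ℕ.≤-reflexive (solve 1 (λ n → con 1 :+ n :+ (con 1 :+ n) :=
       con 1 :+ (n :+ (con 1 :+ n :+ con 0) :+ con 0)) refl n))))))
  where open ℕSolve

dyadic≤ : ∀ n → dyadic n ℚ.≤ recip n ℚ.+ recip n
dyadic≤ zero    = ℚ.≤-refl
dyadic≤ (suc n) = ℚ.≤-trans (ℚ.*-monoˡ-≤-nonNeg ½ (dyadic≤ n))
  (ℚ.≤-trans (ℚ.≤-reflexive (ℚ.*-distribˡ-+ ½ (recip n) (recip n)))
             (ℚ.+-mono-≤ (half-recip n) (half-recip n)))

-- A positive fraction is at least the reciprocal of its own denominator, which is `suc d`.
recip-small : ∀ {ε} → ℚ.Positive ε → Eventually (λ n → recip n ℚ.≤ ε)
recip-small {mkℚ +[1+ k ] d _} _ = d , λ d≤n → ℚ.*≤*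
  (ℤ.+≤+ (ℕ.*-mono-≤ {1} {suc k} (ℕ.s≤s ℕ.z≤n) (ℕ.s≤s d≤n)))

dyadic-small : ∀ {ε} → 0ℚ ℚ.< ε → Eventually (λ n → dyadic n ℚ.≤ ε)
dyadic-small {ε} 0<ε = ev-map
  (λ n r≤ → ℚ.≤-trans (dyadic≤ n) (subst (recip n ℚ.+ recip n ℚ.≤_) (half+half ε) (ℚ.+-mono-≤ {recip n} {half ε} {recip n} {half ε} r≤ r≤)))
  (recip-small (ℚ.positive (half-pos 0<ε)))

-- For nonnegative a and b, ∣ a - b ∣ ≤ ∣ a + b ∣. So ∣ a - b ∣ ≥ ε would force ∣ a² - b² ∣ ≥ ε².
-- This is uniform continuity of the square root, also at 0.
squares-near⇒near : ∀ {ε a b} → 0ℚ ℚ.< ε → 0ℚ ℚ.≤ a → 0ℚ ℚ.≤ b →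
                    ℚ.∣ a ℚ.* a ℚ.- b ℚ.* b ∣ ℚ.< ε ℚ.* ε → ℚ.∣ a ℚ.- b ∣ ℚ.< ε
squares-near⇒near {ε} {a} {b} 0<ε 0≤a 0≤b near = ℚ.≰⇒> λ ε≤d → ℚ.<-irrefl refl (ℚ.<-≤-trans near (begin
  ε ℚ.* ε
    ≤⟨ *-mono-≤-nonNeg (ℚ.0≤∣p∣ (a ℚ.- b)) (ℚ.<⇒≤ 0<ε) ε≤d (ℚ.≤-trans ε≤d d≤s) ⟩
  ℚ.∣ a ℚ.- b ∣ ℚ.* ℚ.∣ a ℚ.+ b ∣
    ≡⟨ sym (ℚ.∣p*q∣≡∣p∣*∣q∣ (a ℚ.- b) (a ℚ.+ b)) ⟩
  ℚ.∣ (a ℚ.- b) ℚ.* (a ℚ.+ b) ∣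
    ≡⟨ cong ℚ.∣_∣ (solve 2 (λ a b → (a :- b) :* (a :+ b) := a :* a :- b :* b) refl a b) ⟩
  ℚ.∣ a ℚ.* a ℚ.- b ℚ.* b ∣ ∎))
  where
  open ℚ.≤-Reasoning
  open ℚSolve
  d≤s : ℚ.∣ a ℚ.- b ∣ ℚ.≤ ℚ.∣ a ℚ.+ b ∣
  d≤s = begin
    ℚ.∣ a ℚ.- b ∣       ≤⟨ ℚ.∣p-q∣≤∣p∣+∣q∣ a b ⟩
    ℚ.∣ a ∣ ℚ.+ ℚ.∣ b ∣ ≡⟨ cong₂ ℚ._+_ (ℚ.0≤p⇒∣p∣≡p 0≤a) (ℚ.0≤p⇒∣p∣≡p 0≤b) ⟩
    a ℚ.+ b             ≤⟨ p≤∣p∣ (a ℚ.+ b) ⟩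
    ℚ.∣ a ℚ.+ b ∣ ∎

module Sqrt (x : ℝ) (0≼x : 0ℝ ≼ x) (x≼1 : x ≼ 1ℝ) where

  -- A diagonal sequence: the n-th term performs n bisection steps on the n-th rational term of `x`.
  -- The terms of `x` are eventually below 2, hence below 4, where the bisection on [0 , 2] is
  -- valid.
  approx : ℕ → ℚ
  approx n = root (seq x n) n

  approx-isRoot : Eventually (λ n → IsRoot (seq x n) (dyadic n) (approx n))
  approx-isRoot = ev-map (λ n x< → root-isRoot (x<4 n x<) n) (≼-out x≼1 (ℚ.positive⁻¹ 1ℚ))
    where
    x<4 : ∀ n → seq x n ℚ.- 1ℚ ℚ.< 1ℚ → seq x n ℚ.< (1ℚ ℚ.+ 1ℚ) ℚ.* (1ℚ ℚ.+ 1ℚ)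
    x<4 n x< = begin-strict
      seq x n                  ≡⟨ solve 1 (λ a → a := a :- con 1ℚ :+ con 1ℚ) refl (seq x n) ⟩
      seq x n ℚ.- 1ℚ ℚ.+ 1ℚ    <⟨ ℚ.+-monoˡ-< 1ℚ x< ⟩
      1ℚ ℚ.+ 1ℚ                ≤⟨ p≤p+q (1ℚ ℚ.+ 1ℚ) {1ℚ ℚ.+ 1ℚ} (ℚ.nonNegative⁻¹ (1ℚ ℚ.+ 1ℚ)) ⟩
      1ℚ ℚ.+ 1ℚ ℚ.+ (1ℚ ℚ.+ 1ℚ) ∎
      where open ℚ.≤-Reasoning
            open ℚSolve

  4ℚ : ℚ
  4ℚ = (1ℚ ℚ.+ 1ℚ) ℚ.+ (1ℚ ℚ.+ 1ℚ)

  -- The error is less than (s + δ)² - s² = (s + (s + δ)) δ, and both `s` and `s + δ` are at most 2.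
  below : ∀ {q δ s} → 0ℚ ℚ.< δ → IsRoot q δ s → q ℚ.- s ℚ.* s ℚ.< 4ℚ ℚ.* δ
  below {q} {δ} {s} 0<δ isRoot = begin-strict
    q ℚ.- s ℚ.* s
      <⟨ ℚ.+-monoˡ-< (ℚ.- (s ℚ.* s)) upper ⟩
    (s ℚ.+ δ) ℚ.* (s ℚ.+ δ) ℚ.- s ℚ.* s
      ≡⟨ solve 2 (λ s d → (s :+ d) :* (s :+ d) :- s :* s := (s :+ (s :+ d)) :* d) refl s δ ⟩
    (s ℚ.+ (s ℚ.+ δ)) ℚ.* δ
      ≤⟨ ℚ.*-monoʳ-≤-nonNeg δ {{ℚ.nonNegative (ℚ.<⇒≤ 0<δ)}} {s ℚ.+ (s ℚ.+ δ)} {4ℚ}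
           (ℚ.+-mono-≤ (ℚ.≤-trans (p≤p+q s (ℚ.<⇒≤ 0<δ)) bounded) bounded) ⟩
    4ℚ ℚ.* δ ∎
    where open ℚ.≤-Reasoning
          open ℚSolve
          open IsRoot isRoot

  above : ∀ {q δ s ε} → 0ℚ ℚ.< ε → 0ℚ ℚ.- q ℚ.< ε → IsRoot q δ s → s ℚ.* s ℚ.- q ℚ.< ε
  above {q} {s = s} {ε} 0<ε -q<ε isRoot with IsRoot.lower isRoot
  ... | inj₁ s²≤q = ℚ.≤-<-trans (subst (s ℚ.* s ℚ.- q ℚ.≤_) (ℚ.+-inverseʳ q) (ℚ.+-monoˡ-≤ (ℚ.- q) s²≤q)) 0<ε
  ... | inj₂ refl = -q<ε

  approx² : ∀ {ε} → 0ℚ ℚ.< ε → Eventually (λ n → ℚ.∣ approx n ℚ.* approx n ℚ.- seq x n ∣ ℚ.< ε)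
  approx² {ε} 0<ε = ev-zip (λ n → λ (isRoot , small) -x<ε → ∣-∣<-intro
      (above 0<ε -x<ε isRoot)
      (subst (ℚ._< ε) (sym (neg-diff (approx n ℚ.* approx n) (seq x n)))
        (ℚ.<-≤-trans (below (dyadic-pos n) isRoot)
          (ℚ.≤-trans (ℚ.*-monoˡ-≤-nonNeg 4ℚ small) (ℚ.≤-reflexive 4*)))))
    (ev-zip (λ _ → _,_) approx-isRoot (dyadic-small (*-pos {1/ 4ℚ} (ℚ.positive⁻¹ (1/ 4ℚ)) 0<ε)))
    (≼-out 0≼x 0<ε)
    where
    4* : 4ℚ ℚ.* (1/ 4ℚ ℚ.* ε) ≡ ε
    4* = trans (sym (ℚ.*-assoc 4ℚ (1/ 4ℚ) ε)) (ℚ.*-identityˡ ε)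

  -- The squares are compared, through the Cauchy sequence of `x`, and `squares-near⇒near` passes to
  -- the roots. Three errors below ε²/4 add up to less than ε².
  approx-cauchy : IsCauchy approx
  approx-cauchy {ε} 0<ε =
    let N , p = ev-zip (λ _ → _,_) approx-isRoot (approx² 0<¼ε²)
        M , near = cauchy x 0<¼ε²
    in N ⊔ M , λ {m} {n} ≤m ≤n →
      let rootₘ , pₘ = p (ℕ.m⊔n≤o⇒m≤o N M ≤m)
          rootₙ , pₙ = p (ℕ.m⊔n≤o⇒m≤o N M ≤n)
      in squares-near⇒near 0<ε (IsRoot.nonNeg rootₘ) (IsRoot.nonNeg rootₙ)
           (close (approx m ℚ.* approx m) (approx n ℚ.* approx n) (seq x m) (seq x n)
              pₘ pₙ (near (ℕ.m⊔n≤o⇒n≤o N M ≤m) (ℕ.m⊔n≤o⇒n≤o N M ≤n)))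
    where
    open ℚSolve
    ¼ε² = half (half (ε ℚ.* ε))
    0<¼ε² : 0ℚ ℚ.< ¼ε²
    0<¼ε² = half-pos (half-pos (*-pos 0<ε 0<ε))
    close : ∀ a b p q → ℚ.∣ a ℚ.- p ∣ ℚ.< ¼ε² → ℚ.∣ b ℚ.- q ∣ ℚ.< ¼ε² →
            ℚ.∣ p ℚ.- q ∣ ℚ.< ¼ε² → ℚ.∣ a ℚ.- b ∣ ℚ.< ε ℚ.* ε
    close a b p q a~p b~q p~q = begin-strict
      ℚ.∣ a ℚ.- b ∣
        ≡⟨ cong ℚ.∣_∣ (solve 4 (λ a b p q → a :- b := (a :- p :+ (p :- q)) :- (b :- q)) refl a b p q) ⟩
      ℚ.∣ (a ℚ.- p ℚ.+ (p ℚ.- q)) ℚ.- (b ℚ.- q) ∣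
        ≤⟨ ℚ.∣p-q∣≤∣p∣+∣q∣ (a ℚ.- p ℚ.+ (p ℚ.- q)) (b ℚ.- q) ⟩
      ℚ.∣ a ℚ.- p ℚ.+ (p ℚ.- q) ∣ ℚ.+ ℚ.∣ b ℚ.- q ∣
        ≤⟨ ℚ.+-monoˡ-≤ ℚ.∣ b ℚ.- q ∣ (ℚ.∣p+q∣≤∣p∣+∣q∣ (a ℚ.- p) (p ℚ.- q)) ⟩
      ℚ.∣ a ℚ.- p ∣ ℚ.+ ℚ.∣ p ℚ.- q ∣ ℚ.+ ℚ.∣ b ℚ.- q ∣
        <⟨ ℚ.+-mono-< (ℚ.+-mono-< a~p p~q) b~q ⟩
      ¼ε² ℚ.+ ¼ε² ℚ.+ ¼ε²
        ≤⟨ p≤p+q _ (ℚ.<⇒≤ 0<¼ε²) ⟩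
      ¼ε² ℚ.+ ¼ε² ℚ.+ ¼ε² ℚ.+ ¼ε²
        ≡⟨ solve 1 (λ e → h e :+ h e :+ h e :+ h e := e) refl (ε ℚ.* ε) ⟩
      ε ℚ.* ε ∎
      where open ℚ.≤-Reasoning
            h = λ e → con ½ :* (con ½ :* e)

  √ : ℝ
  √ = mkℝ approx approx-cauchy

  √*√ : √ *ℝ √ ≃ x
  √*√ = ≃-in approx²

-- Linear algebra over a commutative ℚ-algebra

natℚ : ℕ → ℚ
natℚ n = multiple ℚ.+-0-rawMonoid n 1ℚ

natℚ-nonNeg : ∀ n → ℚ.NonNegative (natℚ n)
natℚ-nonNeg zero    = _
natℚ-nonNeg (suc n) = ℚ.nonNeg+nonNeg⇒nonNeg 1ℚ (natℚ n) {{natℚ-nonNeg n}}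

natℚ-pos : ∀ n → ℚ.Positive (natℚ (suc n))
natℚ-pos n = ℚ.pos+nonNeg⇒pos 1ℚ (natℚ n) {{natℚ-nonNeg n}}

1/natℚ : ℕ → ℚ
1/natℚ n = (1/ natℚ (suc n)) {{ℚ.pos⇒nonZero (natℚ (suc n)) {{natℚ-pos n}}}}

natℚ*1/natℚ : ∀ n → natℚ (suc n) ℚ.* 1/natℚ n ≡ 1ℚ
natℚ*1/natℚ n = ℚ.*-inverseʳ (natℚ (suc n)) {{ℚ.pos⇒nonZero (natℚ (suc n)) {{natℚ-pos n}}}}

module ℚ-Algebra (R : CommutativeRing 0ℓ 0ℓ)
                 (ℚ⟶R : ℚ.+-*-rawRing -Raw-AlmostCommutative⟶ fromCommutativeRing R) where

  open CommutativeRing R hiding (zero)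
    renaming (refl to ≈-refl; sym to ≈-sym; trans to ≈-trans) public
  open LinearAlgebra rawRing public
  open _-Raw-AlmostCommutative⟶_ ℚ⟶R public
    renaming (⟦_⟧ to ι; +-homo to ι-+; *-homo to ι-*; 0-homo to ι-0; 1-homo to ι-1) hiding (-‿homo)
  open Relation.Binary.Reasoning.Setoid setoid public
  open Algebra.Properties.Semiring.Sum semiring using () renaming (∑-comm to ∑-swap) public
  open Algebra.Properties.Semiring.Sum semiring
    using (sum-cong-≋; ∑-distrib-+; *-distribˡ-sum; *-distribʳ-sum; sum-replicate; sum-replicate-zero)
  open Algebra.Properties.Semiring.Mult semiring using (×-assoc-*)
  open Algebra.Properties.Ring ring using (-1*x≈-x; -0#≈0#) public

  ι-cong : ∀ {p q} → p ≡ q → ι p ≈ ι q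
  ι-cong refl = ≈-refl

  _coeff≟_ : WeaklyDecidable (Induced-equivalence ℚ⟶R)
  p coeff≟ q with p ℚ.≟ q
  ... | yes p≡q = just (ι-cong p≡q)
  ... | no  _   = nothing

  module Solver = Algebra.Solver.Ring ℚ.+-*-rawRing (fromCommutativeRing R) ℚ⟶R _coeff≟_
  open Solver using (solve; con; _:+_; _:*_; _:-_; :-_; _:=_) public

  nat : ℕ → Carrier
  nat n = multiple +-rawMonoid n 1#

  ι-nat : ∀ n → ι (natℚ n) ≈ nat n
  ι-nat zero    = ι-0
  ι-nat (suc n) = ≈-trans (ι-+ 1ℚ (natℚ n)) (+-cong ι-1 (ι-nat n))

  -- The inverse of n + 1, not of n. It is imported from ℚ, so it exists in any ℚ-algebra.
  1/nat : ℕ → Carrier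
  1/nat n = ι (1/natℚ n)

  nat*1/nat : ∀ n → nat (suc n) * 1/nat n ≈ 1#
  nat*1/nat n = begin
    nat (suc n) * 1/nat n               ≈⟨ *-congʳ (ι-nat (suc n)) ⟨
    ι (natℚ (suc n)) * 1/nat n          ≈⟨ ι-* (natℚ (suc n)) (1/natℚ n) ⟨
    ι (natℚ (suc n) ℚ.* 1/natℚ n)       ≈⟨ ι-cong (natℚ*1/natℚ n) ⟩
    ι 1ℚ                                ≈⟨ ι-1 ⟩
    1#                                  ∎

  ≈⇒-≈0 : ∀ {x y} → x ≈ y → x - y ≈ 0#
  ≈⇒-≈0 {x} {y} x≈y = ≈-trans (+-congʳ x≈y) (-‿inverseʳ y)

  -≈0⇒≈ : ∀ {x y} → x - y ≈ 0# → x ≈ y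
  -≈0⇒≈ {x} {y} x-y≈0 = begin
    x            ≈⟨ solve 2 (λ x y → x := x :- y :+ y) ≈-refl x y ⟩
    x - y + y    ≈⟨ +-congʳ x-y≈0 ⟩
    0# + y       ≈⟨ +-identityˡ y ⟩
    y            ∎

  *-zeroʳ-cong : ∀ x {y} → y ≈ 0# → x * y ≈ 0#
  *-zeroʳ-cong x y≈0 = ≈-trans (*-congˡ y≈0) (zeroʳ x)

  +-zero-cong : ∀ {x y} → x ≈ 0# → y ≈ 0# → x + y ≈ 0#
  +-zero-cong x≈0 y≈0 = ≈-trans (+-cong x≈0 y≈0) (+-identityˡ 0#)

  ∑-cong : {x y : Vec n} → x ≋ y → ∑ x ≈ ∑ y
  ∑-cong x≋y = sum-cong-≋ x≋y

  ∑-+ : (x y : Vec n) → ∑ (λ i → x i + y i) ≈ ∑ x + ∑ y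
  ∑-+ = ∑-distrib-+

  ∑-*ˡ : ∀ c (x : Vec n) → ∑ (λ i → c * x i) ≈ c * ∑ x
  ∑-*ˡ c x = ≈-sym (*-distribˡ-sum c x)

  ∑-*ʳ : ∀ c (x : Vec n) → ∑ (λ i → x i * c) ≈ ∑ x * c
  ∑-*ʳ c x = ≈-sym (*-distribʳ-sum c x)

  ∑-neg : (x : Vec n) → ∑ (λ i → - x i) ≈ - ∑ x
  ∑-neg x = begin
    ∑ (λ i → - x i)        ≈⟨ ∑-cong (λ i → -1*x≈-x (x i)) ⟨
    ∑ (λ i → - 1# * x i)   ≈⟨ ∑-*ˡ (- 1#) x ⟩
    - 1# * ∑ x             ≈⟨ -1*x≈-x (∑ x) ⟩
    - ∑ x                  ∎

  ∑-- : (x y : Vec n) → ∑ (λ i → x i - y i) ≈ ∑ x - ∑ y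
  ∑-- x y = ≈-trans (∑-+ x (λ i → - y i)) (+-congˡ (∑-neg y))

  ∑-0 : {x : Vec n} → (∀ i → x i ≈ 0#) → ∑ x ≈ 0#
  ∑-0 {n} x≋0 = ≈-trans (∑-cong x≋0) (sum-replicate-zero n)

  ∑-const : ∀ n c → ∑ {n} (λ _ → c) ≈ nat n * c
  ∑-const n c = begin
    ∑ {n} (λ _ → c)              ≈⟨ sum-replicate n ⟩
    multiple +-rawMonoid n c     ≈⟨ multiple-cong n (*-identityˡ c) ⟨
    multiple +-rawMonoid n (1# * c) ≈⟨ ×-assoc-* n 1# c ⟨
    nat n * c                    ∎
    where
    open Algebra.Properties.Semiring.Mult semiring using () renaming (×-congʳ to multiple-cong)

  𝐞· : (x : Vec n) → 𝐞 · x ≈ ∑ x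
  𝐞· x = ∑-cong λ i → *-identityˡ (x i)

  ∑-kronecker : (i : Fin n) (x : Vec n) → ∑ (λ j → if does (i ≟ j) then x j else 0#) ≈ x i
  ∑-kronecker {suc n} zero    x = ≈-trans (+-congˡ (∑-0 {n} λ _ → ≈-refl)) (+-identityʳ (x zero))
  ∑-kronecker {suc n} (suc i) x = ≈-trans (+-identityˡ _) (∑-kronecker i (λ j → x (suc j)))

  ∑-kronecker′ : (j : Fin n) (x : Vec n) → ∑ (λ i → if does (i ≟ j) then x i else 0#) ≈ x j
  ∑-kronecker′ {suc n} zero    x = ≈-trans (+-congˡ (∑-0 {n} λ _ → ≈-refl)) (+-identityʳ (x zero))
  ∑-kronecker′ {suc n} (suc j) x = ≈-trans (+-identityˡ _) (∑-kronecker′ j (λ i → x (suc i)))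

  if-* : ∀ b x y → (if b then x else 0#) * y ≈ (if b then x * y else 0#)
  if-* true  x y = ≈-refl
  if-* false x y = zeroˡ y

  if-cong : ∀ b {x y} → x ≈ y → (if b then x else 0#) ≈ (if b then y else 0#)
  if-cong true  x≈y = x≈y
  if-cong false _   = ≈-refl

  I*ᵥ : (x : Vec n) → I *ᵥ x ≋ x
  I*ᵥ x i = ≈-trans (∑-cong λ j → ≈-trans (if-* (does (i ≟ j)) 1# (x j))
                                          (if-cong (does (i ≟ j)) (*-identityˡ (x j))))
                    (∑-kronecker i x)

  ·-congˡ : (x : Vec n) {y z : Vec n} → y ≋ z → x · y ≈ x · z
  ·-congˡ x y≋z = ∑-cong λ i → *-congˡ (y≋z i)

  *ᵥ-cong : (A : Matrix m n) {x y : Vec n} → x ≋ y → A *ᵥ x ≋ A *ᵥ y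
  *ᵥ-cong A x≋y i = ·-congˡ (A i) x≋y

  *ᵥ-scale : (A : Matrix m n) (c : Carrier) (x : Vec n) → A *ᵥ (λ j → c * x j) ≋ (λ i → c * (A *ᵥ x) i)
  *ᵥ-scale A c x i = ≈-trans
    (∑-cong λ j → solve 3 (λ a c x → a :* (c :* x) := c :* (a :* x)) ≈-refl (A i j) c (x j))
    (∑-*ˡ c (λ j → A i j * x j))

  *ᵥ-- : (A : Matrix m n) (x y : Vec n) → A *ᵥ (λ j → x j - y j) ≋ (λ i → (A *ᵥ x) i - (A *ᵥ y) i)
  *ᵥ-- A x y i = ≈-trans
    (∑-cong λ j → solve 3 (λ a x y → a :* (x :- y) := a :* x :- a :* y) ≈-refl (A i j) (x j) (y j))
    (∑-- (λ j → A i j * x j) (λ j → A i j * y j))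

  *ₘ-*ᵥ : (A : Matrix l m) (B : Matrix m n) (x : Vec n) → (A *ₘ B) *ᵥ x ≋ A *ᵥ (B *ᵥ x)
  *ₘ-*ᵥ A B x i = begin
    ∑ (λ j → ∑ (λ k → A i k * B k j) * x j)     ≈⟨ ∑-cong (λ j → ∑-*ʳ (x j) (λ k → A i k * B k j)) ⟨
    ∑ (λ j → ∑ (λ k → A i k * B k j * x j))     ≈⟨ ∑-swap (λ j k → A i k * B k j * x j) ⟩
    ∑ (λ k → ∑ (λ j → A i k * B k j * x j))     ≈⟨ ∑-cong (λ k → ∑-cong λ j → *-assoc (A i k) (B k j) (x j)) ⟩
    ∑ (λ k → ∑ (λ j → A i k * (B k j * x j)))   ≈⟨ ∑-cong (λ k → ∑-*ˡ (A i k) (λ j → B k j * x j)) ⟩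
    ∑ (λ k → A i k * ∑ (λ j → B k j * x j))     ∎

  -- The Laplacian of the weight matrix `A`, in the form that visibly annihilates constants and in
  -- which the maximum principle compares entries.
  Δ : Matrix n n → Vec n → Vec n
  Δ A x i = ∑ λ j → A i j * (x i - x j)

  Δ-cong : {A B : Matrix n n} → (∀ i j → A i j ≈ B i j) → ∀ x → Δ A x ≋ Δ B x
  Δ-cong A≈B x i = ∑-cong λ j → *-congʳ (A≈B i j)

  degree-Δ : (A : Matrix n n) (d : Vec n) → (∀ i → d i ≈ ∑ (A i)) → ∀ x →
             (λ i j → (if does (i ≟ j) then d i else 0#) - A i j) *ᵥ x ≋ Δ A x
  degree-Δ A d d≈ x i = begin
    ∑ (λ j → ((if does (i ≟ j) then d i else 0#) - A i j) * x j)
      ≈⟨ ∑-cong (λ j → ≈-trans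
           (solve 3 (λ c a x → (c :- a) :* x := c :* x :- a :* x) ≈-refl
              (if does (i ≟ j) then d i else 0#) (A i j) (x j))
           (+-congʳ (if-* (does (i ≟ j)) (d i) (x j)))) ⟩
    ∑ (λ j → (if does (i ≟ j) then d i * x j else 0#) - A i j * x j)
      ≈⟨ ∑-- (λ j → if does (i ≟ j) then d i * x j else 0#) (λ j → A i j * x j) ⟩
    ∑ (λ j → if does (i ≟ j) then d i * x j else 0#) - ∑ (λ j → A i j * x j)
      ≈⟨ +-congʳ (≈-trans (∑-kronecker i (λ j → d i * x j)) (*-congʳ (d≈ i))) ⟩
    ∑ (A i) * x i - ∑ (λ j → A i j * x j)
      ≈⟨ +-congʳ (∑-*ʳ (x i) (A i)) ⟨
    ∑ (λ j → A i j * x i) - ∑ (λ j → A i j * x j)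
      ≈⟨ ∑-- (λ j → A i j * x i) (λ j → A i j * x j) ⟨
    ∑ (λ j → A i j * x i - A i j * x j)
      ≈⟨ ∑-cong (λ j → solve 3 (λ a y z → a :* y :- a :* z := a :* (y :- z)) ≈-refl (A i j) (x i) (x j)) ⟩
    ∑ (λ j → A i j * (x i - x j)) ∎

  -- The constant cancels in every difference. If Δ A w = μ w + c, then μ w + c is therefore an
  -- eigenvector equation without shift.
  Δ-affine : (A : Matrix n n) (μ c : Carrier) (x : Vec n) →
             Δ A (λ i → μ * x i + c) ≋ (λ i → μ * Δ A x i)
  Δ-affine A μ c x i = ≈-trans
    (∑-cong λ j → solve 5 (λ a μ c y z → a :* (μ :* y :+ c :- (μ :* z :+ c)) := μ :* (a :* (y :- z)))
                    ≈-refl (A i j) μ c (x i) (x j))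
    (∑-*ˡ μ (λ j → A i j * (x i - x j)))

  -- The diagonal weights multiply `x i - x i`, so they do no harm. On vectors with sum 0 this
  -- operator is n - Δ A, which reflects an eigenvalue μ to n - μ.
  Δ-complement : (A : Matrix n n) (x : Vec n) →
                 Δ (λ i j → 1# - A i j) x ≋ (λ i → nat n * x i - ∑ x - Δ A x i)
  Δ-complement {n} A x i = begin
    ∑ (λ j → (1# - A i j) * (x i - x j))
      ≈⟨ ∑-cong (λ j → ≈-trans (distribʳ (x i - x j) 1# (- A i j))
           (+-cong (*-identityˡ (x i - x j))
             (solve 2 (λ a y → :- a :* y := :- (a :* y)) ≈-refl (A i j) (x i - x j)))) ⟩
    ∑ (λ j → x i - x j - A i j * (x i - x j))
      ≈⟨ ∑-- (λ j → x i - x j) (λ j → A i j * (x i - x j)) ⟩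
    ∑ (λ j → x i - x j) - Δ A x i
      ≈⟨ +-congʳ (∑-- (λ _ → x i) x) ⟩
    ∑ {n} (λ _ → x i) - ∑ x - Δ A x i
      ≈⟨ +-congʳ (+-congʳ (∑-const n (x i))) ⟩
    nat n * x i - ∑ x - Δ A x i ∎

-- Restrictors

-- A stand-in for complex conjugation, which lets restrictors be treated over an abstract
-- commutative ring.
record IsAdditive (R : CommutativeRing 0ℓ 0ℓ)
                  (h : CommutativeRing.Carrier R → CommutativeRing.Carrier R) : Set where
  open CommutativeRing R using (_≈_; _+_; 0#)
  field
    ⋆-cong : ∀ {x y} → x ≈ y → h x ≈ h y
    ⋆-+    : ∀ x y → h (x + y) ≈ h x + h y
    ⋆-0    : h 0# ≈ 0#

module Restrictor
  (R : CommutativeRing 0ℓ 0ℓ)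
  (ℚ⟶R : ℚ.+-*-rawRing -Raw-AlmostCommutative⟶ fromCommutativeRing R)
  (_⋆ : CommutativeRing.Carrier R → CommutativeRing.Carrier R)
  (⋆-isAdditive : IsAdditive R _⋆)
  where

  open ℚ-Algebra R ℚ⟶R
  open IsAdditive ⋆-isAdditive

  _† : Matrix m n → Matrix n m
  (Q †) j i = (Q i j) ⋆

  ⋆-∑ : (x : Vec n) → ((∑ x) ⋆) ≈ ∑ (λ i → (x i) ⋆)
  ⋆-∑ {zero}  x = ⋆-0
  ⋆-∑ {suc n} x = ≈-trans (⋆-+ (x zero) (∑ (λ i → x (suc i)))) (+-congˡ (⋆-∑ (λ i → x (suc i))))

  record IsIsometryOnto𝐞⊥ {n m} (Q : Matrix n m) : Set where
    field
      columns-sum : ∀ j → ∑ (λ i → Q i j) ≈ 0#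
      gram        : ∀ j k → (Q † *ₘ Q) j k ≈ I j k
      onto        : ∀ x → ∑ x ≈ 0# → ∃[ c ] x ≋ Q *ᵥ c

  module _ {n m} {Q : Matrix (suc n) m} (isometry : IsIsometryOnto𝐞⊥ Q) where
    open IsIsometryOnto𝐞⊥ isometry

    ∑-Q : ∀ v → ∑ (Q *ᵥ v) ≈ 0#
    ∑-Q v = begin
      ∑ (λ i → ∑ (λ j → Q i j * v j))  ≈⟨ ∑-swap (λ i j → Q i j * v j) ⟩
      ∑ (λ j → ∑ (λ i → Q i j * v j))  ≈⟨ ∑-0 (λ j → ≈-trans (∑-*ʳ (v j) (λ i → Q i j))
                                            (≈-trans (*-congʳ (columns-sum j)) (zeroˡ (v j)))) ⟩
      0# ∎

    Q†Q : ∀ v → Q † *ᵥ (Q *ᵥ v) ≋ v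
    Q†Q v j = begin
      (Q † *ᵥ (Q *ᵥ v)) j   ≈⟨ *ₘ-*ᵥ (Q †) Q v j ⟨
      ((Q † *ₘ Q) *ᵥ v) j   ≈⟨ ∑-cong (λ k → *-congʳ (gram j k)) ⟩
      (I *ᵥ v) j            ≈⟨ I*ᵥ v j ⟩
      v j                   ∎

    Q†-const : ∀ c → Q † *ᵥ (λ _ → c) ≋ 𝟘
    Q†-const c j = begin
      ∑ (λ i → (Q i j) ⋆ * c)    ≈⟨ ∑-*ʳ c (λ i → (Q i j) ⋆) ⟩
      ∑ (λ i → (Q i j) ⋆) * c    ≈⟨ *-congʳ (⋆-∑ (λ i → Q i j)) ⟨
      ((∑ (λ i → Q i j)) ⋆) * c  ≈⟨ *-congʳ (≈-trans (⋆-cong (columns-sum j)) ⋆-0) ⟩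
      0# * c                     ≈⟨ zeroˡ c ⟩
      0#                         ∎

    Q-Q†-onto : ∀ x → ∑ x ≈ 0# → Q *ᵥ (Q † *ᵥ x) ≋ x
    Q-Q†-onto x ∑x≈0 i with onto x ∑x≈0
    ... | c , x≋Qc = begin
      (Q *ᵥ (Q † *ᵥ x)) i           ≈⟨ *ᵥ-cong Q (*ᵥ-cong (Q †) x≋Qc) i ⟩
      (Q *ᵥ (Q † *ᵥ (Q *ᵥ c))) i    ≈⟨ *ᵥ-cong Q (Q†Q c) i ⟩
      (Q *ᵥ c) i                    ≈⟨ x≋Qc i ⟨
      x i                           ∎

    mean : Vec (suc n) → Carrier
    mean x = 1/nat n * ∑ x

    ∑-centred : ∀ x → ∑ (λ i → x i - mean x) ≈ 0#
    ∑-centred x = begin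
      ∑ (λ i → x i - mean x)                    ≈⟨ ∑-- x (λ _ → mean x) ⟩
      ∑ x - ∑ {suc n} (λ _ → mean x)            ≈⟨ +-congˡ (-‿cong (∑-const (suc n) (mean x))) ⟩
      ∑ x - nat (suc n) * (1/nat n * ∑ x)       ≈⟨ +-congˡ (-‿cong (*-assoc _ _ _)) ⟨
      ∑ x - nat (suc n) * 1/nat n * ∑ x         ≈⟨ +-congˡ (-‿cong (≈-trans (*-congʳ (nat*1/nat n)) (*-identityˡ (∑ x)))) ⟩
      ∑ x - ∑ x                                 ≈⟨ -‿inverseʳ (∑ x) ⟩
      0#                                        ∎

    -- `Q *ₘ Q †` is the orthogonal projection I - J/n: `Q †` kills the constant part of `x`, and
    -- what is left lies in the range of `Q`, where the Gram identity makes the product act as the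
    -- identity.
    Q-Q† : ∀ x → Q *ᵥ (Q † *ᵥ x) ≋ (λ i → x i - mean x)
    Q-Q† x i = begin
      (Q *ᵥ (Q † *ᵥ x)) i                          ≈⟨ *ᵥ-cong Q Q†x i ⟩
      (Q *ᵥ (Q † *ᵥ (λ k → x k - mean x))) i       ≈⟨ Q-Q†-onto (λ k → x k - mean x) (∑-centred x) i ⟩
      x i - mean x                                 ∎
      where
      Q†x : Q † *ᵥ x ≋ Q † *ᵥ (λ k → x k - mean x)
      Q†x j = begin
        (Q † *ᵥ x) j                                   ≈⟨ +-identityʳ _ ⟨
        (Q † *ᵥ x) j + 0#                              ≈⟨ +-congˡ -0#≈0# ⟨
        (Q † *ᵥ x) j - 0#                              ≈⟨ +-congˡ (-‿cong (Q†-const (mean x) j)) ⟨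
        (Q † *ᵥ x) j - (Q † *ᵥ (λ _ → mean x)) j       ≈⟨ *ᵥ-- (Q †) x (λ _ → mean x) j ⟨
        (Q † *ᵥ (λ k → x k - mean x)) j                ∎

    compression : Matrix (suc n) (suc n) → Matrix m m
    compression M = Q † *ₘ M *ₘ Q

    compression-*ᵥ : ∀ M v → compression M *ᵥ v ≋ Q † *ᵥ (M *ᵥ (Q *ᵥ v))
    compression-*ᵥ M v j = ≈-trans (*ₘ-*ᵥ (Q † *ₘ M) Q v j) (*ₘ-*ᵥ (Q †) M (Q *ᵥ v) j)

    -- Applying `Q` to the eigenvalue equation recovers M Q v only after projection. The lost
    -- component is its mean, and this is the origin of the shift.
    compression-eigen⁻ : ∀ M μ v → compression M *ᵥ v ≋ (λ j → μ * v j) →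
                         M *ᵥ (Q *ᵥ v) ≋ (λ i → μ * (Q *ᵥ v) i + mean (M *ᵥ (Q *ᵥ v)))
    compression-eigen⁻ M μ v eigen i = begin
      y i                           ≈⟨ solve 2 (λ y c → y := y :- c :+ c) ≈-refl (y i) (mean y) ⟩
      y i - mean y + mean y         ≈⟨ +-congʳ (Q-Q† y i) ⟨
      (Q *ᵥ (Q † *ᵥ y)) i + mean y  ≈⟨ +-congʳ (*ᵥ-cong Q (λ j → ≈-trans (≈-sym (compression-*ᵥ M v j)) (eigen j)) i) ⟩
      (Q *ᵥ (λ j → μ * v j)) i + mean y ≈⟨ +-congʳ (*ᵥ-scale Q μ v i) ⟩
      μ * (Q *ᵥ v) i + mean y       ∎
      where y = M *ᵥ (Q *ᵥ v)

    compression-eigen⁺ : ∀ M μ w → ∑ w ≈ 0# → M *ᵥ w ≋ (λ i → μ * w i) →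
                         compression M *ᵥ (Q † *ᵥ w) ≋ (λ j → μ * (Q † *ᵥ w) j)
    compression-eigen⁺ M μ w ∑w≈0 eigen j = begin
      (compression M *ᵥ (Q † *ᵥ w)) j        ≈⟨ compression-*ᵥ M (Q † *ᵥ w) j ⟩
      (Q † *ᵥ (M *ᵥ (Q *ᵥ (Q † *ᵥ w)))) j    ≈⟨ *ᵥ-cong (Q †) (*ᵥ-cong M (Q-Q†-onto w ∑w≈0)) j ⟩
      (Q † *ᵥ (M *ᵥ w)) j                    ≈⟨ *ᵥ-cong (Q †) eigen j ⟩
      (Q † *ᵥ (λ i → μ * w i)) j             ≈⟨ *ᵥ-scale (Q †) μ w j ⟩
      μ * (Q † *ᵥ w) j                       ∎

    *ᵥ-0 : ∀ {m n} (A : Matrix m n) {x} → x ≋ 𝟘 → A *ᵥ x ≋ 𝟘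
    *ᵥ-0 A x≋0 i = ∑-0 (λ j → *-zeroʳ-cong (A i j) (x≋0 j))

    Q-injective : ∀ v → Q *ᵥ v ≋ 𝟘 → v ≋ 𝟘
    Q-injective v Qv≋0 j = ≈-trans (≈-sym (Q†Q v j)) (*ᵥ-0 (Q †) Qv≋0 j)

    Q†-injective : ∀ w → ∑ w ≈ 0# → Q † *ᵥ w ≋ 𝟘 → w ≋ 𝟘
    Q†-injective w ∑w≈0 Q†w≋0 i = ≈-trans (≈-sym (Q-Q†-onto w ∑w≈0 i)) (*ᵥ-0 Q Q†w≋0 i)

  -- All columns but the first of the Householder reflection exchanging the first coordinate vector and
  -- - 𝐞 / √n, where n = suc k: here r = 1 / √n and g = (1 - r) / k.
  module Reflection (k : ℕ) (r g : Carrier) (r⋆ : (r ⋆) ≈ r) (g⋆ : (g ⋆) ≈ g) (1⋆ : (1# ⋆) ≈ 1#)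
    (neg⋆ : ∀ x → ((- x) ⋆) ≈ - (x ⋆))
    (kg+r≈1 : nat k * g + r ≈ 1#) (nr²≈1 : nat (suc k) * (r * r) ≈ 1#) (g[1+r]≈r² : g * (1# + r) ≈ r * r)
    where

    Q : Matrix (suc k) k
    Q zero    _ = - r
    Q (suc i) j = I i j - g

    Q⋆ : ∀ i j → ((Q i j) ⋆) ≈ Q i j
    Q⋆ zero    j = ≈-trans (neg⋆ r) (-‿cong r⋆)
    Q⋆ (suc i) j = ≈-trans (⋆-+ (I i j) (- g)) (+-cong (if-⋆ (does (i ≟ j))) (≈-trans (neg⋆ g) (-‿cong g⋆)))
      where
      if-⋆ : ∀ b → ((if b then 1# else 0#) ⋆) ≈ (if b then 1# else 0#)
      if-⋆ true  = 1⋆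
      if-⋆ false = ⋆-0

    ∑-I : ∀ j → ∑ (λ i → I {k} i j) ≈ 1#
    ∑-I j = ∑-kronecker′ j (λ _ → 1#)

    column-sum : ∀ j → ∑ (λ i → Q i j) ≈ 0#
    column-sum j = begin
      - r + ∑ (λ i → I {k} i j - g)          ≈⟨ +-congˡ (∑-- (λ i → I {k} i j) (λ _ → g)) ⟩
      - r + (∑ (λ i → I {k} i j) - ∑ {k} (λ _ → g))
        ≈⟨ +-congˡ (+-cong (∑-I j) (-‿cong (∑-const k g))) ⟩
      - r + (1# - nat k * g)
        ≈⟨ solve 3 (λ r o kg → :- r :+ (o :- kg) := :- (kg :+ r :- o)) ≈-refl r 1# (nat k * g) ⟩
      - (nat k * g + r - 1#)             ≈⟨ -‿cong (≈⇒-≈0 kg+r≈1) ⟩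
      - 0#                               ≈⟨ -0#≈0# ⟩
      0#                                 ∎

    I-I : ∀ j l → ∑ (λ i → I {k} i j * I i l) ≈ I j l
    I-I j l = ≈-trans (∑-cong λ i → ≈-trans (if-* (does (i ≟ j)) 1# (I i l))
                                            (if-cong (does (i ≟ j)) (*-identityˡ (I i l))))
                      (∑-kronecker′ j (λ i → I {k} i l))

    -- Every Gram entry exceeds that of `I` by the same number r² + k g² - 2 g, which is g (k g + r
    -- - 1) + (r² - g (1 + r)) and so vanishes.
    Q-gram : ∀ j l → (Q † *ₘ Q) j l ≈ I j l
    Q-gram j l = begin
      ∑ (λ i → (Q i j) ⋆ * Q i l)
        ≈⟨ ∑-cong (λ i → *-congʳ {Q i l} (Q⋆ i j)) ⟩
      - r * - r + ∑ (λ i → (I {k} i j - g) * (I i l - g))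
        ≈⟨ +-congˡ (∑-cong λ i → solve 3 (λ a b g → (a :- g) :* (b :- g) := a :* b :+ (g :* g :- g :* (a :+ b)))
             ≈-refl (I i j) (I i l) g) ⟩
      - r * - r + ∑ (λ i → I {k} i j * I i l + (g * g - g * (I {k} i j + I i l)))
        ≈⟨ +-congˡ (≈-trans (∑-+ (λ i → I {k} i j * I i l) (λ i → g * g - g * (I {k} i j + I {k} i l))) (+-cong (I-I j l)
             (≈-trans (∑-- (λ _ → g * g) (λ i → g * (I {k} i j + I i l))) (+-cong (∑-const k (g * g))
               (-‿cong (≈-trans (∑-*ˡ g (λ i → I {k} i j + I i l))
                 (*-congˡ (≈-trans (∑-+ (λ i → I {k} i j) (λ i → I {k} i l)) (+-cong (∑-I j) (∑-I l)))))))))) ⟩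
      - r * - r + (I j l + (nat k * (g * g) - g * (1# + 1#)))
        ≈⟨ solve 5 (λ r i k g o → :- r :* :- r :+ (i :+ (k :* (g :* g) :- g :* (o :+ o)))
                                := i :+ (g :* (k :* g :+ r :- o) :+ (r :* r :- g :* (o :+ r))))
             ≈-refl r (I j l) (nat k) g 1# ⟩
      I j l + (g * (nat k * g + r - 1#) + (r * r - g * (1# + r)))
        ≈⟨ +-congˡ (+-zero-cong (*-zeroʳ-cong g (≈⇒-≈0 kg+r≈1)) (≈⇒-≈0 (≈-sym g[1+r]≈r²))) ⟩
      I j l + 0#
        ≈⟨ +-identityʳ (I j l) ⟩
      I j l ∎

    -- Equivalently n r g = r - g, the correction that the lower rows of `Q` require in
    -- `Q-coordinates`. It combines n r times g (1 + r) = r² with r - g times n r² = 1.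
    g[1+nr]≈r : g * (1# + nat (suc k) * r) ≈ r
    g[1+nr]≈r = -≈0⇒≈ (begin
      g * (1# + N * r) - r
        -- The constant of the solver is `ι 1ℚ`, which in an abstract ring agrees with `1#` only up
        -- to `_≈_`.
        ≈⟨ +-congʳ (*-congˡ (+-congʳ ι-1)) ⟨
      g * (ι 1ℚ + N * r) - r
        ≈⟨ solve 3 (λ N r g → g :* (con 1ℚ :+ N :* r) :- r
             := N :* r :* (g :* (con 1ℚ :+ r) :- r :* r) :+ (r :- g) :* (N :* (r :* r) :- con 1ℚ)) ≈-refl N r g ⟩
      N * r * (g * (ι 1ℚ + r) - r * r) + (r - g) * (N * (r * r) - ι 1ℚ)
        ≈⟨ +-zero-cong
             (*-zeroʳ-cong (N * r) (≈⇒-≈0 (≈-trans (*-congˡ (+-congʳ ι-1)) g[1+r]≈r²)))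
             (*-zeroʳ-cong (r - g) (≈⇒-≈0 (≈-trans nr²≈1 (≈-sym ι-1)))) ⟩
      0# ∎)
      where N = nat (suc k)

    module _ (x : Vec (suc k)) (∑x≈0 : ∑ x ≈ 0#) where

      x₀ : Carrier
      x₀ = x zero

      -- These are the entries of Q† x: column j gives - r x₀ + x (suc j) - g S, where S is the sum
      -- of the entries after the first and equals - x₀.
      coordinates : Vec k
      coordinates j = x (suc j) + (g - r) * x₀

      -- The entries of x other than x₀ sum to - x₀, and k (g - r) = 1 - n r.
      ∑-coordinates : ∑ coordinates ≈ - (nat (suc k) * r * x₀)
      ∑-coordinates = begin
        ∑ coordinates
          ≈⟨ ≈-trans (∑-+ (λ j → x (suc j)) (λ _ → (g - r) * x₀)) (+-congˡ (∑-const k ((g - r) * x₀))) ⟩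
        S + nat k * ((g - r) * x₀)
          ≈⟨ solve 5 (λ S K g r x → S :+ K :* ((g :- r) :* x)
               := (x :+ S) :+ (K :* g :+ r :- con 1ℚ) :* x :- (con 1ℚ :+ K) :* r :* x)
               ≈-refl S (nat k) g r x₀ ⟩
        (x₀ + S) + (nat k * g + r - ι 1ℚ) * x₀ - (ι 1ℚ + nat k) * r * x₀
          ≈⟨ +-cong (+-zero-cong ∑x≈0 (≈-trans (*-congʳ (≈⇒-≈0 (≈-trans kg+r≈1 (≈-sym ι-1)))) (zeroˡ x₀)))
                    (-‿cong (*-congʳ (*-congʳ (+-congʳ ι-1)))) ⟩
        0# - nat (suc k) * r * x₀
          ≈⟨ +-identityˡ _ ⟩
        - (nat (suc k) * r * x₀) ∎
        where S = ∑ (λ j → x (suc j))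

      -- Each row sees the coordinates through their sum, apart from one entry. The first row then
      -- needs n r² = 1 and the others n r g = r - g.
      Q-coordinates : x ≋ Q *ᵥ coordinates
      Q-coordinates zero = begin
        x₀                                  ≈⟨ *-identityˡ x₀ ⟨
        1# * x₀                             ≈⟨ *-congʳ nr²≈1 ⟨
        N * (r * r) * x₀
          ≈⟨ solve 3 (λ N r x → N :* (r :* r) :* x := :- r :* (:- (N :* r :* x))) ≈-refl N r x₀ ⟩
        - r * - (N * r * x₀)                ≈⟨ *-congˡ ∑-coordinates ⟨
        - r * ∑ coordinates                 ≈⟨ ∑-*ˡ (- r) coordinates ⟨
        ∑ (λ j → - r * coordinates j)       ∎
        where N = nat (suc k)
      Q-coordinates (suc i) = begin
        x (suc i)
          ≈⟨ solve 4 (λ x g r y → x := x :+ (g :- r) :* y :+ (r :- g) :* y) ≈-refl (x (suc i)) g r x₀ ⟩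
        coordinates i + (r - g) * x₀
          ≈⟨ +-congˡ (*-congʳ (+-congʳ g[1+nr]≈r)) ⟨
        coordinates i + (g * (1# + N * r) - g) * x₀
          ≈⟨ +-congˡ (*-congʳ (≈-trans (+-congʳ (≈-trans (distribˡ g 1# (N * r)) (+-congʳ (*-identityʳ g)))) (solve 2 (λ g a → g :+ g :* a :- g := g :* a) ≈-refl g (N * r)))) ⟩
        coordinates i + g * (N * r) * x₀
          ≈⟨ +-congˡ (solve 3 (λ g a x → g :* a :* x := :- (g :* (:- (a :* x)))) ≈-refl g (N * r) x₀) ⟩
        coordinates i - g * - (N * r * x₀)
          ≈⟨ +-congˡ (-‿cong (*-congˡ ∑-coordinates)) ⟨
        coordinates i - g * ∑ coordinates
          ≈⟨ +-cong (I*ᵥ coordinates i) (-‿cong (∑-*ˡ g coordinates)) ⟨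
        (I *ᵥ coordinates) i - ∑ (λ j → g * coordinates j)
          ≈⟨ ∑-- (λ j → I i j * coordinates j) (λ j → g * coordinates j) ⟨
        ∑ (λ j → I i j * coordinates j - g * coordinates j)
          ≈⟨ ∑-cong (λ j → solve 3 (λ a g c → a :* c :- g :* c := (a :- g) :* c) ≈-refl (I i j) g (coordinates j)) ⟩
        ∑ (λ j → (I i j - g) * coordinates j) ∎
        where N = nat (suc k)

    Q-isometry : IsIsometryOnto𝐞⊥ Q
    Q-isometry = record
      { columns-sum = column-sum
      ; gram        = Q-gram
      ; onto        = λ x ∑x≈0 → coordinates x ∑x≈0 , Q-coordinates x ∑x≈0 }

-- Ordered rings and the maximum principle

-- The order axioms of a classical ordered field, in the form in which they hold for ℝ constructively.
record IsStableOrder (R : CommutativeRing 0ℓ 0ℓ) (_≤_ : Rel (CommutativeRing.Carrier R) 0ℓ) : Set where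
  open CommutativeRing R using (_≈_; _+_; _*_; 0#)
  field
    isPartialOrder   : IsPartialOrder _≈_ _≤_
    +-mono-≤         : ∀ {x y u v} → x ≤ y → u ≤ v → (x + u) ≤ (y + v)
    *-nonNeg         : ∀ {x y} → 0# ≤ x → 0# ≤ y → 0# ≤ (x * y)
    *-cancelʳ-nonNeg : ∀ {x y} → 0# ≤ (x * y) → ¬ (y ≤ 0#) → 0# ≤ x
    ≤-stable         : ∀ {x y} → ¬ ¬ (x ≤ y) → x ≤ y
    ≰⇒≥              : ∀ {x y} → ¬ (x ≤ y) → y ≤ x

module Ordered
  (R : CommutativeRing 0ℓ 0ℓ)
  (ℚ⟶R : ℚ.+-*-rawRing -Raw-AlmostCommutative⟶ fromCommutativeRing R)
  (_≤_ : Rel (CommutativeRing.Carrier R) 0ℓ)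
  (isStableOrder : IsStableOrder R _≤_)
  where

  open ℚ-Algebra R ℚ⟶R
  open IsStableOrder isStableOrder public
  open IsPartialOrder isPartialOrder public using ()
    renaming (reflexive to ≤-reflexive; refl to ≤-refl; trans to ≤-trans; antisym to ≤-antisym)

  ≤-respˡ : ∀ {x y z} → x ≈ y → x ≤ z → y ≤ z
  ≤-respˡ x≈y x≤z = ≤-trans (≤-reflexive (≈-sym x≈y)) x≤z

  ≤-respʳ : ∀ {x y z} → y ≈ z → x ≤ y → x ≤ z
  ≤-respʳ y≈z x≤y = ≤-trans x≤y (≤-reflexive y≈z)

  +-nonNeg : ∀ {x y} → 0# ≤ x → 0# ≤ y → 0# ≤ (x + y)
  +-nonNeg 0≤x 0≤y = ≤-respˡ (+-identityˡ 0#) (+-mono-≤ 0≤x 0≤y)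

  x≤y⇒0≤y-x : ∀ {x y} → x ≤ y → 0# ≤ (y - x)
  x≤y⇒0≤y-x {x} {y} x≤y = ≤-respˡ (-‿inverseʳ x) (+-mono-≤ x≤y ≤-refl)

  0≤y-x⇒x≤y : ∀ {x y} → 0# ≤ (y - x) → x ≤ y
  0≤y-x⇒x≤y {x} {y} 0≤y-x = ≤-respˡ (+-identityˡ x)
    (≤-respʳ (solve 2 (λ x y → y :- x :+ x := y) ≈-refl x y) (+-mono-≤ 0≤y-x ≤-refl))

  0≤-x⇒x≤0 : ∀ {x} → 0# ≤ (- x) → x ≤ 0#
  0≤-x⇒x≤0 {x} 0≤-x = 0≤y-x⇒x≤y (≤-respʳ (≈-sym (+-identityˡ (- x))) 0≤-x)

  x≤0⇒0≤-x : ∀ {x} → x ≤ 0# → 0# ≤ (- x)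
  x≤0⇒0≤-x {x} x≤0 = ≤-respʳ (+-identityˡ (- x)) (x≤y⇒0≤y-x x≤0)

  square-nonNeg : ∀ x → 0# ≤ (x * x)
  square-nonNeg x = ≤-stable λ x²≱0 →
    let x≱0 : ¬ (0# ≤ x)
        x≱0 0≤x = x²≱0 (*-nonNeg 0≤x 0≤x)
        0≤-x = x≤0⇒0≤-x (≰⇒≥ x≱0)
    in x²≱0 (≤-respʳ (solve 1 (λ x → :- x :* :- x := x :* x) ≈-refl x) (*-nonNeg 0≤-x 0≤-x))

  -- If x were positive, it could be cancelled from the nonnegative product (- x) x, leaving - x
  -- nonnegative.
  square≤0⇒≤0 : ∀ {x} → (x * x) ≤ 0# → x ≤ 0#
  square≤0⇒≤0 {x} x²≤0 = ≤-stable λ x≰0 → x≰0 (0≤-x⇒x≤0 (*-cancelʳ-nonNeg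
    (≤-respʳ (solve 1 (λ x → :- (x :* x) := :- x :* x) ≈-refl x) (x≤0⇒0≤-x x²≤0)) x≰0))

  square≤0⇒≈0 : ∀ {x} → (x * x) ≤ 0# → x ≈ 0#
  square≤0⇒≈0 {x} x²≤0 = ≤-antisym (square≤0⇒≤0 x²≤0) (≤-respʳ
    (solve 1 (λ x → :- (:- x) := x) ≈-refl x)
    (x≤0⇒0≤-x (square≤0⇒≤0 (≤-respˡ (solve 1 (λ x → x :* x := :- x :* :- x) ≈-refl x) x²≤0))))

  norm² : Carrier → Carrier → Carrier
  norm² x y = x * x + y * y

  norm²-nonNeg : ∀ x y → 0# ≤ norm² x y
  norm²-nonNeg x y = +-nonNeg (square-nonNeg x) (square-nonNeg y)

  norm²≤0⇒≈0 : ∀ {x y} → norm² x y ≤ 0# → x ≈ 0# × y ≈ 0#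
  norm²≤0⇒≈0 {x} {y} N≤0 =
      square≤0⇒≈0 (≤-trans (0≤y-x⇒x≤y (≤-respʳ
        (solve 2 (λ x y → y :* y := x :* x :+ y :* y :- x :* x) ≈-refl x y) (square-nonNeg y))) N≤0)
    , square≤0⇒≈0 (≤-trans (0≤y-x⇒x≤y (≤-respʳ
        (solve 2 (λ x y → x :* x := x :* x :+ y :* y :- y :* y) ≈-refl x y) (square-nonNeg x))) N≤0)

  0≤1 : 0# ≤ 1#
  0≤1 = ≤-respʳ (*-identityˡ 1#) (square-nonNeg 1#)

  nat-nonNeg : ∀ n → 0# ≤ nat n
  nat-nonNeg zero    = ≤-refl
  nat-nonNeg (suc n) = +-nonNeg 0≤1 (nat-nonNeg n)

  ∑-nonNeg : {x : Vec n} → (∀ i → 0# ≤ x i) → 0# ≤ ∑ x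
  ∑-nonNeg {zero}  0≤x = ≤-refl
  ∑-nonNeg {suc n} 0≤x = +-nonNeg (0≤x zero) (∑-nonNeg (λ i → 0≤x (suc i)))

  term≤∑ : {x : Vec n} → (∀ i → 0# ≤ x i) → ∀ i → x i ≤ ∑ x
  term≤∑ {x = x} 0≤x zero    = ≤-respˡ (+-identityʳ (x zero))
    (+-mono-≤ ≤-refl (∑-nonNeg (λ i → 0≤x (suc i))))
  term≤∑ {x = x} 0≤x (suc i) = ≤-respˡ (+-identityˡ (x (suc i)))
    (+-mono-≤ (0≤x zero) (term≤∑ (λ i → 0≤x (suc i)) i))

  -- From the order axioms alone: ½ is the sum of squares ½² + ½².
  ½-nonNeg : ∀ {x} → 0# ≤ x → 0# ≤ (ι ½ * x)
  ½-nonNeg = *-nonNeg (≤-respʳ (solve 0 (con ½ :* con ½ :+ con ½ :* con ½ := con ½) ≈-refl)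
                                (norm²-nonNeg (ι ½) (ι ½)))

  -- Selecting the index would require deciding inequalities. The double negation is enough for a
  -- stable goal.
  ¬¬maximum : (x : Vec (suc n)) → ¬ ¬ (∃[ i ] ∀ j → x j ≤ x i)
  ¬¬maximum {zero}  x none = none (zero , λ { zero → ≤-refl })
  ¬¬maximum {suc n} x none = ¬¬maximum (λ i → x (suc i)) λ (i , max) →
    let x₀≰xᵢ : ¬ (x zero ≤ x (suc i))
        x₀≰xᵢ x₀≤xᵢ = none (suc i , λ { zero → x₀≤xᵢ ; (suc j) → max j })
    in none (zero , λ { zero → ≤-refl ; (suc j) → ≤-trans (max j) (≰⇒≥ x₀≰xᵢ) })

  -- The complex equation Δ A z = (ρ + i σ) z for z = u + i v, split into real and imaginary parts
  -- because the order lives on the reals.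
  module _ (A : Matrix (suc n) (suc n)) (A-nonNeg : ∀ i j → 0# ≤ A i j)
           (ρ σ : Carrier) (ρ≱0 : ¬ (0# ≤ ρ)) (u v : Vec (suc n))
           (Δu : Δ A u ≋ (λ i → ρ * u i - σ * v i))
           (Δv : Δ A v ≋ (λ i → σ * u i + ρ * v i)) where

    private
      N : Vec (suc n)
      N i = norm² (u i) (v i)

      -- At a maximum of N, the inner product of u + i v and its image under Δ A has nonnegative real part,
      -- because 2 (N i - ⟨uᵢ + i vᵢ , uⱼ + i vⱼ⟩) = (N i - N j) + |uᵢ - uⱼ|² + |vᵢ - vⱼ|².
      maximum-≤0 : ∀ i → (∀ j → N j ≤ N i) → N i ≤ 0#
      maximum-≤0 i max = ≤-stable λ N≰0 → ρ≱0 (*-cancelʳ-nonNeg (≤-respʳ (begin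
        ∑ (λ j → A i j * (u i * (u i - u j) + v i * (v i - v j)))
          ≈⟨ ∑-cong (λ j → solve 5 (λ a x y z w → a :* (x :* (x :- z) :+ y :* (y :- w))
               := x :* (a :* (x :- z)) :+ y :* (a :* (y :- w))) ≈-refl (A i j) (u i) (v i) (u j) (v j)) ⟩
        ∑ (λ j → u i * (A i j * (u i - u j)) + v i * (A i j * (v i - v j)))
          ≈⟨ ≈-trans (∑-+ (λ j → u i * (A i j * (u i - u j))) (λ j → v i * (A i j * (v i - v j))))
               (+-cong (∑-*ˡ (u i) (λ j → A i j * (u i - u j))) (∑-*ˡ (v i) (λ j → A i j * (v i - v j)))) ⟩
        u i * Δ A u i + v i * Δ A v i
          ≈⟨ +-cong (*-congˡ (Δu i)) (*-congˡ (Δv i)) ⟩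
        u i * (ρ * u i - σ * v i) + v i * (σ * u i + ρ * v i)
          -- The terms in `σ` cancel, since i σ zᵢ is orthogonal to zᵢ in the plane. So ρ N i is
          -- nonnegative, and a positive N i would make ρ nonnegative.
          ≈⟨ solve 4 (λ x y r s → x :* (r :* x :- s :* y) :+ y :* (s :* x :+ r :* y)
               := r :* (x :* x :+ y :* y)) ≈-refl (u i) (v i) ρ σ ⟩
        ρ * N i ∎)
        (∑-nonNeg λ j → *-nonNeg (A-nonNeg i j) (≤-respʳ
          (solve 4 (λ x y z w → con ½ :* ((x :* x :+ y :* y :- (z :* z :+ w :* w))
               :+ ((x :- z) :* (x :- z) :+ (y :- w) :* (y :- w)))
             := x :* (x :- z) :+ y :* (y :- w)) ≈-refl (u i) (v i) (u j) (v j))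
          (½-nonNeg (+-nonNeg (x≤y⇒0≤y-x (max j)) (norm²-nonNeg (u i - u j) (v i - v j))))))) N≰0)

    maximum-principle : ∀ i → u i ≈ 0# × v i ≈ 0#
    maximum-principle i = norm²≤0⇒≈0 (≤-stable λ Nᵢ≰0 →
      ¬¬maximum N λ (m , max) → Nᵢ≰0 (≤-trans (max i) (maximum-≤0 m max)))

  *-cancelʳ-0 : ∀ {x y} → (x * y) ≈ 0# → ¬ (y ≤ 0#) → x ≈ 0#
  *-cancelʳ-0 {x} {y} xy≈0 y≰0 = ≤-antisym
    (0≤-x⇒x≤0 (*-cancelʳ-nonNeg (≤-reflexive (≈-sym (begin
      - x * y    ≈⟨ solve 2 (λ x y → :- x :* y := :- (x :* y)) ≈-refl x y ⟩
      - (x * y)  ≈⟨ -‿cong xy≈0 ⟩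
      - 0#       ≈⟨ -0#≈0# ⟩
      0#         ∎))) y≰0))
    (*-cancelʳ-nonNeg (≤-reflexive (≈-sym xy≈0)) y≰0)

-- The complex numbers

ℝ-isStableOrder : IsStableOrder ℝ-commutativeRing _≼_
ℝ-isStableOrder = record
  { isPartialOrder = record
    { isPreorder = record
      { isEquivalence = CommutativeRing.isEquivalence ℝ-commutativeRing
      ; reflexive = ≼-reflexive
      ; trans = ≼-trans }
    ; antisym = ≼-antisym }
  ; +-mono-≤ = +ℝ-mono-≼
  ; *-nonNeg = ≼-*-nonNeg
  ; *-cancelʳ-nonNeg = *ℝ-cancelʳ-nonNeg
  ; ≤-stable = ≼-stable
  ; ≰⇒≥ = ≰⇒≽ }

module 𝓡 = ℚ-Algebra ℝ-commutativeRing ℚ⟶ℝ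
module 𝓞 = Ordered ℝ-commutativeRing ℚ⟶ℝ _≼_ ℝ-isStableOrder

infix  4 _≃ᶜ_
infixl 6 _+ᶜ_
infixl 7 _*ᶜ_
infix  8 -ᶜ_

record _≃ᶜ_ (z w : ℂ) : Set where
  constructor _,_
  field
    re≃ : re z ≃ re w
    im≃ : im z ≃ im w

open _≃ᶜ_ public

_+ᶜ_ _*ᶜ_ : ℂ → ℂ → ℂ
_+ᶜ_ = RawRing._+_ ℂ-rawRing
_*ᶜ_ = RawRing._*_ ℂ-rawRing

-ᶜ_ : ℂ → ℂ
-ᶜ_ = RawRing.-_ ℂ-rawRing

ℂ-commutativeRing : CommutativeRing 0ℓ 0ℓ
ℂ-commutativeRing = record
  { Carrier = ℂ ; _≈_ = _≃ᶜ_ ; _+_ = _+ᶜ_ ; _*_ = _*ᶜ_ ; -_ = -ᶜ_ ; 0# = fromℝ 0ℝ ; 1# = fromℝ 1ℝ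
  ; isCommutativeRing = record
    { isRing = record
      { +-isAbelianGroup = record
        { isGroup = record
          { isMonoid = record
            { isSemigroup = record
              { isMagma = record
                { isEquivalence = record
                  { refl = ≈-refl , ≈-refl
                  ; sym = λ (p , q) → ≈-sym p , ≈-sym q
                  ; trans = λ (p , q) (p′ , q′) → ≈-trans p p′ , ≈-trans q q′ }
                ; ∙-cong = λ (p , q) (p′ , q′) → +-cong p p′ , +-cong q q′ }
              ; assoc = λ x y z → +-assoc (re x) (re y) (re z) , +-assoc (im x) (im y) (im z) }
            ; identity = (λ x → +-identityˡ (re x) , +-identityˡ (im x))
                       , (λ x → +-identityʳ (re x) , +-identityʳ (im x)) }
          ; inverse = (λ x → -‿inverseˡ (re x) , -‿inverseˡ (im x))
                    , (λ x → -‿inverseʳ (re x) , -‿inverseʳ (im x))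
          ; ⁻¹-cong = λ (p , q) → -‿cong p , -‿cong q }
        ; comm = λ x y → +-comm (re x) (re y) , +-comm (im x) (im y) }
      ; *-cong = λ (p , q) (p′ , q′) →
          +-cong (*-cong p p′) (-‿cong (*-cong q q′)) , +-cong (*-cong p q′) (*-cong q p′)
      ; *-assoc = λ x y z →
          solve 6 (λ a b c d e f → (a :* c :- b :* d) :* e :- (a :* d :+ b :* c) :* f
                                := a :* (c :* e :- d :* f) :- b :* (c :* f :+ d :* e)) ≈-refl
            (re x) (im x) (re y) (im y) (re z) (im z)
        , solve 6 (λ a b c d e f → (a :* c :- b :* d) :* f :+ (a :* d :+ b :* c) :* e
                                := a :* (c :* f :+ d :* e) :+ b :* (c :* e :- d :* f)) ≈-refl
            (re x) (im x) (re y) (im y) (re z) (im z)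
      ; *-identity = (λ x →
          solve 2 (λ a b → con 1ℚ :* a :- con 0ℚ :* b := a) ≈-refl (re x) (im x)
        , solve 2 (λ a b → con 1ℚ :* b :+ con 0ℚ :* a := b) ≈-refl (re x) (im x))
        , (λ x →
          solve 2 (λ a b → a :* con 1ℚ :- b :* con 0ℚ := a) ≈-refl (re x) (im x)
        , solve 2 (λ a b → a :* con 0ℚ :+ b :* con 1ℚ := b) ≈-refl (re x) (im x))
      ; distrib = (λ x y z →
          solve 6 (λ a b c d e f → a :* (c :+ e) :- b :* (d :+ f)
                                := (a :* c :- b :* d) :+ (a :* e :- b :* f)) ≈-refl
            (re x) (im x) (re y) (im y) (re z) (im z)
        , solve 6 (λ a b c d e f → a :* (d :+ f) :+ b :* (c :+ e)
                                := (a :* d :+ b :* c) :+ (a :* f :+ b :* e)) ≈-refl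
            (re x) (im x) (re y) (im y) (re z) (im z))
        , (λ x y z →
          solve 6 (λ a b c d e f → (c :+ e) :* a :- (d :+ f) :* b
                                := (c :* a :- d :* b) :+ (e :* a :- f :* b)) ≈-refl
            (re x) (im x) (re y) (im y) (re z) (im z)
        , solve 6 (λ a b c d e f → (c :+ e) :* b :+ (d :+ f) :* a
                                := (c :* b :+ d :* a) :+ (e :* b :+ f :* a)) ≈-refl
            (re x) (im x) (re y) (im y) (re z) (im z)) }
    ; *-comm = λ x y →
        solve 4 (λ a b c d → a :* c :- b :* d := c :* a :- d :* b) ≈-refl (re x) (im x) (re y) (im y)
      , solve 4 (λ a b c d → a :* d :+ b :* c := c :* b :+ d :* a) ≈-refl (re x) (im x) (re y) (im y) } }
  where open 𝓡

fromℝ-cong : ∀ {x y} → x ≃ y → fromℝ x ≃ᶜ fromℝ y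
fromℝ-cong x≃y = x≃y , ≃-refl

fromℝ-+ : ∀ x y → fromℝ (x +ℝ y) ≃ᶜ fromℝ x +ᶜ fromℝ y
fromℝ-+ x y = ≃-refl , pointwise λ _ → refl

fromℝ-neg : ∀ x → fromℝ (-ℝ x) ≃ᶜ -ᶜ fromℝ x
fromℝ-neg x = ≃-refl , pointwise λ _ → refl

fromℝ-* : ∀ x y → fromℝ (x *ℝ y) ≃ᶜ fromℝ x *ᶜ fromℝ y
fromℝ-* x y = solve 2 (λ x y → x :* y := x :* y :- con 0ℚ :* con 0ℚ) ≈-refl x y
            , solve 2 (λ x y → con 0ℚ := x :* con 0ℚ :+ con 0ℚ :* y) ≈-refl x y
  where open 𝓡

ℚ⟶ℂ : ℚ.+-*-rawRing -Raw-AlmostCommutative⟶ fromCommutativeRing ℂ-commutativeRing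
ℚ⟶ℂ = record
  { ⟦_⟧ = λ q → fromℝ (fromℚ q)
  ; +-homo = λ p q → trans′ (fromℝ-cong (+-homo p q)) (fromℝ-+ (fromℚ p) (fromℚ q))
  ; *-homo = λ p q → trans′ (fromℝ-cong (*-homo p q)) (fromℝ-* (fromℚ p) (fromℚ q))
  ; -‿homo = λ p → trans′ (fromℝ-cong (-‿homo p)) (fromℝ-neg (fromℚ p))
  ; 0-homo = CommutativeRing.refl ℂ-commutativeRing
  ; 1-homo = CommutativeRing.refl ℂ-commutativeRing }
  where
  open _-Raw-AlmostCommutative⟶_ ℚ⟶ℝ
  trans′ = CommutativeRing.trans ℂ-commutativeRing

module 𝓒 = ℚ-Algebra ℂ-commutativeRing ℚ⟶ℂ

re-∑ : (z : ℂᴸ.Vec n) → re (ℂᴸ.∑ z) ≡ ℝᴸ.∑ (λ i → re (z i))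
re-∑ {zero}  z = refl
re-∑ {suc n} z = cong (re (z zero) +ℝ_) (re-∑ (λ i → z (suc i)))

im-∑ : (z : ℂᴸ.Vec n) → im (ℂᴸ.∑ z) ≡ ℝᴸ.∑ (λ i → im (z i))
im-∑ {zero}  z = refl
im-∑ {suc n} z = cong (im (z zero) +ℝ_) (im-∑ (λ i → z (suc i)))

∑-fromℝ : (x : ℝᴸ.Vec n) → ℂᴸ.∑ (λ i → fromℝ (x i)) ≃ᶜ fromℝ (ℝᴸ.∑ x)
∑-fromℝ {n} x = 𝓡.reflexive (re-∑ (λ i → fromℝ (x i)))
              , 𝓡.≈-trans (𝓡.reflexive (im-∑ (λ i → fromℝ (x i)))) (𝓡.∑-0 {n} λ _ → ≃-refl)

re-fromℝ* : ∀ a z → re (fromℝ a *ᶜ z) ≃ a *ℝ re z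
re-fromℝ* a z = solve 3 (λ a x y → a :* x :- con 0ℚ :* y := a :* x) ≈-refl a (re z) (im z)
  where open 𝓡

im-fromℝ* : ∀ a z → im (fromℝ a *ᶜ z) ≃ a *ℝ im z
im-fromℝ* a z = solve 3 (λ a x y → a :* y :+ con 0ℚ :* x := a :* y) ≈-refl a (re z) (im z)
  where open 𝓡

re-Δ : (A : ℝᴸ.Matrix n n) (z : ℂᴸ.Vec n) (i : Fin n) →
       re (𝓒.Δ (complexify A) z i) ≃ 𝓡.Δ A (λ j → re (z j)) i
re-Δ A z i = 𝓡.≈-trans (𝓡.reflexive (re-∑ (λ j → fromℝ (A i j) *ᶜ (z i +ᶜ -ᶜ z j))))
                       (𝓡.∑-cong λ j → re-fromℝ* (A i j) (z i +ᶜ -ᶜ z j))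

im-Δ : (A : ℝᴸ.Matrix n n) (z : ℂᴸ.Vec n) (i : Fin n) →
       im (𝓒.Δ (complexify A) z i) ≃ 𝓡.Δ A (λ j → im (z j)) i
im-Δ A z i = 𝓡.≈-trans (𝓡.reflexive (im-∑ (λ j → fromℝ (A i j) *ᶜ (z i +ᶜ -ᶜ z j))))
                       (𝓡.∑-cong λ j → im-fromℝ* (A i j) (z i +ᶜ -ᶜ z j))

nat-fromℝ : ∀ n → 𝓒.nat n ≃ᶜ fromℝ (𝓡.nat n)
nat-fromℝ zero    = 𝓒.≈-refl
nat-fromℝ (suc n) = 𝓒.≈-trans (𝓒.+-congˡ (nat-fromℝ n)) (𝓒.≈-sym (fromℝ-+ 1ℝ (𝓡.nat n)))

-- fromℕ and 𝓡.nat are multiples in two raw monoids that differ in the equality only.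
fromℕ≡nat : ∀ n → fromℕ n ≡ 𝓡.nat n
fromℕ≡nat zero    = refl
fromℕ≡nat (suc n) = cong (1ℝ +ℝ_) (fromℕ≡nat n)

-- Multiplication by the conjugate of μ reduces the claim to cancelling the real number ∣ μ ∣²,
-- which is not ≤ 0 because Re μ is nonzero.
*ᶜ-cancelˡ-0 : ∀ {μ w} → μ *ᶜ w ≃ᶜ fromℝ 0ℝ → ¬ (re μ ≃ 0ℝ) → w ≃ᶜ fromℝ 0ℝ
*ᶜ-cancelˡ-0 {μ} {w} (re≃0 , im≃0) ρ≄0 = cancel (begin
      p * (ρ * ρ + σ * σ)
        ≈⟨ solve 4 (λ ρ σ p q → p :* (ρ :* ρ :+ σ :* σ) := ρ :* (ρ :* p :- σ :* q) :+ σ :* (ρ :* q :+ σ :* p))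
             ≈-refl ρ σ p q ⟩
      ρ * (ρ * p - σ * q) + σ * (ρ * q + σ * p)
        ≈⟨ +-zero-cong (*-zeroʳ-cong ρ re≃0) (*-zeroʳ-cong σ im≃0) ⟩
      0# ∎)
  , cancel (begin
      q * (ρ * ρ + σ * σ)
        ≈⟨ solve 4 (λ ρ σ p q → q :* (ρ :* ρ :+ σ :* σ) := ρ :* (ρ :* q :+ σ :* p) :+ :- σ :* (ρ :* p :- σ :* q))
             ≈-refl ρ σ p q ⟩
      ρ * (ρ * q + σ * p) + - σ * (ρ * p - σ * q)
        ≈⟨ +-zero-cong (*-zeroʳ-cong ρ im≃0) (*-zeroʳ-cong (- σ) re≃0) ⟩
      0# ∎)
  where
  open 𝓡
  ρ = re μ ; σ = im μ ; p = re w ; q = im w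
  cancel : ∀ {x} → x * (ρ * ρ + σ * σ) ≈ 0# → x ≈ 0#
  cancel xN≈0 = 𝓞.*-cancelʳ-0 xN≈0 λ N≤0 → ρ≄0 (proj₁ (𝓞.norm²≤0⇒≈0 N≤0))

re-affine-eigenvalue-nonNeg :
  (A : ℝᴸ.Matrix (suc n) (suc n)) → (∀ i j → 0ℝ ≼ A i j) → ∀ μ c (w : ℂᴸ.Vec (suc n)) →
  ℂᴸ.∑ w ≃ᶜ fromℝ 0ℝ → ¬ (∀ i → w i ≃ᶜ fromℝ 0ℝ) →
  (∀ i → 𝓒.Δ (complexify A) w i ≃ᶜ μ *ᶜ w i +ᶜ c) → 0ℝ ≼ re μ
re-affine-eigenvalue-nonNeg {n} A A-nonNeg μ c w ∑w≈0 w≉0 eigen = ≼-stable λ ρ≱0 →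
  let Δz : ∀ i → Δ (complexify A) z i ≈ μ * z i
      Δz i = ≈-trans (Δ-affine (complexify A) μ c w i) (*-congˡ (eigen i))
      z≋0 : ∀ i → z i ≈ 0#
      z≋0 i = let u≈0 , v≈0 = 𝓞.maximum-principle A A-nonNeg (re μ) (im μ) ρ≱0 (λ i → re (z i)) (λ i → im (z i))
                    (λ i → ≃-trans (≃-sym (re-Δ A z i)) (re≃ (Δz i)))
                    (λ i → ≃-trans (≃-sym (im-Δ A z i)) (≃-trans (im≃ (Δz i)) (𝓡.+-comm _ _))) i
              in u≈0 , v≈0
      -- The entries of z = μ w + c add up to n c, because those of w add up to 0.
      c≈0 : c ≈ 0#
      c≈0 = begin
        c                                  ≈⟨ *-identityˡ c ⟨
        1# * c                             ≈⟨ *-congʳ (nat*1/nat n) ⟨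
        nat (suc n) * 1/nat n * c          ≈⟨ solve 3 (λ N M c → N :* M :* c := M :* (N :* c)) ≈-refl (nat (suc n)) (1/nat n) c ⟩
        1/nat n * (nat (suc n) * c)        ≈⟨ *-zeroʳ-cong (1/nat n) (begin
          nat (suc n) * c                       ≈⟨ +-identityˡ _ ⟨
          0# + nat (suc n) * c                  ≈⟨ +-cong (*-zeroʳ-cong μ ∑w≈0) (∑-const (suc n) c) ⟨
          μ * ∑ w + ∑ {suc n} (λ _ → c)         ≈⟨ +-congʳ (∑-*ˡ μ w) ⟨
          ∑ (λ i → μ * w i) + ∑ {suc n} (λ _ → c) ≈⟨ ∑-+ (λ i → μ * w i) (λ _ → c) ⟨
          ∑ z                                   ≈⟨ ∑-0 z≋0 ⟩
          0#                                    ∎) ⟩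
        0#                                 ∎
  -- What remains is μ w = 0. As `ρ≱0` also excludes Re μ = 0, the factor μ can be cancelled.
  in w≉0 λ i → *ᶜ-cancelˡ-0 {μ} {w i}
       (≈-trans (≈-sym (≈-trans (+-congˡ c≈0) (+-identityʳ (μ * w i)))) (z≋0 i))
       (λ ρ≈0 → ρ≱0 (≼-reflexive (≃-sym ρ≈0)))
  where
  open 𝓒
  z : Vec (suc n)
  z i = μ * w i + c

-- Under the complementary weights the same vector satisfies the equation with n - μ and - c in
-- place of μ and c.
re-affine-eigenvalue-≤ :
  (A : ℝᴸ.Matrix (suc n) (suc n)) → (∀ i j → A i j ≼ 1ℝ) → ∀ μ c (w : ℂᴸ.Vec (suc n)) →
  ℂᴸ.∑ w ≃ᶜ fromℝ 0ℝ → ¬ (∀ i → w i ≃ᶜ fromℝ 0ℝ) →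
  (∀ i → 𝓒.Δ (complexify A) w i ≃ᶜ μ *ᶜ w i +ᶜ c) → re μ ≼ 𝓡.nat (suc n)
re-affine-eigenvalue-≤ {n} A A≤1 μ c w ∑w≈0 w≉0 eigen =
  𝓞.0≤y-x⇒x≤y (𝓞.≤-respʳ (𝓡.+-congʳ (re≃ (nat-fromℝ (suc n))))
    (re-affine-eigenvalue-nonNeg A′ (λ i j → 𝓞.x≤y⇒0≤y-x (A≤1 i j)) (nat (suc n) - μ) (- c) w ∑w≈0 w≉0 λ i → begin
      Δ (complexify A′) w i
        ≈⟨ Δ-cong complement w i ⟩
      Δ (λ i j → 1# - complexify A i j) w i
        ≈⟨ Δ-complement (complexify A) w i ⟩
      nat (suc n) * w i - ∑ w - Δ (complexify A) w i
        ≈⟨ +-cong (+-congˡ (≈-trans (-‿cong ∑w≈0) -0#≈0#)) (-‿cong (eigen i)) ⟩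
      nat (suc n) * w i + 0# - (μ * w i + c)
        ≈⟨ +-congʳ (+-identityʳ _) ⟩
      nat (suc n) * w i - (μ * w i + c)
        ≈⟨ solve 4 (λ N μ w c → N :* w :- (μ :* w :+ c) := (N :- μ) :* w :+ :- c) ≈-refl (nat (suc n)) μ (w i) c ⟩
      (nat (suc n) - μ) * w i - c ∎))
  where
  open 𝓒
  A′ : ℝᴸ.Matrix (suc n) (suc n)
  A′ i j = 1ℝ -ℝ A i j
  complement : ∀ i j → complexify A′ i j ≈ 1# - complexify A i j
  complement i j = ≈-trans (fromℝ-+ 1ℝ (-ℝ A i j)) (+-congˡ (fromℝ-neg (A i j)))

-- Complex restrictors

≈ℂ⇒≃ᶜ : ∀ {z w} → z ≈ℂ w → z ≃ᶜ w
≈ℂ⇒≃ᶜ (p , q) = ≃-in p , ≃-in q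

≃ᶜ⇒≈ℂ : ∀ {z w} → z ≃ᶜ w → z ≈ℂ w
≃ᶜ⇒≈ℂ (p , q) = ≃-out p , ≃-out q

conj-cong : ∀ {z w} → z ≃ᶜ w → conj z ≃ᶜ conj w
conj-cong (p , q) = p , -ℝ-cong q

conj-+ : ∀ z w → conj (z +ᶜ w) ≃ᶜ conj z +ᶜ conj w
conj-+ z w = ≃-refl , solve 2 (λ a b → :- (a :+ b) := :- a :+ :- b) ≈-refl (im z) (im w)
  where open 𝓡

conj-neg : ∀ z → conj (-ᶜ z) ≃ᶜ -ᶜ conj z
conj-neg z = ≃-refl , ≃-refl

conj-fromℝ : ∀ x → conj (fromℝ x) ≃ᶜ fromℝ x
conj-fromℝ x = ≃-refl , pointwise λ _ → refl

conj-isAdditive : IsAdditive ℂ-commutativeRing conj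
conj-isAdditive = record { ⋆-cong = conj-cong ; ⋆-+ = conj-+ ; ⋆-0 = conj-fromℝ 0ℝ }

module 𝓠 = Restrictor ℂ-commutativeRing ℚ⟶ℂ conj conj-isAdditive

isometry : {Q : ℂᴸ.Matrix (suc n) n} → IsRestrictor Q → 𝓠.IsIsometryOnto𝐞⊥ Q
isometry {Q = Q} restrictor = record
  { columns-sum = λ j → 𝓒.≈-trans (𝓒.≈-sym (𝓒.𝐞· (λ i → Q i j))) (≈ℂ⇒≃ᶜ (columns⊥𝐞 j))
  ; gram = λ j k → ≈ℂ⇒≃ᶜ (orthonormal j k)
  ; onto = λ x ∑x≈0 →
      let c , x≋Qc = spanning x (≃ᶜ⇒≈ℂ (𝓒.≈-trans (𝓒.𝐞· x) ∑x≈0))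
      in c , λ i → ≈ℂ⇒≃ᶜ (x≋Qc i) }
  where open IsRestrictor restrictor

isRestrictor : {Q : ℂᴸ.Matrix (suc n) n} → 𝓠.IsIsometryOnto𝐞⊥ Q → IsRestrictor Q
isRestrictor {Q = Q} isometry = record
  { columns⊥𝐞 = λ j → ≃ᶜ⇒≈ℂ (𝓒.≈-trans (𝓒.𝐞· (λ i → Q i j)) (columns-sum j))
  ; orthonormal = λ j k → ≃ᶜ⇒≈ℂ (gram j k)
  ; spanning = λ x 𝐞·x≈0 →
      let c , x≋Qc = onto x (𝓒.≈-trans (𝓒.≈-sym (𝓒.𝐞· x)) (≈ℂ⇒≃ᶜ 𝐞·x≈0))
      in c , λ i → ≃ᶜ⇒≈ℂ (x≋Qc i) }
  where open 𝓠.IsIsometryOnto𝐞⊥ isometry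

-- Puts 1/(n + 1) in the domain of `Sqrt`. The upper bound holds because 1 - 1/(n + 1) = n/(n + 1).
1/nat-bounds : ∀ n → 0ℝ ≼ 𝓡.1/nat n × 𝓡.1/nat n ≼ 1ℝ
1/nat-bounds n = 0≤1/n , 0≤y-x⇒x≤y (≤-respʳ (begin
    nat n * 1/nat n                         ≈⟨ solve 3 (λ o n x → n :* x := (o :+ n) :* x :- o :* x) ≈-refl 1# (nat n) (1/nat n) ⟩
    nat (suc n) * 1/nat n - 1# * 1/nat n    ≈⟨ +-cong (nat*1/nat n) (-‿cong (*-identityˡ (1/nat n))) ⟩
    1# - 1/nat n                            ∎)
  (*-nonNeg (nat-nonNeg n) 0≤1/n))
  where
  open 𝓡
  open 𝓞
  0≤1/n : 0ℝ ≼ 1/nat n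
  0≤1/n = pointwise-≼ λ _ → ℚ.<⇒≤ (ℚ.positive⁻¹ (1/natℚ n) {{ℚ.1/pos⇒pos (natℚ (suc n)) {{natℚ-pos n}}}})

-- The order is suc (suc k) because g divides by the order minus one.
restrictor : ∀ k → ∃[ Q ] IsRestrictor {suc (suc k)} Q
restrictor k = Q , isRestrictor Q-isometry
  where
  open Sqrt (𝓡.1/nat (suc k)) (proj₁ (1/nat-bounds (suc k))) (proj₂ (1/nat-bounds (suc k)))
    using () renaming (√ to r; √*√ to r²)
  -- The order is k + 2, so `1/nat k` is the inverse of the order minus one, that is, of `K`.
  g : ℝ
  g = 𝓡.1/nat k *ℝ (1ℝ -ℝ r)
  K N : ℝ
  K = 𝓡.nat (suc k)
  N = 𝓡.nat (suc (suc k))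
  Kg≈1-r : K *ℝ g ≃ 1ℝ -ℝ r
  Kg≈1-r = begin
    K * (1/nat k * (1# - r))   ≈⟨ *-assoc K (1/nat k) (1# - r) ⟨
    K * 1/nat k * (1# - r)     ≈⟨ *-congʳ (nat*1/nat k) ⟩
    1# * (1# - r)              ≈⟨ *-identityˡ (1# - r) ⟩
    1# - r                     ∎
    where open 𝓡
  Kg+r≈1 : K *ℝ g +ℝ r ≃ 1ℝ
  Kg+r≈1 = begin
    K * g + r      ≈⟨ +-congʳ Kg≈1-r ⟩
    1# - r + r     ≈⟨ solve 2 (λ o r → o :- r :+ r := o) ≈-refl 1# r ⟩
    1#             ∎
    where open 𝓡
  Nr²≈1 : N *ℝ (r *ℝ r) ≃ 1ℝ
  Nr²≈1 = begin
    N * (r * r)          ≈⟨ *-congˡ r² ⟩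
    N * 1/nat (suc k)    ≈⟨ nat*1/nat (suc k) ⟩
    1#                   ∎
    where open 𝓡
  -- k (1 + r) g = (1 + r) (1 - r) = 1 - r² = k r²
  g[1+r]≈r² : g *ℝ (1ℝ +ℝ r) ≃ r *ℝ r
  g[1+r]≈r² = begin
    1/nat k * (1# - r) * (1# + r)
      ≈⟨ solve 2 (λ M r → M :* (con 1ℚ :- r) :* (con 1ℚ :+ r) := M :* (con 1ℚ :- r :* r)) ≈-refl (1/nat k) r ⟩
    1/nat k * (1# - r * r)
      ≈⟨ *-congˡ (+-congʳ Nr²≈1) ⟨
    1/nat k * (N * (r * r) - r * r)
      ≈⟨ solve 3 (λ M K r → M :* ((con 1ℚ :+ K) :* (r :* r) :- r :* r) := K :* M :* (r :* r)) ≈-refl (1/nat k) K r ⟩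
    K * 1/nat k * (r * r)
      ≈⟨ *-congʳ (nat*1/nat k) ⟩
    1# * (r * r)
      ≈⟨ *-identityˡ (r * r) ⟩
    r * r ∎
    where open 𝓡
  module Complex where
    open 𝓒
    Kg+r≈1ᶜ : nat (suc k) * fromℝ g + fromℝ r ≈ 1#
    Kg+r≈1ᶜ = begin
      nat (suc k) * fromℝ g + fromℝ r     ≈⟨ +-congʳ (*-congʳ (nat-fromℝ (suc k))) ⟩
      fromℝ K * fromℝ g + fromℝ r         ≈⟨ +-congʳ (fromℝ-* K g) ⟨
      fromℝ (K *ℝ g) + fromℝ r            ≈⟨ fromℝ-+ (K *ℝ g) r ⟨
      fromℝ (K *ℝ g +ℝ r)                 ≈⟨ fromℝ-cong Kg+r≈1 ⟩
      1#                                  ∎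
    Nr²≈1ᶜ : nat (suc (suc k)) * (fromℝ r * fromℝ r) ≈ 1#
    Nr²≈1ᶜ = begin
      nat (suc (suc k)) * (fromℝ r * fromℝ r)   ≈⟨ *-cong (nat-fromℝ (suc (suc k))) (≈-sym (fromℝ-* r r)) ⟩
      fromℝ N * fromℝ (r *ℝ r)                  ≈⟨ fromℝ-* N (r *ℝ r) ⟨
      fromℝ (N *ℝ (r *ℝ r))                     ≈⟨ fromℝ-cong Nr²≈1 ⟩
      1#                                        ∎
    g[1+r]≈r²ᶜ : fromℝ g * (1# + fromℝ r) ≈ fromℝ r * fromℝ r
    g[1+r]≈r²ᶜ = begin
      fromℝ g * (1# + fromℝ r)      ≈⟨ *-congˡ (fromℝ-+ 1ℝ r) ⟨
      fromℝ g * fromℝ (1ℝ +ℝ r)     ≈⟨ fromℝ-* g (1ℝ +ℝ r) ⟨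
      fromℝ (g *ℝ (1ℝ +ℝ r))        ≈⟨ fromℝ-cong g[1+r]≈r² ⟩
      fromℝ (r *ℝ r)                ≈⟨ fromℝ-* r r ⟩
      fromℝ r * fromℝ r             ∎
  open Complex
  open 𝓠.Reflection (suc k) (fromℝ r) (fromℝ g) (conj-fromℝ r) (conj-fromℝ g) (conj-fromℝ 1ℝ) conj-neg
    Kg+r≈1ᶜ Nr²≈1ᶜ g[1+r]≈r²ᶜ

-- Laplacians and polygonal digraphs

fromℕ-outDegree : (f : Fin n → Bool) → fromℕ ∣ tabulate f ∣ ≃ ℝᴸ.∑ (λ j → if f j then 1ℝ else 0ℝ)
fromℕ-outDegree {zero}  f = ≃-refl
fromℕ-outDegree {suc n} f with f zero
... | true  = 𝓡.+-congˡ (fromℕ-outDegree (λ j → f (suc j)))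
... | false = ≃-trans (fromℕ-outDegree (λ j → f (suc j))) (≃-sym (𝓡.+-identityˡ _))

module _ (Γ : Digraph n) where
  open Digraph Γ

  laplacian-Δ : (x : ℝᴸ.Vec n) (i : Fin n) → (laplacian Γ ℝᴸ.*ᵥ x) i ≃ 𝓡.Δ (adjacency Γ) x i
  laplacian-Δ = 𝓡.degree-Δ (adjacency Γ) (λ i → fromℕ (outDegree Γ i)) (λ i → fromℕ-outDegree (edge i))

  complexify-laplacian-Δ : (x : ℂᴸ.Vec n) (i : Fin n) →
    (complexify (laplacian Γ) ℂᴸ.*ᵥ x) i ≃ᶜ 𝓒.Δ (complexify (adjacency Γ)) x i
  complexify-laplacian-Δ x i = 𝓒.≈-trans
    (𝓒.∑-cong λ j → 𝓒.*-congʳ (entry (does (i ≟ j)) (adjacency Γ i j)))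
    (𝓒.degree-Δ (complexify (adjacency Γ)) (λ i → fromℝ (fromℕ (outDegree Γ i)))
       (λ i → 𝓒.≈-trans (fromℝ-cong (fromℕ-outDegree (edge i))) (𝓒.≈-sym (∑-fromℝ (adjacency Γ i)))) x i)
    where
    d = fromℕ (outDegree Γ i)
    entry : ∀ b a → fromℝ ((if b then d else 0ℝ) -ℝ a) ≃ᶜ (if b then fromℝ d else fromℝ 0ℝ) +ᶜ -ᶜ fromℝ a
    entry true  a = 𝓒.≈-trans (fromℝ-+ d (-ℝ a)) (𝓒.+-congˡ (fromℝ-neg a))
    entry false a = 𝓒.≈-trans (fromℝ-+ 0ℝ (-ℝ a)) (𝓒.+-congˡ (fromℝ-neg a))

  adjacency-bounds : ∀ i j → 0ℝ ≼ adjacency Γ i j × adjacency Γ i j ≼ 1ℝ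
  adjacency-bounds i j with edge i j
  ... | true  = 𝓞.0≤1 , 𝓞.≤-refl
  ... | false = 𝓞.≤-refl , 𝓞.0≤1

-- The equation that an eigenvector v of Q*LQ imposes on Q v: there is a shift by a multiple of 𝐞, because
-- Q Q* is the projection along 𝐞.
record EigenvectorOf (Γ : Digraph (suc n)) (μ : ℂ) : Set where
  field
    vector   : ℂᴸ.Vec (suc n)
    nonzero  : ¬ (∀ i → vector i ≃ᶜ fromℝ 0ℝ)
    centred  : ℂᴸ.∑ vector ≃ᶜ fromℝ 0ℝ
    shift    : ℂ
    equation : ∀ i → 𝓒.Δ (complexify (adjacency Γ)) vector i ≃ᶜ μ *ᶜ vector i +ᶜ shift

Compression : Digraph (suc n) → ℂᴸ.Matrix (suc n) n → ℂᴸ.Matrix n n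
Compression Γ Q = Q ᴴ ℂᴸ.*ₘ complexify (laplacian Γ) ℂᴸ.*ₘ Q

module _ (Γ : Digraph (suc n)) (Q : ℂᴸ.Matrix (suc n) n) (isRestr : IsRestrictor Q) where

  eigenvector : ∀ μ → ℂᴸ.IsEigenvalue (Compression Γ Q) μ → EigenvectorOf Γ μ
  eigenvector μ (v , v≉0 , eigen) = record
    { vector   = Q ℂᴸ.*ᵥ v
    ; nonzero  = λ Qv≋0 → v≉0 λ j → ≃ᶜ⇒≈ℂ {v j} {fromℝ 0ℝ} (𝓠.Q-injective iso v Qv≋0 j)
    ; centred  = 𝓠.∑-Q iso v
    ; shift    = 𝓠.mean iso (complexify (laplacian Γ) ℂᴸ.*ᵥ (Q ℂᴸ.*ᵥ v))
    ; equation = λ i → 𝓒.≈-trans (𝓒.≈-sym (complexify-laplacian-Δ Γ (Q ℂᴸ.*ᵥ v) i))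
        (𝓠.compression-eigen⁻ iso (complexify (laplacian Γ)) μ v (λ j → ≈ℂ⇒≃ᶜ {(Compression Γ Q ℂᴸ.*ᵥ v) j} {μ *ᶜ v j} (eigen j)) i) }
    where iso = isometry isRestr

  isEigenvalue : ∀ μ (w : ℂᴸ.Vec (suc n)) → ℂᴸ.∑ w ≃ᶜ fromℝ 0ℝ → ¬ (∀ i → w i ≃ᶜ fromℝ 0ℝ) →
    (∀ i → 𝓒.Δ (complexify (adjacency Γ)) w i ≃ᶜ μ *ᶜ w i) → ℂᴸ.IsEigenvalue (Compression Γ Q) μ
  isEigenvalue μ w ∑w≈0 w≉0 eigen =
      Q ᴴ ℂᴸ.*ᵥ w
    , (λ Qᴴw≋0 → w≉0 (𝓠.Q†-injective iso w ∑w≈0 λ j → ≈ℂ⇒≃ᶜ {(Q ᴴ ℂᴸ.*ᵥ w) j} {fromℝ 0ℝ} (Qᴴw≋0 j)))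
    , λ j → ≃ᶜ⇒≈ℂ {(Compression Γ Q ℂᴸ.*ᵥ (Q ᴴ ℂᴸ.*ᵥ w)) j} {μ *ᶜ (Q ᴴ ℂᴸ.*ᵥ w) j} (𝓠.compression-eigen⁺ iso (complexify (laplacian Γ)) μ w ∑w≈0
        (λ i → 𝓒.≈-trans (complexify-laplacian-Δ Γ w i) (eigen i)) j)
    where iso = isometry isRestr

re-eigenvalue-bounds : (Γ : Digraph (suc n)) → ∀ {μ} → EigenvectorOf Γ μ →
                       0ℝ ≼ re μ × re μ ≼ 𝓡.nat (suc n)
re-eigenvalue-bounds Γ {μ} e =
    re-affine-eigenvalue-nonNeg A (λ i j → proj₁ (adjacency-bounds Γ i j)) μ shift vector centred nonzero equation
  , re-affine-eigenvalue-≤ A (λ i j → proj₂ (adjacency-bounds Γ i j)) μ shift vector centred nonzero equation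
  where
  open EigenvectorOf e
  A = adjacency Γ

module _ {k} (t : ℝᴸ.Vec k) (p : ℂᴸ.Vec k) (0≤t : ∀ i → 0ℝ ≼ t i) (∑t≈1 : ℝᴸ.∑ t ≃ 1ℝ) where
  private
    z = ℂᴸ.∑ (λ i → fromℝ (t i) *ᶜ p i)

  re-combination : re z ≃ ℝᴸ.∑ (λ i → t i *ℝ re (p i))
  re-combination = ≃-trans (𝓡.reflexive (re-∑ (λ i → fromℝ (t i) *ᶜ p i)))
                           (𝓡.∑-cong λ i → re-fromℝ* (t i) (p i))

  im-combination : im z ≃ ℝᴸ.∑ (λ i → t i *ℝ im (p i))
  im-combination = ≃-trans (𝓡.reflexive (im-∑ (λ i → fromℝ (t i) *ᶜ p i)))
                           (𝓡.∑-cong λ i → im-fromℝ* (t i) (p i))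

  re-combination-nonNeg : (∀ i → 0ℝ ≼ re (p i)) → 0ℝ ≼ re z
  re-combination-nonNeg 0≤p = 𝓞.≤-respʳ (≃-sym re-combination)
    (𝓞.∑-nonNeg λ i → 𝓞.*-nonNeg (0≤t i) (0≤p i))

  re-combination-≤ : ∀ b → (∀ i → re (p i) ≼ b) → re z ≼ b
  re-combination-≤ b p≤b = 0≤y-x⇒x≤y (≤-respʳ (begin
    ∑ (λ i → t i * (b - re (p i)))
      ≈⟨ ∑-cong (λ i → solve 3 (λ t b p → t :* (b :- p) := t :* b :- t :* p) ≈-refl (t i) b (re (p i))) ⟩
    ∑ (λ i → t i * b - t i * re (p i))
      ≈⟨ ∑-- (λ i → t i * b) (λ i → t i * re (p i)) ⟩
    ∑ (λ i → t i * b) - ∑ (λ i → t i * re (p i))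
      ≈⟨ +-cong (≈-trans (∑-*ʳ b t) (≈-trans (*-congʳ ∑t≈1) (*-identityˡ b))) (-‿cong (≈-sym re-combination)) ⟩
    b - re z ∎) (∑-nonNeg λ i → *-nonNeg (0≤t i) (x≤y⇒0≤y-x (p≤b i))))
    where
    open 𝓡
    open 𝓞

  im-combination-≈0 : (∀ i → im (p i) ≃ 0ℝ) → im z ≃ 0ℝ
  im-combination-≈0 p≈0 = ≃-trans im-combination (𝓡.∑-0 λ i → 𝓡.*-zeroʳ-cong (t i) (p≈0 i))

hull-bounds : (Γ : Digraph (suc n)) (Q : ℂᴸ.Matrix (suc n) n) → IsRestrictor Q → ∀ z →
              ConvexHull (ℂᴸ.IsEigenvalue (Compression Γ Q)) z → 0ℝ ≼ re z × re z ≼ 𝓡.nat (suc n)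
hull-bounds {n} Γ Q isRestr z (_ , t , p , 0≤t , ∑t≈1 , eigen , z≈ , _) =
    𝓞.≤-respʳ (≃-sym z≃) (re-combination-nonNeg t p 0≼t ∑t≃1 (λ i → proj₁ (bounds i)))
  , 𝓞.≤-respˡ (≃-sym z≃) (re-combination-≤ t p 0≼t ∑t≃1 (𝓡.nat (suc n)) (λ i → proj₂ (bounds i)))
  where
  0≼t : ∀ i → 0ℝ ≼ t i
  0≼t i = ≼-in (0≤t i)
  ∑t≃1 : ℝᴸ.∑ t ≃ 1ℝ
  ∑t≃1 = ≃-in ∑t≈1
  z≃ : re z ≃ re (ℂᴸ.∑ (λ i → fromℝ (t i) *ᶜ p i))
  z≃ = ≃-in z≈
  bounds : ∀ i → 0ℝ ≼ re (p i) × re (p i) ≼ 𝓡.nat (suc n)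
  bounds i = re-eigenvalue-bounds Γ (eigenvector Γ Q isRestr (p i) (eigen i))

-- The upper bound for the spread

embed : ℝᴸ.Vec n → ℂᴸ.Vec n
embed x i = fromℝ (x i)

embed-unitPerp : (x : ℝᴸ.Vec n) → UnitPerp𝐞ℝ x → UnitPerp𝐞ℂ (embed x)
embed-unitPerp x (𝐞·x≈0 , x·x≈1) =
    ≃ᶜ⇒≈ℂ (begin
      𝐞 · embed x       ≈⟨ 𝐞· (embed x) ⟩
      ∑ (embed x)       ≈⟨ ∑-fromℝ x ⟩
      fromℝ (ℝᴸ.∑ x)    ≈⟨ fromℝ-cong (≃-trans (≃-sym (𝓡.𝐞· x)) (≃-in 𝐞·x≈0)) ⟩
      0#                ∎)
  , ≃ᶜ⇒≈ℂ (begin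
      ∑ (λ i → conj (fromℝ (x i)) * fromℝ (x i))
        ≈⟨ ∑-cong (λ i → ≈-trans (*-congʳ (conj-fromℝ (x i))) (≈-sym (fromℝ-* (x i) (x i)))) ⟩
      ∑ (λ i → fromℝ (x i *ℝ x i))
        ≈⟨ ∑-fromℝ (λ i → x i *ℝ x i) ⟩
      fromℝ (x ℝᴸ.· x)
        ≈⟨ fromℝ-cong (≃-in x·x≈1) ⟩
      1# ∎)
  where open 𝓒

embed-form : (M : ℝᴸ.Matrix n n) (x : ℝᴸ.Vec n) →
  conjᵥ (embed x) ℂᴸ.· (complexify M ℂᴸ.*ᵥ embed x) ≃ᶜ fromℝ (x ℝᴸ.· (M ℝᴸ.*ᵥ x))
embed-form M x = begin
  ∑ (λ i → conj (fromℝ (x i)) * ∑ (λ j → fromℝ (M i j) * fromℝ (x j)))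
    ≈⟨ ∑-cong (λ i → *-cong (conj-fromℝ (x i)) (≈-trans
         (∑-cong λ j → ≈-sym (fromℝ-* (M i j) (x j))) (∑-fromℝ (λ j → M i j *ℝ x j)))) ⟩
  ∑ (λ i → fromℝ (x i) * fromℝ ((M ℝᴸ.*ᵥ x) i))
    ≈⟨ ∑-cong (λ i → ≈-sym (fromℝ-* (x i) ((M ℝᴸ.*ᵥ x) i))) ⟩
  ∑ (λ i → fromℝ (x i *ℝ (M ℝᴸ.*ᵥ x) i))
    ≈⟨ ∑-fromℝ (λ i → x i *ℝ (M ℝᴸ.*ᵥ x) i) ⟩
  fromℝ (x ℝᴸ.· (M ℝᴸ.*ᵥ x)) ∎
  where open 𝓒

module _ {k} (Γ : Digraph (suc (suc k))) (polygonal : Polygonal Γ) where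

  -- A real unit vector is also a complex one, so the value of the form is a point of W_r. The
  -- concrete restrictor places it in a hull of eigenvalues, whose real parts are bounded.
  restrictedForm-bounds : ∀  r → RestrictedForm Γ r → 0ℝ ≼ r × r ≼ 𝓡.nat (suc (suc k))
  restrictedForm-bounds r (x , unitPerp , r≈) =
    let Q , restr = restrictor k
        hull = proj₁ (polygonal Q restr) {z} (embed x , embed-unitPerp x unitPerp , ≃ᶜ⇒≈ℂ {z} {z} 𝓒.≈-refl)
        0≤z , z≤N = hull-bounds Γ Q restr z hull
    in 𝓞.≤-respʳ (≃-sym r≃) 0≤z , 𝓞.≤-respˡ (≃-sym r≃) z≤N
    where
    z : ℂ
    z = conjᵥ (embed x) ℂᴸ.· (complexify (laplacian Γ) ℂᴸ.*ᵥ embed x)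
    r≃ : r ≃ re z
    r≃ = ≃-trans (≃-in {r} {x ℝᴸ.· (laplacian Γ ℝᴸ.*ᵥ x)} r≈) (≃-sym (re≃ (embed-form (laplacian Γ) x)))

  spread≤order : ∀ s → IsSpread Γ s → s ≤ℝ fromℕ (suc (suc k))
  spread≤order s (α , β , (α∈ , _) , (β∈ , _) , s≈β-α) = ≼-out (subst (s ≼_) (sym (fromℕ≡nat (suc (suc k))))
    (≼-trans (≼-reflexive (≃-in s≈β-α)) (≼-trans
      (𝓞.0≤y-x⇒x≤y (𝓞.≤-respʳ (solve 2 (λ α β → α := β :- (β :- α)) ≈-refl α β)
        (proj₁ (restrictedForm-bounds α α∈))))
      (proj₂ (restrictedForm-bounds β β∈)))))
    where open 𝓡

-- Digraphs attaining the bound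

-- On 𝐞⊥ the Laplacian of such a digraph is n times the diagonal 0-1 matrix of `f`, which makes its
-- form and its extreme eigenvectors explicit.
fullOutDegrees : (Fin n → Bool) → Digraph n
fullOutDegrees f = record
  { edge     = λ i j → f i ∧ not (does (i ≟ j))
  ; loopless = λ i → trans (cong (λ b → f i ∧ not b) (dec-true (i ≟ i) refl)) (∧-zeroʳ (f i)) }

module FullOutDegrees (R : CommutativeRing 0ℓ 0ℓ)
                      (ℚ⟶R : ℚ.+-*-rawRing -Raw-AlmostCommutative⟶ fromCommutativeRing R)
                      {n} (f : Fin n → Bool) where
  open ℚ-Algebra R ℚ⟶R
  open Digraph (fullOutDegrees f)

  A : Matrix n n
  A i j = if edge i j then 1# else 0#

  τ : Vec n
  τ i = if f i then 1# else 0#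

  -- The absent loop at i makes no difference, because its factor `x i - x i` is 0.
  A-*- : (x : Vec n) → ∀ i j → A i j * (x i - x j) ≈ τ i * (x i - x j)
  A-*- x i j with f i | i ≟ j
  ... | false | _        = ≈-refl
  ... | true  | no _     = ≈-refl
  ... | true  | yes refl = ≈-trans (zeroˡ (x i - x i)) (≈-sym (*-zeroʳ-cong 1# (-‿inverseʳ (x i))))

  Δ-𝐞⊥ : (x : Vec n) → ∑ x ≈ 0# → ∀ i → Δ A x i ≈ nat n * (τ i * x i)
  Δ-𝐞⊥ x ∑x≈0 i = begin
    ∑ (λ j → A i j * (x i - x j))
      ≈⟨ ∑-cong (A-*- x i) ⟩
    ∑ (λ j → τ i * (x i - x j))
      ≈⟨ ∑-*ˡ (τ i) (λ j → x i - x j) ⟩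
    τ i * ∑ (λ j → x i - x j)
      ≈⟨ *-congˡ (∑-- (λ _ → x i) x) ⟩
    τ i * (∑ {n} (λ _ → x i) - ∑ x)
      ≈⟨ *-congˡ (+-cong (∑-const n (x i)) (≈-trans (-‿cong ∑x≈0) -0#≈0#)) ⟩
    τ i * (nat n * x i + 0#)
      ≈⟨ *-congˡ (+-identityʳ _) ⟩
    τ i * (nat n * x i)
      ≈⟨ solve 3 (λ t N x → t :* (N :* x) := N :* (t :* x)) ≈-refl (τ i) (nat n) (x i) ⟩
    nat n * (τ i * x i) ∎

  -- At y = ∣ x ∣² for a unit vector x in 𝐞⊥, `weight` and `coweight` are the barycentric
  -- coordinates of x*Lx with respect to n and 0.
  weight : Vec (n) → Carrier
  weight y = ∑ (λ i → τ i * y i)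

  coweight : Vec (n) → Carrier
  coweight y = ∑ (λ i → (1# - τ i) * y i)

  coweight+weight : ∀ y → coweight y + weight y ≈ ∑ y
  coweight+weight y = ≈-trans (≈-sym (∑-+ (λ i → (1# - τ i) * y i) (λ i → τ i * y i)))
    (∑-cong λ i → ≈-trans (solve 3 (λ o t y → (o :- t) :* y :+ t :* y := o :* y) ≈-refl 1# (τ i) (y i))
                           (*-identityˡ (y i)))

  -- The left vector is kept separate so that it can be x itself over ℝ and the conjugate of x over
  -- ℂ.
  form : (x y : Vec (n)) → ∑ x ≈ 0# →
    ∑ (λ i → y i * Δ A x i) ≈ nat (n) * weight (λ i → y i * x i)
  form x y ∑x≈0 = ≈-trans
    (∑-cong λ i → ≈-trans (*-congˡ (Δ-𝐞⊥ x ∑x≈0 i))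
      (solve 4 (λ y N t x → y :* (N :* (t :* x)) := N :* (t :* (y :* x))) ≈-refl (y i) (nat (n)) (τ i) (x i)))
    (∑-*ˡ (nat (n)) (λ i → τ i * (y i * x i)))

module _ {n} (f : Fin n → Bool) where
  private
    Γ : Digraph n
    Γ = fullOutDegrees f

    N : ℝ
    N = 𝓡.nat n

    L : ℝᴸ.Matrix n n
    L = laplacian Γ

    module 𝓢 = FullOutDegrees ℝ-commutativeRing ℚ⟶ℝ f
    module 𝓣 = FullOutDegrees ℂ-commutativeRing ℚ⟶ℂ f

  form-ℝ : (x : ℝᴸ.Vec n) → ℝᴸ.∑ x ≃ 0ℝ →
           x ℝᴸ.· (L ℝᴸ.*ᵥ x) ≃ N *ℝ 𝓢.weight (λ i → x i *ℝ x i)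
  form-ℝ x ∑x≈0 = ≃-trans (𝓡.∑-cong {x = λ i → x i *ℝ (L ℝᴸ.*ᵥ x) i} {y = λ i → x i *ℝ 𝓡.Δ (adjacency Γ) x i}
                              λ i → 𝓡.*-congˡ (laplacian-Δ Γ x i))
                          (𝓢.form x x ∑x≈0)

  complexify-adjacency : ∀ i j → complexify (adjacency Γ) i j ≃ᶜ 𝓣.A i j
  complexify-adjacency i j with Digraph.edge Γ i j
  ... | true  = 𝓒.≈-refl
  ... | false = 𝓒.≈-refl

  Δ-ℂ : (z : ℂᴸ.Vec n) → ℂᴸ.∑ z ≃ᶜ fromℝ 0ℝ → ∀ i →
        𝓒.Δ (complexify (adjacency Γ)) z i ≃ᶜ 𝓒.nat n *ᶜ (𝓣.τ i *ᶜ z i)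
  Δ-ℂ z ∑z≈0 i = 𝓒.≈-trans (𝓒.Δ-cong complexify-adjacency z i) (𝓣.Δ-𝐞⊥ z ∑z≈0 i)

  ∣_∣² : ℂᴸ.Vec n → ℝᴸ.Vec n
  ∣ z ∣² i = 𝓞.norm² (re (z i)) (im (z i))

  conj-* : ∀ z → conj z *ᶜ z ≃ᶜ fromℝ (𝓞.norm² (re z) (im z))
  conj-* z = solve 2 (λ a b → a :* a :- :- b :* b := a :* a :+ b :* b) ≈-refl (re z) (im z)
           , solve 2 (λ a b → a :* b :+ :- b :* a := con 0ℚ) ≈-refl (re z) (im z)
    where open 𝓡

  conj·-ℂ : (z : ℂᴸ.Vec n) → conjᵥ z ℂᴸ.· z ≃ᶜ fromℝ (ℝᴸ.∑ ∣ z ∣²)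
  conj·-ℂ z = 𝓒.≈-trans (𝓒.∑-cong λ i → conj-* (z i)) (∑-fromℝ ∣ z ∣²)

  τ-fromℝ : ∀ i → 𝓣.τ i ≃ᶜ fromℝ (𝓢.τ i)
  τ-fromℝ i with f i
  ... | true  = 𝓒.≈-refl
  ... | false = 𝓒.≈-refl

  form-ℂ : (z : ℂᴸ.Vec n) → ℂᴸ.∑ z ≃ᶜ fromℝ 0ℝ →
           ℂᴸ.∑ (λ i → conj (z i) *ᶜ 𝓒.Δ (complexify (adjacency Γ)) z i) ≃ᶜ fromℝ (N *ℝ 𝓢.weight ∣ z ∣²)
  form-ℂ z ∑z≈0 = begin
    ∑ (λ i → conj (z i) * Δ (complexify (adjacency Γ)) z i)
      ≈⟨ ∑-cong (λ i → *-congˡ (Δ-cong complexify-adjacency z i)) ⟩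
    ∑ (λ i → conj (z i) * Δ 𝓣.A z i)
      ≈⟨ 𝓣.form z (conjᵥ z) ∑z≈0 ⟩
    nat n * ∑ (λ i → 𝓣.τ i * (conj (z i) * z i))
      ≈⟨ *-cong (nat-fromℝ n) (∑-cong λ i → ≈-trans (*-cong (τ-fromℝ i) (conj-* (z i)))
                                                   (≈-sym (fromℝ-* (𝓢.τ i) (∣ z ∣² i)))) ⟩
    fromℝ N * ∑ (λ i → fromℝ (𝓢.τ i *ℝ ∣ z ∣² i))
      ≈⟨ *-congˡ (∑-fromℝ (λ i → 𝓢.τ i *ℝ ∣ z ∣² i)) ⟩
    fromℝ N * fromℝ (𝓢.weight ∣ z ∣²)
      ≈⟨ fromℝ-* N (𝓢.weight ∣ z ∣²) ⟨
    fromℝ (N *ℝ 𝓢.weight ∣ z ∣²) ∎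
    where open 𝓒

  τ-bounds : ∀ i → 0ℝ ≼ 𝓢.τ i × 𝓢.τ i ≼ 1ℝ
  τ-bounds i with f i
  ... | true  = 𝓞.0≤1 , 𝓞.≤-refl
  ... | false = 𝓞.≤-refl , 𝓞.0≤1

  weight-nonNeg : {y : ℝᴸ.Vec n} → (∀ i → 0ℝ ≼ y i) → 0ℝ ≼ 𝓢.weight y
  weight-nonNeg 0≤y = 𝓞.∑-nonNeg λ i → 𝓞.*-nonNeg (proj₁ (τ-bounds i)) (0≤y i)

  coweight-nonNeg : {y : ℝᴸ.Vec n} → (∀ i → 0ℝ ≼ y i) → 0ℝ ≼ 𝓢.coweight y
  coweight-nonNeg 0≤y = 𝓞.∑-nonNeg λ i → 𝓞.*-nonNeg (𝓞.x≤y⇒0≤y-x (proj₂ (τ-bounds i))) (0≤y i)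

-- An eigenvector in 𝐞⊥ for 0 needs two sinks to carry 1 and -1, and one for n needs two vertices
-- that are not sinks. Hence four vertices.
twoSinks : Fin (4 ℕ.+ m) → Bool
twoSinks zero          = false
twoSinks (suc zero)    = false
twoSinks (suc (suc _)) = true

module Pairs (R : CommutativeRing 0ℓ 0ℓ)
             (ℚ⟶R : ℚ.+-*-rawRing -Raw-AlmostCommutative⟶ fromCommutativeRing R) (m : ℕ) where
  open ℚ-Algebra R ℚ⟶R
  open FullOutDegrees R ℚ⟶R (twoSinks {m})

  -- A combination of the two extreme eigenvectors: `a` sits on the sinks and `b` on two other
  -- vertices, so only `b` contributes to `weight`.
  pairs : Carrier → Carrier → Vec (4 ℕ.+ m)
  pairs a b zero                   = a
  pairs a b (suc zero)             = - a
  pairs a b (suc (suc zero))       = b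
  pairs a b (suc (suc (suc zero))) = - b
  pairs a b (suc (suc (suc (suc _)))) = 0#

  ∑-first-four : (y : Vec (4 ℕ.+ m)) → (∀ i → y (suc (suc (suc (suc i)))) ≈ 0#) →
    ∑ y ≈ y zero + (y (suc zero) + (y (suc (suc zero)) + (y (suc (suc (suc zero))) + 0#)))
  ∑-first-four y rest≈0 = +-congˡ (+-congˡ (+-congˡ (+-congˡ (∑-0 rest≈0))))

  ∑-pairs : ∀ a b → ∑ (pairs a b) ≈ 0#
  ∑-pairs a b = ≈-trans (∑-first-four (pairs a b) λ _ → ≈-refl)
    (solve 3 (λ a b o → a :+ (:- a :+ (b :+ (:- b :+ o))) := o) ≈-refl a b 0#)

  pairs·pairs : ∀ a b → pairs a b · pairs a b ≈ (a * a + a * a) + (b * b + b * b)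
  pairs·pairs a b = ≈-trans (∑-first-four (λ i → pairs a b i * pairs a b i) λ _ → zeroˡ 0#) (≈-trans
    (solve 3 (λ a b o → a :* a :+ (:- a :* :- a :+ (b :* b :+ (:- b :* :- b :+ o)))
                     := (a :* a :+ a :* a) :+ (b :* b :+ b :* b) :+ o) ≈-refl a b 0#)
    (+-identityʳ _))

  weight-pairs : ∀ a b → weight (λ i → pairs a b i * pairs a b i) ≈ b * b + b * b
  weight-pairs a b = ≈-trans
    (∑-first-four (λ i → τ i * (pairs a b i * pairs a b i)) λ _ → *-zeroʳ-cong 1# (zeroˡ 0#))
    (≈-trans (+-cong (zeroˡ _) (+-cong (zeroˡ _) (+-cong (*-identityˡ _) (+-congʳ (*-identityˡ _)))))
      (≈-trans (solve 2 (λ b o → o :+ (o :+ (b :* b :+ (:- b :* :- b :+ o))) := b :* b :+ b :* b :+ (o :+ o :+ o))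
                  ≈-refl b 0#)
        (≈-trans (+-congˡ (+-zero-cong (+-identityˡ 0#) ≈-refl)) (+-identityʳ _))))

  τ*pairs₀ : ∀ a i → τ i * pairs a 0# i ≈ 0#
  τ*pairs₀ a zero                       = zeroˡ a
  τ*pairs₀ a (suc zero)                 = zeroˡ (- a)
  τ*pairs₀ a (suc (suc zero))           = zeroʳ 1#
  τ*pairs₀ a (suc (suc (suc zero)))     = *-zeroʳ-cong 1# -0#≈0#
  τ*pairs₀ a (suc (suc (suc (suc _))))  = zeroʳ 1#

  τ*pairs₁ : ∀ b i → τ i * pairs 0# b i ≈ pairs 0# b i
  τ*pairs₁ b zero             = zeroˡ 0#
  τ*pairs₁ b (suc zero)       = ≈-trans (zeroˡ (- 0#)) (≈-sym -0#≈0#)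
  τ*pairs₁ b (suc (suc i))    = *-identityˡ (pairs 0# b (suc (suc i)))

-- The shift contributes c times the conjugate of the sum of w, which is 0. So μ is a Rayleigh
-- quotient even though w need not be an eigenvector of L.
conj·affine : ∀ {n} (μ c : ℂ) (w : ℂᴸ.Vec n) → ℂᴸ.∑ w ≃ᶜ fromℝ 0ℝ → {v : ℂᴸ.Vec n} →
              (∀ i → v i ≃ᶜ μ *ᶜ w i +ᶜ c) → conjᵥ w ℂᴸ.· v ≃ᶜ μ *ᶜ (conjᵥ w ℂᴸ.· w)
conj·affine μ c w ∑w≈0 {v} v≈ = begin
  ∑ (λ i → conj (w i) * v i)
    ≈⟨ ∑-cong (λ i → ≈-trans (*-congˡ (v≈ i))
         (solve 4 (λ w′ w μ c → w′ :* (μ :* w :+ c) := μ :* (w′ :* w) :+ w′ :* c) ≈-refl (conj (w i)) (w i) μ c)) ⟩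
  ∑ (λ i → μ * (conj (w i) * w i) + conj (w i) * c)
    ≈⟨ ∑-+ (λ i → μ * (conj (w i) * w i)) (λ i → conj (w i) * c) ⟩
  ∑ (λ i → μ * (conj (w i) * w i)) + ∑ (λ i → conj (w i) * c)
    ≈⟨ +-cong (∑-*ˡ μ (λ i → conj (w i) * w i)) (∑-*ʳ c (conjᵥ w)) ⟩
  μ * ∑ (λ i → conj (w i) * w i) + ∑ (conjᵥ w) * c
    ≈⟨ +-congˡ (≈-trans (*-congʳ (≈-trans (≈-sym (𝓠.⋆-∑ w)) (≈-trans (conj-cong ∑w≈0) (conj-fromℝ 0ℝ)))) (zeroˡ c)) ⟩
  μ * ∑ (λ i → conj (w i) * w i) + 0#
    ≈⟨ +-identityʳ _ ⟩
  μ * ∑ (λ i → conj (w i) * w i) ∎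
  where open 𝓒

1≄0 : ¬ (1ℝ ≃ 0ℝ)
1≄0 1≃0 = ≼⇒≯ (≼-reflexive 1≃0) (<-in {gap = 1ℚ} (ℚ.positive⁻¹ 1ℚ) (always λ _ → ℚ.≤-refl))

module _ {k} (f : Fin (suc k) → Bool) where
  private
    N : ℝ
    N = 𝓡.nat (suc k)

    L : ℝᴸ.Matrix (suc k) (suc k)
    L = laplacian (fullOutDegrees f)

    module 𝓢 = FullOutDegrees ℝ-commutativeRing ℚ⟶ℝ f
    module 𝓣 = FullOutDegrees ℂ-commutativeRing ℚ⟶ℂ f

  0≼N : 0ℝ ≼ N
  0≼N = 𝓞.nat-nonNeg (suc k)

  restrictedForm-fullOutDegrees : ∀ r → RestrictedForm (fullOutDegrees f) r → 0ℝ ≼ r × r ≼ N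
  restrictedForm-fullOutDegrees r (x , (𝐞·x≈0 , x·x≈1) , r≈) =
      ≤-respʳ (≃-sym r≃NT) (*-nonNeg 0≼N (weight-nonNeg f 0≤x²))
    , 0≤y-x⇒x≤y (≤-respʳ (begin
        N * S                    ≈⟨ solve 3 (λ N S T → N :* S := N :* (S :+ T) :- N :* T) ≈-refl N S T ⟩
        N * (S + T) - N * T      ≈⟨ +-cong (≈-trans (*-congˡ S+T≈1) (*-identityʳ N)) (-‿cong (≃-sym r≃NT)) ⟩
        N - r                    ∎) (*-nonNeg 0≼N (coweight-nonNeg f 0≤x²)))
    where
    open 𝓡
    open 𝓞
    x² : ℝᴸ.Vec (suc k)
    x² i = x i *ℝ x i
    0≤x² : ∀ i → 0ℝ ≼ x² i
    0≤x² i = square-nonNeg (x i)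
    S T : ℝ
    S = 𝓢.coweight x²
    T = 𝓢.weight x²
    S+T≈1 : S +ℝ T ≃ 1ℝ
    S+T≈1 = ≃-trans (𝓢.coweight+weight x²) (≃-in {x ℝᴸ.· x} {1ℝ} x·x≈1)
    ∑x≈0 : ℝᴸ.∑ x ≃ 0ℝ
    ∑x≈0 = ≃-trans (≃-sym (𝐞· x)) (≃-in {ℝᴸ.𝐞 ℝᴸ.· x} {0ℝ} 𝐞·x≈0)
    r≃NT : r ≃ N *ℝ T
    r≃NT = ≃-trans (≃-in {r} {x ℝᴸ.· (L ℝᴸ.*ᵥ x)} r≈) (form-ℝ f x ∑x≈0)

  -- With S = `coweight` and T = `weight` of ∣ x ∣², the value is n T = S 0 + T n, and S + T = ∥ x
  -- ∥² = 1.
  range⊆hull : (E : Pred ℂ 0ℓ) → E (fromℝ 0ℝ) → E (fromℝ N) → RestrictedNumericalRange (fullOutDegrees f) ⊆ ConvexHull E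
  range⊆hull E E0 EN {z} (x , (𝐞·x≈0 , x·x≈1) , z≈) =
    2 , t , p , 0≤t , ≃-out ∑t≃1 , p∈E , ≃ᶜ⇒≈ℂ {z} {(λ i → fromℝ (t i)) ℂᴸ.· p} z≃
    where
    S T : ℝ
    S = 𝓢.coweight (∣_∣² f x)
    T = 𝓢.weight (∣_∣² f x)
    0≤x² : ∀ i → 0ℝ ≼ ∣_∣² f x i
    0≤x² i = 𝓞.norm²-nonNeg (re (x i)) (im (x i))
    t : ℝᴸ.Vec 2
    t zero       = S
    t (suc zero) = T
    p : ℂᴸ.Vec 2
    p zero       = fromℝ 0ℝ
    p (suc zero) = fromℝ N
    0≤t : ∀ i → 0ℝ ≤ℝ t i
    0≤t zero       = ≼-out (coweight-nonNeg f 0≤x²)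
    0≤t (suc zero) = ≼-out (weight-nonNeg f 0≤x²)
    p∈E : ∀ i → E (p i)
    p∈E zero       = E0
    p∈E (suc zero) = EN
    ∑x²≃1 : ℝᴸ.∑ (∣_∣² f x) ≃ 1ℝ
    ∑x²≃1 = re≃ (𝓒.≈-trans (𝓒.≈-sym (conj·-ℂ f x)) (≈ℂ⇒≃ᶜ {conjᵥ x ℂᴸ.· x} {fromℝ 1ℝ} x·x≈1))
    ∑t≃1 : ℝᴸ.∑ t ≃ 1ℝ
    ∑t≃1 = ≃-trans (𝓡.+-congˡ (𝓡.+-identityʳ T)) (≃-trans (𝓢.coweight+weight (∣_∣² f x)) ∑x²≃1)
    ∑x≈0 : ℂᴸ.∑ x ≃ᶜ fromℝ 0ℝ
    ∑x≈0 = 𝓒.≈-trans (𝓒.≈-sym (𝓒.𝐞· x)) (≈ℂ⇒≃ᶜ {ℂᴸ.𝐞 ℂᴸ.· x} {fromℝ 0ℝ} 𝐞·x≈0)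
    z≃ : z ≃ᶜ (λ i → fromℝ (t i)) ℂᴸ.· p
    z≃ = begin
      z
        ≈⟨ ≈ℂ⇒≃ᶜ {z} {conjᵥ x ℂᴸ.· (complexify L ℂᴸ.*ᵥ x)} z≈ ⟩
      ∑ (λ i → conj (x i) * (complexify L ℂᴸ.*ᵥ x) i)
        ≈⟨ ·-congˡ (conjᵥ x) (complexify-laplacian-Δ (fullOutDegrees f) x) ⟩
      ∑ (λ i → conj (x i) * Δ (complexify (adjacency (fullOutDegrees f))) x i)
        ≈⟨ form-ℂ f x ∑x≈0 ⟩
      fromℝ (N *ℝ T)
        ≈⟨ fromℝ-cong (*ℝ-comm N T) ⟩
      fromℝ (T *ℝ N)
        ≈⟨ fromℝ-* T N ⟩
      fromℝ T * fromℝ N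
        ≈⟨ +-identityʳ (fromℝ T * fromℝ N) ⟨
      fromℝ T * fromℝ N + 0#
        ≈⟨ +-identityˡ (fromℝ T * fromℝ N + 0#) ⟨
      0# + (fromℝ T * fromℝ N + 0#)
        ≈⟨ +-congʳ (zeroʳ (fromℝ S)) ⟨
      fromℝ S * 0# + (fromℝ T * fromℝ N + 0#) ∎
      where open 𝓒

  -- Pairing the equation with w gives μ ∥ w ∥² = n T, where T is the weight of ∣ w ∣². The right
  -- side is real, and ∥ w ∥² can be cancelled because w is nonzero.
  im-eigenvalue : ∀ {μ} → EigenvectorOf (fullOutDegrees f) μ → im μ ≃ 0ℝ
  im-eigenvalue {μ} e = 𝓞.*-cancelʳ-0 (begin
      im μ * M                        ≈⟨ solve 3 (λ a b m → b :* m := a :* con 0ℚ :+ b :* m) ≈-refl (re μ) (im μ) M ⟩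
      im (μ *ᶜ fromℝ M)               ≈⟨ im≃ μM≃NT ⟩
      0#                              ∎)
    λ M≤0 → nonzero λ i → let re≈0 , im≈0 = 𝓞.norm²≤0⇒≈0 (𝓞.≤-trans (𝓞.term≤∑ 0≤w² i) M≤0) in re≈0 , im≈0
    where
    open EigenvectorOf e renaming (vector to w; shift to c)
    open 𝓡
    M : ℝ
    M = ℝᴸ.∑ (∣_∣² f w)
    0≤w² : ∀ i → 0ℝ ≼ ∣_∣² f w i
    0≤w² i = 𝓞.norm²-nonNeg (re (w i)) (im (w i))
    μM≃NT : μ *ᶜ fromℝ M ≃ᶜ fromℝ (N *ℝ 𝓢.weight (∣_∣² f w))
    μM≃NT = 𝓒.≈-trans
      (𝓒.≈-sym (𝓒.≈-trans (conj·affine μ c w centred equation) (𝓒.*-congˡ (conj·-ℂ f w))))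
      (form-ℂ f w centred)

  -- The explicit substitute for connectedness of the unit sphere of 𝐞⊥: every weight between 0 and
  -- 1 comes with a vector that has it.
  module _ (attains : ∀ t → 0ℝ ≼ t → t ≼ 1ℝ →
                      ∃[ x ] 𝓡.∑ x ≃ 0ℝ × x 𝓡.· x ≃ 1ℝ × 𝓢.weight (λ i → x i *ℝ x i) ≃ t) where

    form-attains : ∀ t → 0ℝ ≼ t → t ≼ 1ℝ → ∃[ x ] UnitPerp𝐞ℝ x × N *ℝ t ≃ x ℝᴸ.· (L ℝᴸ.*ᵥ x)
    form-attains t 0≼t t≼1 =
      let x , ∑x≈0 , x·x≈1 , T≃t = attains t 0≼t t≼1
      in x , (≃-out (≃-trans (𝓡.𝐞· x) ∑x≈0) , ≃-out x·x≈1) , ≃-sym (≃-trans (form-ℝ f x ∑x≈0) (𝓡.*-congˡ T≃t))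

    restrictedForm-attains : ∀ t → 0ℝ ≼ t → t ≼ 1ℝ → ∀ r → r ≃ N *ℝ t → RestrictedForm (fullOutDegrees f) r
    restrictedForm-attains t 0≼t t≼1 r r≃Nt =
      let x , unitPerp , Nt≃ = form-attains t 0≼t t≼1
      in x , unitPerp , ≃-out (≃-trans r≃Nt Nt≃)

    isSpread-order : IsSpread (fullOutDegrees f) (fromℕ (suc k))
    isSpread-order = subst (IsSpread (fullOutDegrees f)) (sym (fromℕ≡nat (suc k)))
      ( 0ℝ , N
      , ( restrictedForm-attains 0ℝ 𝓞.≤-refl 𝓞.0≤1 0ℝ (𝓡.≈-sym (𝓡.zeroʳ N))
        , λ r r∈ → ≼-out (proj₁ (restrictedForm-fullOutDegrees r r∈)))
      , ( restrictedForm-attains 1ℝ 𝓞.0≤1 𝓞.≤-refl N (𝓡.≈-sym (𝓡.*-identityʳ N))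
        , λ r r∈ → ≼-out (proj₂ (restrictedForm-fullOutDegrees r r∈)))
      , ≃-out (𝓡.≈-sym (𝓡.≈-trans (𝓡.+-congˡ 𝓡.-0#≈0#) (𝓡.+-identityʳ N))))

    segment⊆range : ∀ z → 0ℝ ≼ re z → re z ≼ N → im z ≃ 0ℝ → RestrictedNumericalRange (fullOutDegrees f) z
    segment⊆range z 0≼z z≼N im≈0 =
      let x , unitPerp , Nt≃ = form-attains t 0≼t t≼1
          form = conjᵥ (embed x) ℂᴸ.· (complexify L ℂᴸ.*ᵥ embed x)
      in embed x , embed-unitPerp x unitPerp
       , ≃ᶜ⇒≈ℂ {z} {form} (𝓒.≈-trans (≃-trans (≃-sym Nt≃z) Nt≃ , im≈0) (𝓒.≈-sym (embed-form L x)))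
      where
      t : ℝ
      t = 𝓡.1/nat k *ℝ re z
      0≼1/N : 0ℝ ≼ 𝓡.1/nat k
      0≼1/N = proj₁ (1/nat-bounds k)
      0≼t : 0ℝ ≼ t
      0≼t = 𝓞.*-nonNeg 0≼1/N 0≼z
      Nt≃z : N *ℝ t ≃ re z
      Nt≃z = begin
        N * (1/nat k * re z)   ≈⟨ *-assoc N (1/nat k) (re z) ⟨
        N * 1/nat k * re z     ≈⟨ *-congʳ (nat*1/nat k) ⟩
        1# * re z              ≈⟨ *-identityˡ (re z) ⟩
        re z                   ∎
        where open 𝓡
      t≼1 : t ≼ 1ℝ
      t≼1 = 𝓞.0≤y-x⇒x≤y (𝓞.≤-respʳ (begin
          1/nat k * (N - re z)          ≈⟨ solve 3 (λ M N z → M :* (N :- z) := N :* M :- M :* z) ≈-refl (1/nat k) N (re z) ⟩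
          N * 1/nat k - 1/nat k * re z  ≈⟨ +-congʳ (nat*1/nat k) ⟩
          1# - t                        ∎)
        (𝓞.*-nonNeg 0≼1/N (𝓞.x≤y⇒0≤y-x z≼N)))
        where open 𝓡

    hull⊆range : (Q : ℂᴸ.Matrix (suc k) k) → IsRestrictor Q →
                 ConvexHull (ℂᴸ.IsEigenvalue (Compression (fullOutDegrees f) Q)) ⊆ RestrictedNumericalRange (fullOutDegrees f)
    hull⊆range Q isRestr {z} hull =
      let 0≼z , z≼N = hull-bounds (fullOutDegrees f) Q isRestr z hull
      in segment⊆range z 0≼z z≼N (hull-im hull)
      where
      hull-im : ConvexHull (ℂᴸ.IsEigenvalue (Compression (fullOutDegrees f) Q)) z → im z ≃ 0ℝ
      hull-im (_ , t , p , 0≤t , ∑t≈1 , eigen , _ , im≈) = ≃-trans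
        (≃-in {im z} {im ((λ i → fromℝ (t i)) ℂᴸ.· p)} im≈)
        (im-combination-≈0 t p (λ i → ≼-in (0≤t i)) (≃-in {ℝᴸ.∑ t} {1ℝ} ∑t≈1)
          (λ i → im-eigenvalue (eigenvector (fullOutDegrees f) Q isRestr (p i) (eigen i))))

    -- w₀ is supported on the sinks and w₁ on the other vertices, so `Δ-ℂ` makes them eigenvectors
    -- for the two ends of the segment. An entry equal to 1 certifies that each is nonzero.
    module _ (w₀ w₁ : ℂᴸ.Vec (suc k)) (∑w₀≈0 : 𝓒.∑ w₀ ≃ᶜ fromℝ 0ℝ) (∑w₁≈0 : 𝓒.∑ w₁ ≃ᶜ fromℝ 0ℝ)
             (w₀≉0 : ∃[ i ] w₀ i ≃ᶜ fromℝ 1ℝ) (w₁≉0 : ∃[ i ] w₁ i ≃ᶜ fromℝ 1ℝ)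
             (τw₀≈0 : ∀ i → 𝓣.τ i *ᶜ w₀ i ≃ᶜ fromℝ 0ℝ) (τw₁≈w₁ : ∀ i → 𝓣.τ i *ᶜ w₁ i ≃ᶜ w₁ i) where

      isPolygonal : Polygonal (fullOutDegrees f)
      isPolygonal Q isRestr =
          (λ {z} → range⊆hull (ℂᴸ.IsEigenvalue (Compression (fullOutDegrees f) Q))
            (isEigenvalue (fullOutDegrees f) Q isRestr (fromℝ 0ℝ) w₀ ∑w₀≈0 (contains-1⇒≉0 w₀≉0) eigen₀)
            (isEigenvalue (fullOutDegrees f) Q isRestr (fromℝ N) w₁ ∑w₁≈0 (contains-1⇒≉0 w₁≉0) eigen₁) {z})
        , (λ {z} → hull⊆range Q isRestr {z})
        where
        contains-1⇒≉0 : {w : ℂᴸ.Vec (suc k)} → ∃[ i ] w i ≃ᶜ fromℝ 1ℝ → ¬ (∀ i → w i ≃ᶜ fromℝ 0ℝ)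
        contains-1⇒≉0 (i , wᵢ≈1) w≋0 = 1≄0 (≃-trans (≃-sym (re≃ wᵢ≈1)) (re≃ (w≋0 i)))
        eigen₀ : ∀ i → 𝓒.Δ (complexify (adjacency (fullOutDegrees f))) w₀ i ≃ᶜ fromℝ 0ℝ *ᶜ w₀ i
        eigen₀ i = 𝓒.≈-trans (Δ-ℂ f w₀ ∑w₀≈0 i)
          (𝓒.≈-trans (𝓒.*-zeroʳ-cong (𝓒.nat (suc k)) (τw₀≈0 i)) (𝓒.≈-sym (𝓒.zeroˡ (w₀ i))))
        eigen₁ : ∀ i → 𝓒.Δ (complexify (adjacency (fullOutDegrees f))) w₁ i ≃ᶜ fromℝ N *ᶜ w₁ i
        eigen₁ i = 𝓒.≈-trans (Δ-ℂ f w₁ ∑w₁≈0 i) (𝓒.*-cong (nat-fromℝ (suc k)) (τw₁≈w₁ i))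

half-in-unit : ∀ {s} → 0ℝ ≼ s → s ≼ 1ℝ → 0ℝ ≼ fromℚ ½ *ℝ s × fromℚ ½ *ℝ s ≼ 1ℝ
half-in-unit {s} 0≼s s≼1 = ½-nonNeg 0≼s
  , 0≤y-x⇒x≤y (≤-respʳ (solve 1 (λ s → con ½ :* (con 1ℚ :+ (con 1ℚ :- s)) := con 1ℚ :- con ½ :* s) ≈-refl s)
      (½-nonNeg (+-nonNeg 0≤1 (x≤y⇒0≤y-x s≼1))))
  where
  open 𝓡
  open 𝓞

-- The vector `pairs a b` has squared length 2a² + 2b² and weight 2b², so a² = (1 - t)/2 and b² =
-- t/2 are forced.
twoSinks-attains : ∀ m t → 0ℝ ≼ t → t ≼ 1ℝ →
  ∃[ x ] 𝓡.∑ x ≃ 0ℝ × x 𝓡.· x ≃ 1ℝ × FullOutDegrees.weight ℝ-commutativeRing ℚ⟶ℝ (twoSinks {m}) (λ i → x i *ℝ x i) ≃ t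
twoSinks-attains m t 0≼t t≼1 =
    𝓟.pairs a b
  , 𝓟.∑-pairs a b
  , ≃-trans (𝓟.pairs·pairs a b) 2a²+2b²≃1
  , ≃-trans (𝓟.weight-pairs a b) 2b²≃t
  where
  module 𝓟 = Pairs ℝ-commutativeRing ℚ⟶ℝ m
  open 𝓡
  half-1-t : 0ℝ ≼ fromℚ ½ *ℝ (1ℝ -ℝ t) × fromℚ ½ *ℝ (1ℝ -ℝ t) ≼ 1ℝ
  half-1-t = half-in-unit (𝓞.x≤y⇒0≤y-x t≼1)
    (𝓞.0≤y-x⇒x≤y (𝓞.≤-respʳ (solve 1 (λ t → t := con 1ℚ :- (con 1ℚ :- t)) ≃-refl t) 0≼t))
  half-t : 0ℝ ≼ fromℚ ½ *ℝ t × fromℚ ½ *ℝ t ≼ 1ℝ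
  half-t = half-in-unit 0≼t t≼1
  open Sqrt (fromℚ ½ *ℝ (1ℝ -ℝ t)) (proj₁ half-1-t) (proj₂ half-1-t) using () renaming (√ to a; √*√ to a²)
  open Sqrt (fromℚ ½ *ℝ t) (proj₁ half-t) (proj₂ half-t) using () renaming (√ to b; √*√ to b²)
  halves : ∀ s → fromℚ ½ * s + fromℚ ½ * s ≈ s
  halves = solve 1 (λ s → con ½ :* s :+ con ½ :* s := s) ≈-refl
  2b²≃t : b * b + b * b ≈ t
  2b²≃t = ≈-trans (+-cong b² b²) (halves t)
  2a²+2b²≃1 : (a * a + a * a) + (b * b + b * b) ≈ 1#
  2a²+2b²≃1 = ≈-trans (+-cong (≈-trans (+-cong a² a²) (halves (1# - t))) 2b²≃t)
                      (solve 2 (λ o t → o :- t :+ t := o) ≈-refl 1# t)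

twoSinks-polygonal : ∀ m → Polygonal {suc (suc (suc (suc m)))} (fullOutDegrees (twoSinks {m}))
twoSinks-polygonal m = isPolygonal {suc (suc (suc m))} (twoSinks {m}) (twoSinks-attains m)
  (pairs 1# 0#) (pairs 0# 1#) (∑-pairs 1# 0#) (∑-pairs 0# 1#)
  (zero , ≈-refl) (suc (suc zero) , ≈-refl) (τ*pairs₀ 1#) (τ*pairs₁ 1#)
  where
  open 𝓒
  open Pairs ℂ-commutativeRing ℚ⟶ℂ m

theorem3p4 : (∀ n → 2 ≤ n → (Γ : Digraph n) → Polygonal Γ →
    ∀ s → IsSpread Γ s → s ≤ℝ fromℕ n)
    × (∀ n → 4 ≤ n → ∃[ Γ ] Polygonal {n} Γ × IsSpread Γ (fromℕ n))
theorem3p4 =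
    (λ { (suc (suc k)) (s≤s (s≤s z≤n)) Γ polygonal → spread≤order Γ polygonal })
  , λ { (suc (suc (suc (suc m)))) (s≤s (s≤s (s≤s (s≤s z≤n)))) →
        fullOutDegrees (twoSinks {m}) , twoSinks-polygonal m , isSpread-order {suc (suc (suc m))} (twoSinks {m}) (twoSinks-attains m) }
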